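{- Let $(G,X,H)$ be a degree-feasible configuration. Then $(G,X,H)$ is minimal uncolorable if and only if $(G,X,H)$ is constructible.
   Context: A hypergraph $G=(V,E,i)$ consists of finite sets $V=V(G)$ (vertices) and $E=E(G)$ (edges) and a map $i=i_G:E\to 2^V$ with $|i(e)|\ge 2$ for all $e$; distinct edges may have the same vertex set (parallel edges). An edge is ordinary if $|i(e)|=2$ and a hyperedge if $|i(e)|\ge 3$; a graph is a hypergraph with only ordinary edges. The degree $d_G(v)$ is the number of edges $e$ with $v\in i_G(e)$. For distinct $u,v$, $\mu_G(u,v)$ is the number of edges $e$ with $i_G(e)=\{u,v\}$, and $A(G)$ is the set of pairs $\{u,v\}$ with $\mu_G(u,v)\ge1$. For $Y\subseteq V(G)$, $G[Y]$ is the induced subhypergraph (vertex set $Y$, edges $e$ with $i_G(e)\subseteq Y$); $Y$ is independent if $G[Y]$ has no edges. $G$ is connected if any two vertices are joined by a hyperpath (sequence of distinct vertices $v_1,\dots,v_{q+1}$ and distinct edges $e_1,\dots,e_q$ with $\{v_j,v_{j+1}\}\subseteq i(e_j)$). A separating vertex of $G$ is a vertex $v$ such that $G$ is the union of two induced subhypergraphs $G_1,G_2$ with $V(G_1)\cap V(G_2)=\{v\}$ and $|V(G_i)|\ge2$; a block of $G$ is a maximal connected subhypergraph without separating vertex. For a simple graph $F$ and $t\ge1$, $tF$ is obtained by replacing each edge by $t$ parallel edges; $K_n$ is the complete graph, $C_n$ the cycle, $K_{(n,t)}$ the complete $n$-partite graph with all parts of size $t$, $K_{t,t}=K_{(2,t)}$.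 We write $G=\langle e\rangle$ if $E(G)=\{e\}$ and $V(G)=i_G(e)$. A cover of a hypergraph $G$ is a pair $(X,H)$ where $X$ assigns to each $v\in V(G)$ a set $X_v$, these sets pairwise disjoint, and $H$ is a hypergraph with $V(H)=\bigcup_v X_v$, each $X_v$ independent in $H$, and for each $e\in E(G)$ there is a (possibly empty) matching $M_e$ in $H[\bigcup_{v\in i_G(e)}X_v]$ (edges pairwise vertex-disjoint) with $|i_H(\tilde e)\cap X_v|=1$ for all $\tilde e\in M_e$ and $v\in i_G(e)$, and $E(H)=\bigcup_{e}M_e$. An independent transversal of $(X,H)$ is an independent set $T$ of $H$ with $|T\cap X_v|=1$ for all $v$. A feasible configuration is a triple $(G,X,H)$ with $G$ a connected hypergraph and $(X,H)$ a cover of $G$; it is degree-feasible if $|X_v|\ge d_G(v)$ for all $v$; colorable if $(X,H)$ has an independent transversal, uncolorable otherwise; minimal uncolorable if it is uncolorable but $(G,X,H-e)$ is colorable for every $e\in E(H)$. K-configuration: $G=tK_n$ ($t,n\ge1$) and each $X_v$ has a partition $(X_v^1,\dots,X_v^{n-1})$ such that for each $i$, $H^i=H[\bigcup_v X_v^i]$ is a $K_{(n,t)}$ whose parts are the sets $X_v^i$, and $H=H^1\cup\dots\cup H^{n-1}$. Odd C-configuration: $G=tC_n$, $t\ge1$, $n\ge5$ odd, each $X_v$ has a partition $(X_v^1,X_v^2)$ such that for $i\in\{1,2\}$ and $\{u,v\}\in A(G)$, $H[X_u^i\cup X_v^i]$ is a $K_{t,t}$ with parts $X_u^i,X_v^i$,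 and $H$ is the union of all these graphs. Even C-configuration: $G=tC_n$, $t\ge1$, $n\ge4$ even, each $X_v$ has a partition $(X_v^1,X_v^2)$, and there is $\{w,w'\}\in A(G)$ such that for $i\in\{1,2\}$ and every $\{u,v\}\in A(G)\setminus\{\{w,w'\}\}$, $H[X_u^i\cup X_v^i]$ is a $K_{t,t}$ with parts $X_u^i,X_v^i$; $H[X_w^1\cup X_{w'}^2]$ is a $K_{t,t}$ with parts $X_w^1,X_{w'}^2$; $H[X_w^2\cup X_{w'}^1]$ is a $K_{t,t}$ with parts $X_w^2,X_{w'}^1$; and $H$ is the union of these graphs. A C-configuration is an odd or even C-configuration. E-configuration: $G=\langle e\rangle$ for an edge $e$ of $G$, $|X_v|=1$ for all $v$, and $H\cong G$ (a single edge through all vertices of $H$). Merging: for feasible configurations $(G^1,X^1,H^1)$, $(G^2,X^2,H^2)$ with disjoint vertex sets and edge sets, vertices $v^j\in V(G^j)$ and a new vertex $v^*$, let $G$ be obtained from $G^1\cup G^2$ by identifying $v^1$ and $v^2$ into $v^*$ (every edge incident to $v^j$ now incident to $v^*$ instead), $H=H^1\cup H^2$, $X_{v^*}=X^1_{v^1}\cup X^2_{v^2}$ and $X_v=X^j_v$ for other $v\in V(G^j)$. The class of constructible configurations is the smallest class of feasible configurations containing all K-, C- and E-configurations and closed under merging. -}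

module Defs where

open import Data.Nat using (ℕ; zero; suc; _≤_; _∸_; _%_; pred)
open import Data.Bool using (Bool; true; false; _∧_)
import Data.Bool as B
open import Data.Fin using (Fin; toℕ; punchIn; _≟_)
open import Data.Fin.Subset using (Subset; _∈_; _⊆_; ∣_∣; ⁅_⁆; _∪_; _∩_; Empty; ⊤)
open import Data.Vec using (tabulate; lookup)
open import Data.Vec.Properties using (≡-dec)
open import Data.Product using (Σ; ∃; _×_; _,_)
open import Data.Empty using (⊥)
open import Data.Sum using (_⊎_; inj₁; inj₂)
open import Relation.Nullary using (¬_; does)
open import Relation.Binary.PropositionalEquality using (_≡_; _≢_)
open import Function.Bundles using (_↔_; _⇔_; Inverse)

record Hypergraph : Set where
  constructor mkHG
  field
    nV   : ℕ
    nE   : ℕ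
    inc  : Fin nE → Subset nV
    size : ∀ e → 2 ≤ ∣ inc e ∣
open Hypergraph public

degree : (G : Hypergraph) → Fin (nV G) → ℕ
degree G v = ∣ tabulate (λ e → lookup (inc G e) v) ∣

mult : (G : Hypergraph) → Fin (nV G) → Fin (nV G) → ℕ
mult G u v = ∣ tabulate (λ e → does (≡-dec B._≟_ (inc G e) (⁅ u ⁆ ∪ ⁅ v ⁆))) ∣

Adj : (G : Hypergraph) → Fin (nV G) → Fin (nV G) → Set
Adj G u v = u ≢ v × 1 ≤ mult G u v

IsGraph : Hypergraph → Set
IsGraph G = ∀ e → ∣ inc G e ∣ ≡ 2

-- connectivity: u and v joined by a hyperwalk (equivalently a hyperpath)
data Reach (G : Hypergraph) (u : Fin (nV G)) : Fin (nV G) → Set where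
  here : Reach G u u
  step : ∀ {w v} (e : Fin (nE G)) → Reach G u w →
         w ∈ inc G e → v ∈ inc G e → Reach G u v

Connected : Hypergraph → Set
Connected G = ∀ u v → Reach G u v

punchIn′ : ∀ {n} → Fin n → Fin (pred n) → Fin n
punchIn′ {suc n} i j = punchIn i j

deleteEdge : (H : Hypergraph) → Fin (nE H) → Hypergraph
deleteEdge H e = record
  { nV = nV H ; nE = pred (nE H)
  ; inc = λ e′ → inc H (punchIn′ e e′)
  ; size = λ e′ → size H (punchIn′ e e′) }

-- Configurations.  The family X = (X_v) of pairwise disjoint sets with
-- union V(H) is encoded by the map proj : V(H) → V(G), X_v = proj⁻¹(v).

record Config : Set where
  constructor mkConfig
  field
    G    : Hypergraph
    H    : Hypergraph
    proj : Fin (nV H) → Fin (nV G)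
open Config public

Xset : ∀ {n} (H : Hypergraph) → (Fin (nV H) → Fin n) → Fin n → Subset (nV H)
Xset H proj v = tabulate (λ x → does (proj x ≟ v))

X : (C : Config) → Fin (nV (G C)) → Subset (nV (H C))
X C v = Xset (H C) (proj C) v

-- (X,H) is a cover of G: each X_v independent in H, and there is a
-- family of matchings M_e (encoded by assigning each edge of H to the
-- edge e of G with ẽ ∈ M_e) with E(H) = ⋃ M_e.
IsCover : Config → Set
IsCover C =
  (∀ v ẽ → ¬ (inc (H C) ẽ ⊆ X C v)) ×
  Σ (Fin (nE (H C)) → Fin (nE (G C))) λ g →
    (∀ ẽ x → x ∈ inc (H C) ẽ → proj C x ∈ inc (G C) (g ẽ)) ×
    (∀ ẽ v → v ∈ inc (G C) (g ẽ) → ∣ inc (H C) ẽ ∩ X C v ∣ ≡ 1) ×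
    (∀ ẽ ẽ′ → ẽ ≢ ẽ′ → g ẽ ≡ g ẽ′ → Empty (inc (H C) ẽ ∩ inc (H C) ẽ′))

Feasible : Config → Set
Feasible C = Connected (G C) × IsCover C

DegreeFeasible : Config → Set
DegreeFeasible C = ∀ v → degree (G C) v ≤ ∣ X C v ∣

Colorable : ∀ {n} (H : Hypergraph) → (Fin (nV H) → Fin n) → Set
Colorable {n} H proj =
  Σ (Subset (nV H)) λ T →
    (∀ ẽ → ¬ (inc H ẽ ⊆ T)) × (∀ (v : Fin n) → ∣ T ∩ Xset H proj v ∣ ≡ 1)

MinUncolorable : Config → Set
MinUncolorable C =
  ¬ Colorable (H C) (proj C) ×
  (∀ ẽ → Colorable (deleteEdge (H C) ẽ) (proj C))

partSize : ∀ {k} (C : Config) → (Fin (nV (H C)) → Fin k) →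
           Fin (nV (G C)) → Fin k → ℕ
partSize C part v i =
  ∣ tabulate (λ x → does (proj C x ≟ v) ∧ does (part x ≟ i)) ∣

IsTK : ℕ → Hypergraph → Set
IsTK t G = IsGraph G × (∀ u v → u ≢ v → mult G u v ≡ t)

KConfig : Config → Set
KConfig C =
  Σ ℕ λ t → 1 ≤ t × 1 ≤ nV (G C) × IsTK t (G C) ×
  Σ (Fin (nV (H C)) → Fin (nV (G C) ∸ 1)) λ part →
    (∀ v i → partSize C part v i ≡ t) ×
    IsGraph (H C) ×
    (∀ x y → x ≢ y →
       ((proj C x ≢ proj C y × part x ≡ part y) → mult (H C) x y ≡ 1) ×
       (¬ (proj C x ≢ proj C y × part x ≡ part y) → mult (H C) x y ≡ 0))

Succ : (n : ℕ) → Fin n → Fin n → Set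
Succ n i j = toℕ j ≡ suc (toℕ i) ⊎ (suc (toℕ i) ≡ n × toℕ j ≡ 0)

CycAdj : (n : ℕ) → Fin n → Fin n → Set
CycAdj n i j = Succ n i j ⊎ Succ n j i

IsTC : ℕ → Hypergraph → Set
IsTC t G =
  IsGraph G ×
  Σ (Fin (nV G) ↔ Fin (nV G)) λ φ →
    ∀ i j → i ≢ j →
      (CycAdj (nV G) i j → mult G (Inverse.to φ i) (Inverse.to φ j) ≡ t) ×
      (¬ CycAdj (nV G) i j → mult G (Inverse.to φ i) (Inverse.to φ j) ≡ 0)

-- H built from K_{t,t}'s between X_u^i, X_v^j over pairs {u,v} ∈ A(G);
-- Link x y says which pairs (x,y) of H-vertices are joined.
TwoPartH : (C : Config) → ℕ → (Fin (nV (H C)) → Fin 2) →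
           (Fin (nV (H C)) → Fin (nV (H C)) → Set) → Set
TwoPartH C t part Link =
  (∀ v i → partSize C part v i ≡ t) ×
  IsGraph (H C) ×
  (∀ x y → x ≢ y →
     (Link x y → mult (H C) x y ≡ 1) ×
     (¬ Link x y → mult (H C) x y ≡ 0))

OddCConfig : Config → Set
OddCConfig C =
  Σ ℕ λ t → 1 ≤ t × 5 ≤ nV (G C) × nV (G C) % 2 ≡ 1 × IsTC t (G C) ×
  Σ (Fin (nV (H C)) → Fin 2) λ part →
    TwoPartH C t part
      (λ x y → Adj (G C) (proj C x) (proj C y) × part x ≡ part y)

EvenCConfig : Config → Set
EvenCConfig C =
  Σ ℕ λ t → 1 ≤ t × 4 ≤ nV (G C) × nV (G C) % 2 ≡ 0 × IsTC t (G C) ×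
  Σ (Fin (nV (H C)) → Fin 2) λ part →
  Σ (Fin (nV (G C))) λ w → Σ (Fin (nV (G C))) λ w′ →
    Adj (G C) w w′ ×
    TwoPartH C t part
      (λ x y → Adj (G C) (proj C x) (proj C y) ×
        (((proj C x ≡ w × proj C y ≡ w′) ⊎ (proj C x ≡ w′ × proj C y ≡ w))
           → part x ≢ part y) ×
        (¬ ((proj C x ≡ w × proj C y ≡ w′) ⊎ (proj C x ≡ w′ × proj C y ≡ w))
           → part x ≡ part y))

CConfig : Config → Set
CConfig C = OddCConfig C ⊎ EvenCConfig C

-- G = ⟨e⟩, |X_v| = 1, H ≅ G (one hyperedge through all vertices of H)
EConfig : Config → Set
EConfig C =
  Σ (nE (G C) ≡ 1) λ _ →
    (∀ e → inc (G C) e ≡ ⊤) ×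
    (∀ v → ∣ X C v ∣ ≡ 1) ×
    (nE (H C) ≡ 1) ×
    (∀ ẽ → inc (H C) ẽ ≡ ⊤)

-- Merging (up to relabelling of vertices and edges).
-- IsMerge C C₁ C₂ : C is obtained from C₁ and C₂ by identifying
-- v₁ ∈ V(G₁) and v₂ ∈ V(G₂) into one vertex v* = α v₁ = β v₂.

module _ (C C₁ C₂ : Config) where
  private
    G₀ = G C ; G₁ = G C₁ ; G₂ = G C₂
    H₀ = H C ; H₁ = H C₁ ; H₂ = H C₂

  IsMerge : Set
  IsMerge =
    Σ (Fin (nV G₁)) λ v₁ → Σ (Fin (nV G₂)) λ v₂ →
    Σ (Fin (nV G₁) → Fin (nV G₀)) λ α →
    Σ (Fin (nV G₂) → Fin (nV G₀)) λ β →
    Σ ((Fin (nE G₁) ⊎ Fin (nE G₂)) ↔ Fin (nE G₀)) λ ε →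
    Σ ((Fin (nV H₁) ⊎ Fin (nV H₂)) ↔ Fin (nV H₀)) λ γ →
    Σ ((Fin (nE H₁) ⊎ Fin (nE H₂)) ↔ Fin (nE H₀)) λ δ →
      (∀ x y → α x ≡ α y → x ≡ y) ×
      (∀ x y → β x ≡ β y → x ≡ y) ×
      α v₁ ≡ β v₂ ×
      (∀ x y → α x ≡ β y → x ≡ v₁ × y ≡ v₂) ×
      (∀ z → (∃ λ x → α x ≡ z) ⊎ (∃ λ y → β y ≡ z)) ×
      (∀ e z → (z ∈ inc G₀ (Inverse.to ε (inj₁ e)) ⇔ (∃ λ x → x ∈ inc G₁ e × α x ≡ z))) ×
      (∀ e z → (z ∈ inc G₀ (Inverse.to ε (inj₂ e)) ⇔ (∃ λ y → y ∈ inc G₂ e × β y ≡ z))) ×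
      (∀ e x → (Inverse.to γ (inj₁ x) ∈ inc H₀ (Inverse.to δ (inj₁ e)) ⇔ x ∈ inc H₁ e)) ×
      (∀ e y → (Inverse.to γ (inj₂ y) ∈ inc H₀ (Inverse.to δ (inj₁ e)) → ⊥)) ×
      (∀ e y → (Inverse.to γ (inj₂ y) ∈ inc H₀ (Inverse.to δ (inj₂ e)) ⇔ y ∈ inc H₂ e)) ×
      (∀ e x → (Inverse.to γ (inj₁ x) ∈ inc H₀ (Inverse.to δ (inj₂ e)) → ⊥)) ×
      -- X_{v*} = X¹_{v₁} ∪ X²_{v₂}, X_v = X^j_v otherwise
      (∀ x → proj C (Inverse.to γ (inj₁ x)) ≡ α (proj C₁ x)) ×
      (∀ y → proj C (Inverse.to γ (inj₂ y)) ≡ β (proj C₂ y))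

data Constructible : Config → Set where
  fromK : ∀ C → Feasible C → KConfig C → Constructible C
  fromC : ∀ C → Feasible C → CConfig C → Constructible C
  fromE : ∀ C → Feasible C → EConfig C → Constructible C
  merge : ∀ C C₁ C₂ → Constructible C₁ → Constructible C₂ →
          IsMerge C C₁ C₂ → Constructible C

{-# OPTIONS --safe #-}
-- If every vertex but v is coloured (greedily, towards v, using |X_u| ≥ d(u)), then uncolourability
-- forces each edge of G at v to block exactly one colour of v and each colour to be blocked exactly
-- once; in particular a blocked colour may be given to v while another vertex of the blocking edge
-- becomes the uncoloured one.  At a separating vertex v the set of colours blocked from either side
-- does not depend on the colouring of that side, which splits X_v and hence the configuration.  In a
-- block, moving the uncoloured vertex shows that a hyperedge of size at least 3 is the only edge.  For a
-- multigraph block, Lovász's argument makes two colours with a common neighbour adjacent whenever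
-- deleting their two vertices leaves G connected: if this always happens, H is a union of complete
-- multipartite graphs; otherwise every vertex of G has exactly two neighbours, so G is a multiple of
-- a cycle, neighbourhoods inside each X_v are equal or complementary, and uncolourability
-- decides by parity whether the two strands of H close up straight or crossed.
module Submission where

open import Data.Nat using (ℕ; zero; suc; _≤_; _<_; _+_; _∸_; _%_; pred; z≤n; s≤s; >-nonZero)
import Data.Nat.Properties as ℕ
open import Relation.Binary.Definitions using (tri<; tri≈; tri>)
open import Data.Bool using (Bool; true; false; not; _xor_)
import Data.Bool as B
import Data.Bool.Properties as Bₚ
open import Data.Fin using (Fin; zero; suc; _≟_; toℕ; fromℕ<; punchIn; punchOut)
import Data.Fin.Properties as Fₚ
open import Data.Fin.Subset using (Subset; _∈_; _∉_; _⊆_; ∣_∣; ⁅_⁆; _∪_; _∩_; _-_; Empty; Nonempty; ⊤; ⊥; inside; outside)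
import Data.Fin.Subset.Properties as Sₚ
open import Data.Vec using (tabulate; lookup; []; _∷_; here; there)
open import Data.Vec.Properties using (lookup∘tabulate; []=⇒lookup; lookup⇒[]=; ≡-dec)
open import Data.Vec.Properties.WithK using ([]=-irrelevant)
open import Data.Product using (Σ; ∃; _×_; _,_; proj₁; proj₂)
open import Data.Empty using (⊥-elim) renaming (⊥ to ⊥₀)
open import Data.Unit using (tt) renaming (⊤ to ⊤₀)
open import Data.Sum using (_⊎_; inj₁; inj₂; [_,_]′)
import Data.Sum as Sum
open import Data.Sum.Properties using (inj₁-injective; inj₂-injective)
open import Relation.Nullary using (¬_; Dec; yes; no; does)
open import Relation.Nullary.Decidable using (_×-dec_; _⊎-dec_; _→-dec_; ¬?; map′; dec-true; dec-false; does-⇔)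
open import Relation.Binary.Construct.Closure.ReflexiveTransitive using (Star; ε; _◅_; _◅◅_)
open import Relation.Unary using () renaming (Decidable to Decidable₁)
open import Relation.Binary.PropositionalEquality using (_≡_; _≢_; refl; sym; trans; cong; cong₂; subst; subst₂)
open import Function.Bundles using (_↔_; _⇔_; Inverse; Equivalence; mk↔ₛ′; mk⇔)
open import Data.Bool.Solver using (module xor-∧-Solver)
open import Defs

-- Finite sets

-- A colouring is a section of `proj` together with the set D of vertices where it counts, so
-- colouring a vertex or moving the hole is one `upd`. Tightness at the hole is a count: two edges
-- of H that block colours of v over the same edge of G share the colour of another end of it, hence
-- coincide; so the colours inject into the edges at v, and |X_v| ≥ d(v) makes the injection a
-- bijection. At a separating vertex, minimality is what keeps each edge of H on one side: a
-- colouring of H without that edge turns it into a blocking edge. The converse is an induction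
-- along the construction, and minimal uncolourability alone does not pass through merging: to
-- extend a colouring of one side, the other side must supply an independent set that meets every
-- fibre except the one at the identified vertex. `Critical` therefore carries such a set for every
-- vertex. Both kinds of C-configuration, with the crossed pair anywhere, are brought to one
-- `CycleForm`, where the single bit `tw` is compared with the parity of n - 1; this comparison
-- serves both directions.

∈-tabulate⁺ : ∀ {n} {f : Fin n → Bool} {x} → f x ≡ true → x ∈ tabulate f
∈-tabulate⁺ {f = f} {x} fx = lookup⇒[]= x (tabulate f) (trans (lookup∘tabulate f x) fx)

∈-tabulate⁻ : ∀ {n} {f : Fin n → Bool} {x} → x ∈ tabulate f → f x ≡ true
∈-tabulate⁻ {f = f} {x} h = trans (sym (lookup∘tabulate f x)) ([]=⇒lookup h)

does⁻ : ∀ {A : Set} (d : Dec A) → does d ≡ true → A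
does⁻ (yes a) _ = a

compr : ∀ {n} {P : Fin n → Set} → Decidable₁ P → Subset n
compr P? = tabulate (λ x → does (P? x))

∈-compr⁺ : ∀ {n} {P : Fin n → Set} (P? : Decidable₁ P) {x} → P x → x ∈ compr P?
∈-compr⁺ P? {x} px = ∈-tabulate⁺ (dec-true (P? x) px)

∈-compr⁻ : ∀ {n} {P : Fin n → Set} (P? : Decidable₁ P) {x} → x ∈ compr P? → P x
∈-compr⁻ P? {x} h = does⁻ (P? x) (∈-tabulate⁻ h)

-- The map may use the membership proof, so it need only be defined on p. Each step of the induction
-- removes the image of the head from q.
∣∣-mono-inj : ∀ {m n} (p : Subset m) (q : Subset n) (f : ∀ x → x ∈ p → Fin n) →
  (∀ x h → f x h ∈ q) → (∀ x y h k → f x h ≡ f y k → x ≡ y) → ∣ p ∣ ≤ ∣ q ∣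
∣∣-mono-inj [] q f f∈ inj = z≤n
∣∣-mono-inj (outside ∷ p) q f f∈ inj =
  ∣∣-mono-inj p q (λ x h → f (suc x) (there h)) (λ x h → f∈ _ _)
    (λ x y h k eq → Fₚ.suc-injective (inj _ _ _ _ eq))
∣∣-mono-inj (inside ∷ p) q f f∈ inj =
  ℕ.<-≤-trans (s≤s (∣∣-mono-inj p (q - y) (λ x h → f (suc x) (there h))
    (λ x h → Sₚ.x∈p∧x≢y⇒x∈p-y (f∈ _ _) (λ eq → Fₚ.0≢1+n (sym (inj _ _ _ _ eq))))
    (λ x y h k eq → Fₚ.suc-injective (inj _ _ _ _ eq))))
    (Sₚ.x∈p⇒∣p-x∣<∣p∣ (f∈ zero here))
  where y = f zero here

module _ {m n} (p : Subset m) (q : Subset n) (R : Fin m → Fin n → Set)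
  (total : ∀ x → x ∈ p → ∃ λ y → y ∈ q × R x y)
  (inj : ∀ x x′ y → x ∈ p → x′ ∈ p → R x y → R x′ y → x ≡ x′) where

  private
    f : ∀ x → x ∈ p → Fin n
    f x h = proj₁ (total x h)
    f-inj : ∀ x y h k → f x h ≡ f y k → x ≡ y
    f-inj x y h k eq = inj x y (f y k) h k (subst (R x) eq (proj₂ (proj₂ (total x h)))) (proj₂ (proj₂ (total y k)))

  ∣∣-mono-rel : ∣ p ∣ ≤ ∣ q ∣
  ∣∣-mono-rel = ∣∣-mono-inj p q f (λ x h → proj₁ (proj₂ (total x h))) f-inj

  -- A missed y would leave an injection of p into `q - y`. With p a fibre and q the edges at its
  -- vertex, this is where degree-feasibility enters.
  rel-surjective : ∣ q ∣ ≤ ∣ p ∣ → ∀ y → y ∈ q → ∃ λ x → x ∈ p × R x y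
  rel-surjective le y y∈q with Fₚ.any? hit?
    where
    hit? : ∀ x → Dec (Σ (x ∈ p) λ h → f x h ≡ y)
    hit? x with x Sₚ.∈? p
    ... | no ∉ = no (λ (h , _) → ∉ h)
    ... | yes h = map′ (h ,_) (λ (k , eq) → subst (λ k → f x k ≡ y) ([]=-irrelevant k h) eq) (f x h ≟ y)
  ... | yes (x , h , refl) = x , h , proj₂ (proj₂ (total x h))
  ... | no ¬hit = ⊥-elim (ℕ.<⇒≱ (ℕ.≤-<-trans (∣∣-mono-inj p (q - y) f
          (λ x h → Sₚ.x∈p∧x≢y⇒x∈p-y (proj₁ (proj₂ (total x h))) (λ eq → ¬hit (x , h , eq))) f-inj)
          (Sₚ.x∈p⇒∣p-x∣<∣p∣ y∈q)) le)

∣∣≥1⁺ : ∀ {n} {p : Subset n} {x} → x ∈ p → 1 ≤ ∣ p ∣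
∣∣≥1⁺ h = ℕ.≤-trans (s≤s z≤n) (Sₚ.x∈p⇒∣p-x∣<∣p∣ h)

∣∣≥1⁻ : ∀ {n} (p : Subset n) → 1 ≤ ∣ p ∣ → Nonempty p
∣∣≥1⁻ {n} p le with Sₚ.nonempty? p
... | yes ne = ne
... | no e = ⊥-elim (ℕ.<⇒≢ le (sym (trans (cong ∣_∣ (Sₚ.Empty-unique e)) (Sₚ.∣⊥∣≡0 n))))

∣∣≡0⁺ : ∀ {n} (p : Subset n) → Empty p → ∣ p ∣ ≡ 0
∣∣≡0⁺ {n} p e = trans (cong ∣_∣ (Sₚ.Empty-unique e)) (Sₚ.∣⊥∣≡0 n)

∣∣≥2⁺ : ∀ {n} {p : Subset n} {x y} → x ≢ y → x ∈ p → y ∈ p → 2 ≤ ∣ p ∣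
∣∣≥2⁺ {x = x} x≢y hx hy =
  ℕ.≤-trans (s≤s (∣∣≥1⁺ (Sₚ.x∈p∧x≢y⇒x∈p-y hy (λ eq → x≢y (sym eq))))) (Sₚ.x∈p⇒∣p-x∣<∣p∣ hx)

∣∣≡1⁺ : ∀ {n} {p : Subset n} {x} → x ∈ p → (∀ y → y ∈ p → y ≡ x) → ∣ p ∣ ≡ 1
∣∣≡1⁺ {p = p} {x} h u = ℕ.≤-antisym
  (subst (∣ p ∣ ≤_) (Sₚ.∣⁅x⁆∣≡1 x) (Sₚ.p⊆q⇒∣p∣≤∣q∣ (λ {y} k → subst (_∈ ⁅ x ⁆) (sym (u y k)) (Sₚ.x∈⁅x⁆ x))))
  (∣∣≥1⁺ h)

∣∣≡1⁻ : ∀ {n} (p : Subset n) → ∣ p ∣ ≡ 1 → ∃ λ x → x ∈ p × (∀ y → y ∈ p → y ≡ x)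
∣∣≡1⁻ p eq with ∣∣≥1⁻ p (ℕ.≤-reflexive (sym eq))
... | x , h = x , h , u
  where
  u : ∀ y → y ∈ p → y ≡ x
  u y k with y ≟ x
  ... | yes e = e
  ... | no ne = ⊥-elim (ℕ.<⇒≢ (∣∣≥2⁺ ne k h) (sym eq))

other : ∀ {n} {p : Subset n} → 2 ≤ ∣ p ∣ → ∀ {x} → x ∈ p → ∃ λ y → y ∈ p × y ≢ x
other {p = p} le {x} h with Fₚ.any? (λ y → (y Sₚ.∈? p) ×-dec ¬? (y ≟ x))
... | yes r = r
... | no ¬r = ⊥-elim (ℕ.<⇒≢ le (sym (∣∣≡1⁺ h u)))
  where
  u : ∀ y → y ∈ p → y ≡ x
  u y k with y ≟ x
  ... | yes e = e
  ... | no ne = ⊥-elim (¬r (y , k , ne))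

another : ∀ {n} → 2 ≤ n → (x : Fin n) → ∃ λ y → y ≢ x
another {n} n≥2 x = let y , _ , ne = other {p = ⊤} (subst (2 ≤_) (sym (Sₚ.∣⊤∣≡n n)) n≥2) {x} Sₚ.∈⊤ in y , ne

∣∣≥2⁻ : ∀ {n} {p : Subset n} → 2 ≤ ∣ p ∣ → ∃ λ x → ∃ λ y → x ∈ p × y ∈ p × y ≢ x
∣∣≥2⁻ {p = p} le with ∣∣≥1⁻ p (ℕ.≤-trans (s≤s z≤n) le)
... | x , hx with other le hx
... | y , hy , ne = x , y , hx , hy , ne

∣pair∣ : ∀ {n} {x y : Fin n} → x ≢ y → ∣ ⁅ x ⁆ ∪ ⁅ y ⁆ ∣ ≡ 2
∣pair∣ {n} {x} {y} x≢y = ℕ.≤-antisym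
  ≤2
  (∣∣≥2⁺ x≢y (Sₚ.x∈p∪q⁺ (inj₁ (Sₚ.x∈⁅x⁆ x))) (Sₚ.x∈p∪q⁺ (inj₂ (Sₚ.x∈⁅x⁆ y))))
  where
  p = ⁅ x ⁆ ∪ ⁅ y ⁆
  ≤2 : ∣ p ∣ ≤ 2
  ≤2 = ∣∣-mono-inj p (inside ∷ inside ∷ []) g (λ z h → all-in (g z h)) g-inj
    where
    g : ∀ z → z ∈ p → Fin 2
    g z h with z ≟ x
    ... | yes _ = zero
    ... | no _ = suc zero
    all-in : ∀ (i : Fin 2) → i ∈ (inside ∷ inside ∷ [])
    all-in zero = here
    all-in (suc zero) = there here
    isy : ∀ z → z ∈ p → z ≢ x → z ≡ y
    isy z h ne with Sₚ.x∈p∪q⁻ ⁅ x ⁆ ⁅ y ⁆ h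
    ... | inj₁ k = ⊥-elim (ne (Sₚ.x∈⁅y⁆⇒x≡y x k))
    ... | inj₂ k = Sₚ.x∈⁅y⁆⇒x≡y y k
    g-inj : ∀ a b h k → g a h ≡ g b k → a ≡ b
    g-inj a b h k eq with a ≟ x | b ≟ x
    ... | yes e | yes f = trans e (sym f)
    ... | no e | no f = trans (isy a h e) (sym (isy b k f))

∈-pair⁻ : ∀ {n} {x y z : Fin n} → z ∈ ⁅ x ⁆ ∪ ⁅ y ⁆ → z ≡ x ⊎ z ≡ y
∈-pair⁻ {x = x} {y} h with Sₚ.x∈p∪q⁻ ⁅ x ⁆ ⁅ y ⁆ h
... | inj₁ k = inj₁ (Sₚ.x∈⁅y⁆⇒x≡y x k)
... | inj₂ k = inj₂ (Sₚ.x∈⁅y⁆⇒x≡y y k)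

∈-pairˡ : ∀ {n} (x y : Fin n) → x ∈ ⁅ x ⁆ ∪ ⁅ y ⁆
∈-pairˡ x y = Sₚ.x∈p∪q⁺ (inj₁ (Sₚ.x∈⁅x⁆ x))

∈-pairʳ : ∀ {n} (x y : Fin n) → y ∈ ⁅ x ⁆ ∪ ⁅ y ⁆
∈-pairʳ x y = Sₚ.x∈p∪q⁺ (inj₂ (Sₚ.x∈⁅x⁆ y))

∣∣≡2⇒pair : ∀ {n} {p : Subset n} {x y} → ∣ p ∣ ≡ 2 → x ≢ y → x ∈ p → y ∈ p → p ≡ ⁅ x ⁆ ∪ ⁅ y ⁆
∣∣≡2⇒pair {p = p} {x} {y} eq x≢y hx hy = sym (Sₚ.⊆-antisym sub sup)
  where
  q = ⁅ x ⁆ ∪ ⁅ y ⁆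
  sub : q ⊆ p
  sub h with ∈-pair⁻ h
  ... | inj₁ refl = hx
  ... | inj₂ refl = hy
  sup : p ⊆ q
  sup {z} h with z Sₚ.∈? q
  ... | yes k = k
  ... | no k = ⊥-elim (ℕ.<⇒≢ (Sₚ.p⊂q⇒∣p∣<∣q∣ ((λ {w} → sub {w}) , z , h , k)) (trans (∣pair∣ x≢y) (sym eq)))

-- Vertices and edges are elements of `Fin`, so the two sides of a separating vertex have to be
-- renumbered; `emb` and `idx` translate between a side and the whole.
record Enum {n} (f : Fin n → Bool) : Set where
  field
    size′ : ℕ
    emb : Fin size′ → Fin n
    emb-inj : ∀ {i j} → emb i ≡ emb j → i ≡ j
    emb-true : ∀ i → f (emb i) ≡ true
    idx : ∀ x → f x ≡ true → Fin size′
    emb-idx : ∀ x h → emb (idx x h) ≡ x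

abstract
  enum : ∀ {n} (f : Fin n → Bool) → Enum f
  enum {zero} f = record { size′ = 0 ; emb = λ () ; emb-inj = λ { {()} } ; emb-true = λ () ; idx = λ () ; emb-idx = λ () }
  enum {suc n} f with f zero in eq | enum (λ x → f (suc x))
  ... | false | r = record { size′ = size′ ; emb = λ i → suc (emb i) ; emb-inj = λ e → emb-inj (Fₚ.suc-injective e)
      ; emb-true = emb-true ; idx = ix ; emb-idx = ei }
    where
    open Enum r
    absurd : f zero ≡ true → ⊥₀
    absurd h with trans (sym eq) h
    ... | ()
    ix : ∀ x → f x ≡ true → Fin size′
    ix zero h = ⊥-elim (absurd h)
    ix (suc x) h = idx x h
    ei : ∀ x (h : f x ≡ true) → suc (emb (ix x h)) ≡ x
    ei zero h = ⊥-elim (absurd h)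
    ei (suc x) h = cong suc (emb-idx x h)
  ... | true | r = record { size′ = suc size′ ; emb = em ; emb-inj = λ {i} {j} → ei {i} {j}
      ; emb-true = et ; idx = ix ; emb-idx = ee }
    where
    open Enum r
    em : Fin (suc size′) → Fin (suc n)
    em zero = zero
    em (suc i) = suc (emb i)
    ei : ∀ {i j} → em i ≡ em j → i ≡ j
    ei {zero} {zero} e = refl
    ei {suc i} {suc j} e = cong suc (emb-inj (Fₚ.suc-injective e))
    et : ∀ i → f (em i) ≡ true
    et zero = eq
    et (suc i) = emb-true i
    ix : ∀ x → f x ≡ true → Fin (suc size′)
    ix zero h = zero
    ix (suc x) h = suc (idx x h)
    ee : ∀ x (h : f x ≡ true) → em (ix x h) ≡ x
    ee zero h = refl
    ee (suc x) h = cong suc (emb-idx x h)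

module _ where
  open Enum

  enum-↔ : ∀ {n} {f h : Fin n → Bool} (E₁ : Enum f) (E₂ : Enum h) → (∀ x → h x ≡ not (f x)) →
    Σ ((Fin (size′ E₁) ⊎ Fin (size′ E₂)) ↔ Fin n) λ φ →
      (∀ i → Inverse.to φ (inj₁ i) ≡ emb E₁ i) × (∀ i → Inverse.to φ (inj₂ i) ≡ emb E₂ i)
  enum-↔ {n} {f} {h} E₁ E₂ compl = mk↔ₛ′ to from to-from from-to , (λ i → refl) , (λ i → refl)
    where
    to : Fin (size′ E₁) ⊎ Fin (size′ E₂) → Fin n
    to (inj₁ i) = emb E₁ i
    to (inj₂ i) = emb E₂ i
    pick : ∀ x (b : Bool) → f x ≡ b → Fin (size′ E₁) ⊎ Fin (size′ E₂)
    pick x true e = inj₁ (idx E₁ x e)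
    pick x false e = inj₂ (idx E₂ x (trans (compl x) (cong not e)))
    from : Fin n → Fin (size′ E₁) ⊎ Fin (size′ E₂)
    from x = pick x (f x) refl
    to-pick : ∀ x b e → to (pick x b e) ≡ x
    to-pick x true e = emb-idx E₁ x e
    to-pick x false e = emb-idx E₂ x _
    to-from : ∀ x → to (from x) ≡ x
    to-from x = to-pick x (f x) refl
    no-conf : ∀ x → f x ≡ true → h x ≡ true → ⊥₀
    no-conf x a b with trans (sym b) (trans (compl x) (cong not a))
    ... | ()
    to-inj : ∀ a b → to a ≡ to b → a ≡ b
    to-inj (inj₁ i) (inj₁ j) e = cong inj₁ (emb-inj E₁ e)
    to-inj (inj₂ i) (inj₂ j) e = cong inj₂ (emb-inj E₂ e)
    to-inj (inj₁ i) (inj₂ j) e = ⊥-elim (no-conf _ (emb-true E₁ i) (subst (λ z → h z ≡ true) (sym e) (emb-true E₂ j)))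
    to-inj (inj₂ i) (inj₁ j) e = ⊥-elim (no-conf _ (emb-true E₁ j) (subst (λ z → h z ≡ true) e (emb-true E₂ i)))
    from-to : ∀ a → from (to a) ≡ a
    from-to a = to-inj _ _ (to-from (to a))

-- Reachability under a decidable relation

record Closure {n} (R : Fin n → Fin n → Set) (u : Fin n) : Set where
  field
    set : Subset n
    source : u ∈ set
    closed : ∀ {p q} → p ∈ set → R p q → q ∈ set
    reach : ∀ {p} → p ∈ set → Star R u p

grow : ∀ {n} {P : Fin n → Set} (W : Subset n) (q : Fin n) → (∀ {p} → p ∈ W → P p) → P q → ∀ {p} → p ∈ W ∪ ⁅ q ⁆ → P p
grow W q all pq h with Sₚ.x∈p∪q⁻ W ⁅ q ⁆ h
... | inj₁ k = all k
... | inj₂ k with Sₚ.x∈⁅y⁆⇒x≡y q k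
... | refl = pq

∣grow∣ : ∀ {n} {W : Subset n} {q} → q ∉ W → ∣ W ∣ < ∣ W ∪ ⁅ q ⁆ ∣
∣grow∣ {W = W} {q} q∉ = Sₚ.p⊂q⇒∣p∣<∣q∣ ((λ {x} h → Sₚ.p⊆p∪q ⁅ q ⁆ h) , q , Sₚ.q⊆p∪q W ⁅ q ⁆ (Sₚ.x∈⁅x⁆ q) , q∉)

closure : ∀ {n} {R : Fin n → Fin n → Set} → (∀ p q → Dec (R p q)) → ∀ u → Closure R u
closure {n} {R} R? u = go n ⁅ u ⁆ (Sₚ.x∈⁅x⁆ u) (λ h → subst (Star R u) (sym (Sₚ.x∈⁅y⁆⇒x≡y u h)) ε)
    (ℕ.≤-trans (ℕ.≤-reflexive (sym (ℕ.+-identityʳ n))) (ℕ.+-monoʳ-≤ n z≤n))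
  where
  open import Data.Nat using (_+_)
  -- The fuel k bounds the number of elements outside W: each round adds one, and at k = 0 nothing
  -- is outside.
  go : ∀ k (W : Subset n) → u ∈ W → (∀ {p} → p ∈ W → Star R u p) → n ≤ k + ∣ W ∣ → Closure R u
  go k W u∈ re le with Fₚ.any? (λ p → Fₚ.any? (λ q → (p Sₚ.∈? W) ×-dec (¬? (q Sₚ.∈? W) ×-dec R? p q)))
  ... | no ¬c = record { set = W ; source = u∈ ; reach = re ; closed = cl }
    where
    cl : ∀ {p q} → p ∈ W → R p q → q ∈ W
    cl {p} {q} h r with q Sₚ.∈? W
    ... | yes k = k
    ... | no k = ⊥-elim (¬c (p , q , h , k , r))
  go zero W u∈ re le | yes (p , q , h , q∉ , r) =
    ⊥-elim (q∉ (subst (q ∈_) (sym (Sₚ.∣p∣≡n⇒p≡⊤ (ℕ.≤-antisym (Sₚ.∣p∣≤n W) le))) Sₚ.∈⊤))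
  go (suc k) W u∈ re le | yes (p , q , h , q∉ , r) =
    go k (W ∪ ⁅ q ⁆) (Sₚ.p⊆p∪q ⁅ q ⁆ u∈) (grow W q re (re h ◅◅ (r ◅ ε)))
      (ℕ.≤-trans le (subst (_≤ k + ∣ W ∪ ⁅ q ⁆ ∣) (ℕ.+-suc k ∣ W ∣) (ℕ.+-monoʳ-≤ k (∣grow∣ q∉))))

-- Covers and near-colourings

≤-fuel : ∀ n {m} → n ≤ n + m
≤-fuel n = ℕ.m≤m+n n _

∈-Xset⁺ : ∀ {n} (H : Hypergraph) (π : Fin (nV H) → Fin n) {v x} → π x ≡ v → x ∈ Xset H π v
∈-Xset⁺ H π {v} = ∈-compr⁺ (λ x → π x ≟ v)

∈-Xset⁻ : ∀ {n} (H : Hypergraph) (π : Fin (nV H) → Fin n) {v x} → x ∈ Xset H π v → π x ≡ v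
∈-Xset⁻ H π {v} = ∈-compr⁻ (λ x → π x ≟ v)

star : (G : Hypergraph) → Fin (nV G) → Subset (nE G)
star G v = tabulate (λ e → lookup (inc G e) v)

∈-star⁺ : ∀ (G : Hypergraph) {v e} → v ∈ inc G e → e ∈ star G v
∈-star⁺ G h = ∈-tabulate⁺ ([]=⇒lookup h)

∈-star⁻ : ∀ (G : Hypergraph) {v e} → e ∈ star G v → v ∈ inc G e
∈-star⁻ G {v} {e} h = lookup⇒[]= v (inc G e) (∈-tabulate⁻ h)

Crossing : (G : Hypergraph) (D : Fin (nV G) → Set) (W : Subset (nV G)) → Set
Crossing G D W = ∃ λ e → ∃ λ p → ∃ λ q → p ∈ inc G e × q ∈ inc G e × p ∈ W × q ∉ W × ¬ D q

-- G − D is connected, phrased by cuts.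
ConnOff : (G : Hypergraph) (D : Fin (nV G) → Set) → Set
ConnOff G D = ∀ W → (∀ {p} → p ∈ W → ¬ D p) → Nonempty W → (∃ λ q → q ∉ W × ¬ D q) → Crossing G D W

crossing? : ∀ G {D} → Decidable₁ D → ∀ W → Dec (Crossing G D W)
crossing? G D? W = Fₚ.any? λ e → Fₚ.any? λ p → Fₚ.any? λ q →
  (p Sₚ.∈? inc G e) ×-dec ((q Sₚ.∈? inc G e) ×-dec ((p Sₚ.∈? W) ×-dec (¬? (q Sₚ.∈? W) ×-dec ¬? (D? q))))

Disconnecting : (G : Hypergraph) (D : Fin (nV G) → Set) (W : Subset (nV G)) → Set
Disconnecting G D W = (∀ p → p ∈ W → ¬ D p) × Nonempty W × (∃ λ q → q ∉ W × ¬ D q) × ¬ Crossing G D W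

-- A failure of `ConnOff` has to come with the set that witnesses it; a search through all subsets
-- of the vertices finds it.
connOff? : ∀ G {D} → Decidable₁ D → ConnOff G D ⊎ ∃ (Disconnecting G D)
connOff? G {D} D? with Sₚ.anySubset? {P = Disconnecting G D} (λ W →
    Fₚ.all? (λ p → (p Sₚ.∈? W) →-dec ¬? (D? p)) ×-dec (Sₚ.nonempty? W ×-dec
    (Fₚ.any? (λ q → ¬? (q Sₚ.∈? W) ×-dec ¬? (D? q)) ×-dec ¬? (crossing? G D? W))))
... | yes d = inj₂ d
... | no ¬d = inj₁ λ W WD ne q → con W WD ne q
  where
  con : ConnOff G D
  con W WD ne q with crossing? G D? W
  ... | yes c = c
  ... | no ¬c = ⊥-elim (¬d (W , (λ p h → WD h) , ne , q , ¬c))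

reach⇒crossing : ∀ {G : Hypergraph} {W : Subset (nV G)} {u v} → Reach G u v → u ∈ W → v ∉ W → Crossing G (λ _ → ⊥₀) W
reach⇒crossing here hu hv = ⊥-elim (hv hu)
reach⇒crossing {G} {W} (step {w} {v} e r hw hv) hu v∉ with w Sₚ.∈? W
... | yes k = e , w , v , hw , hv , k , v∉ , λ ()
... | no k = reach⇒crossing r hu k

connected⇒connOff : ∀ {G : Hypergraph} → Connected G → ConnOff G (λ _ → ⊥₀)
connected⇒connOff con W _ (p , hp) (q , hq , _) = reach⇒crossing (con p q) hp hq

reach-trans : ∀ {G : Hypergraph} {u v w} → Reach G u v → Reach G v w → Reach G u w
reach-trans r here = r
reach-trans r (step e s a b) = step e (reach-trans r s) a b

reach-sym : ∀ {G : Hypergraph} {u v} → Reach G u v → Reach G v u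
reach-sym here = here
reach-sym (step e r a b) = reach-trans (step e here b a) (reach-sym r)

upd : ∀ {m n} → (Fin m → Fin n) → Fin m → Fin n → Fin m → Fin n
upd c u x w with w ≟ u
... | yes _ = x
... | no _ = c w

upd-same : ∀ {m n} (c : Fin m → Fin n) u x → upd c u x u ≡ x
upd-same c u x with u ≟ u
... | yes _ = refl
... | no ne = ⊥-elim (ne refl)

upd-other : ∀ {m n} (c : Fin m → Fin n) u x {w} → w ≢ u → upd c u x w ≡ c w
upd-other c u x {w} ne with w ≟ u
... | yes e = ⊥-elim (ne e)
... | no _ = refl

module Cover (C : Config) (cov : IsCover C) where
  V E VH EH : Set
  V = Fin (nV (G C))
  E = Fin (nE (G C))
  VH = Fin (nV (H C))
  EH = Fin (nE (H C))

  infix 4 _∈ᴳ_ _∈ᴴ_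
  _∈ᴳ_ : V → E → Set
  v ∈ᴳ e = v ∈ inc (G C) e
  _∈ᴴ_ : VH → EH → Set
  x ∈ᴴ ẽ = x ∈ inc (H C) ẽ

  ∈ᴳ-resp : ∀ {v e e′} → e ≡ e′ → v ∈ᴳ e → v ∈ᴳ e′
  ∈ᴳ-resp refl h = h

  π : VH → V
  π = proj C

  g : EH → E
  g = proj₁ (proj₂ cov)

  π∈ : ∀ {ẽ x} → x ∈ᴴ ẽ → π x ∈ᴳ (g ẽ)
  π∈ = proj₁ (proj₂ (proj₂ cov)) _ _

  fibre : ∀ ẽ {v} → v ∈ᴳ (g ẽ) → ∃ λ x → x ∈ᴴ ẽ × π x ≡ v
  fibre ẽ {v} h with ∣∣≡1⁻ (inc (H C) ẽ ∩ X C v) (proj₁ (proj₂ (proj₂ (proj₂ cov))) ẽ v h)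
  ... | x , hx , _ with Sₚ.x∈p∩q⁻ (inc (H C) ẽ) (X C v) hx
  ... | k , l = x , k , ∈-Xset⁻ (H C) π l

  fibre-unique : ∀ {ẽ x y} → x ∈ᴴ ẽ → y ∈ᴴ ẽ → π x ≡ π y → x ≡ y
  fibre-unique {ẽ} {x} {y} hx hy eq
    with ∣∣≡1⁻ (inc (H C) ẽ ∩ X C (π y)) (proj₁ (proj₂ (proj₂ (proj₂ cov))) ẽ (π y) (π∈ hy))
  ... | z , _ , u = trans (u x (Sₚ.x∈p∩q⁺ (hx , ∈-Xset⁺ (H C) π eq)))
                          (sym (u y (Sₚ.x∈p∩q⁺ (hy , ∈-Xset⁺ (H C) π refl))))

  matching : ∀ {ẽ ẽ′ x} → x ∈ᴴ ẽ → x ∈ᴴ ẽ′ → g ẽ ≡ g ẽ′ → ẽ ≡ ẽ′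
  matching {ẽ} {ẽ′} {x} h h′ eq with ẽ ≟ ẽ′
  ... | yes e = e
  ... | no ne = ⊥-elim (proj₂ (proj₂ (proj₂ (proj₂ cov))) ẽ ẽ′ ne eq (x , Sₚ.x∈p∩q⁺ (h , h′)))

  other-end : ∀ {ẽ x} → x ∈ᴴ ẽ → ∃ λ y → y ∈ᴴ ẽ × π y ≢ π x
  other-end {ẽ} {x} h with other (size (G C) (g ẽ)) (π∈ h)
  ... | v , hv , ne with fibre ẽ hv
  ... | y , hy , refl = y , hy , ne

  Section : (V → VH) → Set
  Section c = ∀ v → π (c v) ≡ v

  Hit : (V → VH) → (V → Set) → EH → Set
  Hit c D ẽ = ∀ x → x ∈ᴴ ẽ → D (π x) × c (π x) ≡ x

  record IndOn (c : V → VH) (D : V → Set) : Set where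
    constructor mkInd
    field
      misses : ∀ ẽ → ¬ Hit c D ẽ
  open IndOn public

  -- Choosing x as well would complete ẽ. Nothing is asked of D at `π x`, which is usually the
  -- vertex still to be coloured.
  record Blk (c : V → VH) (D : V → Set) (x : VH) (ẽ : EH) : Set where
    constructor mkBlk
    field
      end : x ∈ᴴ ẽ
      rest : ∀ y → y ∈ᴴ ẽ → y ≢ x → D (π y) × c (π y) ≡ y
  open Blk public

  blk? : ∀ c {D} → Decidable₁ D → ∀ x ẽ → Dec (Blk c D x ẽ)
  blk? c D? x ẽ = map′ (λ (h , r) → mkBlk h r) (λ b → end b , rest b)
      ((x Sₚ.∈? inc (H C) ẽ) ×-dec Fₚ.all? (λ y → (y Sₚ.∈? inc (H C) ẽ) →-dec
    (¬? (y ≟ x) →-dec (D? (π y) ×-dec (c (π y) ≟ y)))))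

  upd-section : ∀ {c u x} → Section c → π x ≡ u → Section (upd c u x)
  upd-section {c} {u} {x} sc eq v with v ≟ u
  ... | yes e = trans eq (sym e)
  ... | no _ = sc v

  ind-mono : ∀ {c c′ D D′} → (∀ {w} → D′ w → D w × c w ≡ c′ w) → IndOn c D → IndOn c′ D′
  ind-mono sub ind = mkInd λ ẽ hit → misses ind ẽ (λ x h → let d , e = hit x h in proj₁ (sub d) , trans (proj₂ (sub d)) e)

  blk-weaken : ∀ {c D D′ x ẽ} → (∀ {w} → D w → D′ w) → Blk c D x ẽ → Blk c D′ x ẽ
  blk-weaken sub (mkBlk h b) = mkBlk h λ y hy ne → let d , e = b y hy ne in sub d , e

  blk-end : ∀ {c D x ẽ w} → Blk c D x ẽ → w ∈ᴳ (g ẽ) → w ≢ π x → D w × c w ∈ᴴ ẽ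
  blk-end {ẽ = ẽ} (mkBlk h b) hw ne with fibre ẽ hw
  ... | y , hy , refl with b y hy (λ e → ne (cong π e))
  ... | d , e = d , subst (_∈ᴴ ẽ) (sym e) hy

  -- The edge of G has an end w other than `π x`, and both blocking edges contain `c w`; the
  -- matching condition identifies them.
  blk-same : ∀ {c D x x′ ẽ ẽ′} → Blk c D x ẽ → Blk c D x′ ẽ′ → g ẽ ≡ g ẽ′ → π x ≡ π x′ → ẽ ≡ ẽ′ × x ≡ x′
  blk-same {c} {x = x} {x′} {ẽ} {ẽ′} b b′ eq πeq with other (size (G C) (g ẽ)) (π∈ (end b))
  ... | w , hw , ne with matching (proj₂ (blk-end b hw ne))
                           (proj₂ (blk-end b′ (∈ᴳ-resp eq hw) (λ e → ne (trans e (sym πeq))))) eq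
  ... | refl = refl , fibre-unique (end b) (end b′) πeq

  -- Choosing x can complete only an edge through x, and such an edge blocks x. Both domains appear
  -- in the last hypothesis so that the lemma serves for colouring one more vertex and also for
  -- moving the hole from one vertex to another.
  ind-upd : ∀ {c D D′ u x} → π x ≡ u → (∀ {w} → D′ w → w ≢ u → D w) →
    IndOn c D → (∀ ẽ → Blk c (λ w → D w × D′ w) x ẽ → ¬ Hit (upd c u x) D′ ẽ) → IndOn (upd c u x) D′
  ind-upd {c} {D} {D′} {u} {x} πx sub ind nb = mkInd go
   where
   go : ∀ ẽ → ¬ Hit (upd c u x) D′ ẽ
   go ẽ hit with x Sₚ.∈? inc (H C) ẽ
   ... | yes hx = nb ẽ (mkBlk hx b) hit
    where
    b : ∀ y → y ∈ᴴ ẽ → y ≢ x → (D (π y) × D′ (π y)) × c (π y) ≡ y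
    b y hy ne = let d , e = hit y hy
                    ne′ = λ eq → ne (fibre-unique hy hx (trans eq (sym πx)))
                in (sub d ne′ , d) , trans (sym (upd-other c u x ne′)) e
   ... | no ∉ = misses ind ẽ (λ y hy →
      let d , e = hit y hy
          ne = λ eq → ∉ (subst (_∈ᴴ ẽ) (trans (sym e) (trans (cong (upd c u x) eq) (upd-same c u x))) hy)
      in sub d ne , trans (sym (upd-other c u x ne)) e)

  module Saturated {c : V → VH} {D : V → Set} {u : V} (deg : degree (G C) u ≤ ∣ X C u ∣)
    (all-blk : ∀ x → π x ≡ u → ∃ λ ẽ → Blk c D x ẽ) where

    private
      -- Q is a side condition that the blocking edges may be chosen to satisfy. It is trivial for
      -- `every-edge`; for uniqueness it says that a given edge is avoided.
      surj : (Q : EH → Set) → (∀ x → π x ≡ u → ∃ λ ẽ → Blk c D x ẽ × Q ẽ) → ∀ e → u ∈ᴳ e →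
        ∃ λ x → ∃ λ ẽ → π x ≡ u × Blk c D x ẽ × g ẽ ≡ e × Q ẽ
      surj Q all e he
        with rel-surjective (X C u) (star (G C) u) (λ x e → ∃ λ ẽ → Blk c D x ẽ × g ẽ ≡ e × Q ẽ)
          (λ x hx → let πx = ∈-Xset⁻ (H C) π hx
                        ẽ , b , q = all x πx
                    in g ẽ , ∈-star⁺ (G C) (subst (_∈ᴳ (g ẽ)) πx (π∈ (end b))) , ẽ , b , refl , q)
          (λ x x′ e hx hx′ (ẽ , b , q , _) (ẽ′ , b′ , q′ , _) →
             proj₂ (blk-same b b′ (trans q (sym q′)) (trans (∈-Xset⁻ (H C) π hx) (sym (∈-Xset⁻ (H C) π hx′)))))
          deg e (∈-star⁺ (G C) he)
      ... | x , hx , ẽ , b , eq , q = x , ẽ , ∈-Xset⁻ (H C) π hx , b , eq , q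

    abstract
      every-edge : ∀ e → u ∈ᴳ e → ∃ λ x → ∃ λ ẽ → π x ≡ u × Blk c D x ẽ × g ẽ ≡ e
      every-edge e he =
        let x , ẽ , πx , b , eq , _ = surj (λ _ → ⊤₀) (λ x πx → let ẽ , b = all-blk x πx in ẽ , b , tt) e he
        in x , ẽ , πx , b , eq

    -- A second blocking edge of x could be spared, leaving too few edges at u for the fibre.
    abstract
      blk-unique : ∀ {x ẽ ẽ′} → π x ≡ u → Blk c D x ẽ → Blk c D x ẽ′ → ẽ ≡ ẽ′
      blk-unique {x} {ẽ} {ẽ′} πx b b′ with ẽ ≟ ẽ′
      ... | yes e = e
      ... | no ne =
        let y , ẽ₂ , πy , b₂ , eq , ne₂ = surj (_≢ ẽ′) all′ (g ẽ′) (subst (_∈ᴳ (g ẽ′)) πx (π∈ (end b′)))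
        in ⊥-elim (ne₂ (proj₁ (blk-same b₂ b′ eq (trans πy (sym πx)))))
        where
        all′ : ∀ y → π y ≡ u → ∃ λ ẽ₁ → Blk c D y ẽ₁ × ẽ₁ ≢ ẽ′
        all′ y πy with all-blk y πy
        ... | ẽ₁ , b₁ with ẽ₁ ≟ ẽ′
        ... | no ne₁ = ẽ₁ , b₁ , ne₁
        ... | yes refl with fibre-unique (end b₁) (end b′) (trans πy (sym πx))
        ... | refl = ẽ , b , ne

  abstract
    free? : ∀ c {D} → Decidable₁ D → ∀ u →
      (∃ λ x → π x ≡ u × (∀ ẽ → ¬ Blk c D x ẽ)) ⊎ (∀ x → π x ≡ u → ∃ λ ẽ → Blk c D x ẽ)
    free? c {D} D? u with Fₚ.any? (λ x → (π x ≟ u) ×-dec ¬? (Fₚ.any? (blk? c D? x)))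
    ... | yes (x , πx , nb) = inj₁ (x , πx , λ ẽ b → nb (ẽ , b))
    ... | no ¬f = inj₂ all
      where
      all : ∀ x → π x ≡ u → ∃ λ ẽ → Blk c D x ẽ
      all x πx with Fₚ.any? (blk? c D? x)
      ... | yes b = b
      ... | no nb = ⊥-elim (¬f (x , πx , nb))

  -- v is the uncoloured vertex: the value c v is junk.
  Near : (V → VH) → V → Set
  Near c v = Section c × IndOn c (_≢ v)

  -- Colour outside-in: W is the uncoloured part, and the vertex coloured next still has an uncoloured neighbour in W.
  abstract
    greedy : DegreeFeasible C → ∀ {D} → Decidable₁ D → ConnOff (G C) D → ∀ {c} → Section c → IndOn c D →
      ∀ {v} → ¬ D v → ∃ λ c′ → Near c′ v × (∀ {w} → D w → c′ w ≡ c w)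
    greedy df {D} D? con {c} sc ind {v} v∉D with go (nV (G C)) ⁅ v ⁆ (Sₚ.x∈⁅x⁆ v)
        (λ h d → v∉D (subst D (Sₚ.x∈⁅y⁆⇒x≡y v h) d)) (≤-fuel (nV (G C)))
      where
      go : ∀ k W → v ∈ W → (∀ {p} → p ∈ W → ¬ D p) → nV (G C) ≤ k + ∣ W ∣ →
        ∃ λ c′ → Section c′ × IndOn c′ (_∉ W) × (∀ {w} → D w → c′ w ≡ c w)
      go k W hv WD le with Fₚ.any? (λ q → ¬? (q Sₚ.∈? W) ×-dec ¬? (D? q))
      ... | no ¬q = c , sc , ind-mono (λ {w} w∉ → inD w w∉ , refl) ind , λ _ → refl
        where
        inD : ∀ w → w ∉ W → D w
        inD w w∉ with D? w
        ... | yes d = d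
        ... | no nd = ⊥-elim (¬q (w , w∉ , nd))
      ... | yes ∃q with con W WD (v , hv) ∃q
      go zero W hv WD le | yes ∃q | e , p , q , hp , hq , p∈ , q∉ , q∉D =
        ⊥-elim (q∉ (subst (q ∈_) (sym (Sₚ.∣p∣≡n⇒p≡⊤ (ℕ.≤-antisym (Sₚ.∣p∣≤n W) le))) Sₚ.∈⊤))
      go (suc k) W hv WD le | yes ∃q | e , p , q , hp , hq , p∈ , q∉ , q∉D
        with go k (W ∪ ⁅ q ⁆) (Sₚ.p⊆p∪q ⁅ q ⁆ hv) (grow W q WD q∉D)
               (ℕ.≤-trans le (subst (_≤ k + ∣ W ∪ ⁅ q ⁆ ∣) (ℕ.+-suc k ∣ W ∣) (ℕ.+-monoʳ-≤ k (∣grow∣ q∉))))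
      ... | c₁ , sc₁ , ind₁ , ag with free? c₁ (λ w → ¬? (w Sₚ.∈? W ∪ ⁅ q ⁆)) q
      ... | inj₁ (x , πx , nb) = upd c₁ q x , upd-section sc₁ πx ,
            ind-upd πx (λ {w} w∉ ne → λ h → grow {P = λ z → z ≢ w} W q (λ k eq → w∉ (subst (_∈ W) eq k))
                (λ eq → ne (sym eq)) h refl)
              ind₁ (λ ẽ b _ → nb ẽ (blk-weaken proj₁ b)) ,
            λ {w} d → trans (upd-other c₁ q x (λ eq → q∉D (subst D eq d))) (ag d)
      -- If every colour of q were blocked, the crossing edge e would have to block one of them,
      -- although its end p is still uncoloured.
      ... | inj₂ all =
            let x , ẽ , πx , b , eq = Saturated.every-edge (df q) all e hq
            in ⊥-elim (proj₁ (blk-end b (∈ᴳ-resp (sym eq) hp)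
                 (λ eq → q∉ (subst (_∈ W) (trans eq πx) p∈))) (Sₚ.p⊆p∪q ⁅ q ⁆ p∈))
    ... | c′ , sc′ , ind′ , ag = c′ , (sc′ , ind-mono (λ ne → (λ h → ne (Sₚ.x∈⁅y⁆⇒x≡y v h)) , refl) ind′) , ag

    near-exists : DegreeFeasible C → Connected (G C) → ∀ {c} → Section c → ∀ v → ∃ λ c → Near c v
    near-exists df con sc v =
      let c , nr , _ = greedy df {λ _ → ⊥₀} (λ _ → no (λ ())) (connected⇒connOff con) sc
            (mkInd λ ẽ hit → let x , _ , h , _ = ∣∣≥2⁻ (size (H C) ẽ) in proj₁ (hit x h)) {v} (λ ())
      in c , nr

  Uncol : Set
  Uncol = ∀ c → Section c → ¬ IndOn c (λ _ → ⊤₀)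

  module Tight (df : DegreeFeasible C) (unc : Uncol) where

    abstract
      near-blk : ∀ {c v} → Near c v → ∀ x → π x ≡ v → ∃ λ ẽ → Blk c (_≢ v) x ẽ
      near-blk {c} {v} (sc , ind) x πx with free? c (λ w → ¬? (w ≟ v)) v
      ... | inj₂ all = all x πx
      ... | inj₁ (y , πy , nb) = ⊥-elim (unc (upd c v y) (upd-section sc πy)
              (ind-upd πy (λ _ ne → ne) ind (λ ẽ b _ → nb ẽ (blk-weaken proj₁ b))))

    module _ {c v} (nr : Near c v) where
      open Saturated {c} {_≢ v} {v} (df v) (near-blk nr) public using ()
        renaming (every-edge to near-edge; blk-unique to near-unique)

    -- By `near-unique` ẽ is the only edge that choosing x could complete, and the new hole q is an
    -- end of the edge of G below ẽ.
    shift : ∀ {c v x ẽ q} → Near c v → π x ≡ v → Blk c (_≢ v) x ẽ → q ∈ᴳ (g ẽ) → q ≢ v → Near (upd c v x) q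
    shift {c} {v} {x} {ẽ} {q} nr@(sc , ind) πx b hq ne = upd-section sc πx , ind-upd πx (λ _ ne → ne) ind nb
      where
      nb : ∀ ẽ′ → Blk c (λ w → w ≢ v × w ≢ q) x ẽ′ → ¬ Hit (upd c v x) (_≢ q) ẽ′
      nb ẽ′ b′ hit with near-unique nr πx b (blk-weaken proj₁ b′)
      ... | refl with fibre ẽ hq
      ... | y , hy , πy = proj₁ (hit y hy) πy

-- Splitting at a separating vertex

-- A transversal is the image of a section c of π; Mono says that it contains the edge ẽ.
Mono : (H : Hypergraph) {n : ℕ} (π : Fin (nV H) → Fin n) → (Fin n → Fin (nV H)) → Fin (nE H) → Set
Mono H π c ẽ = ∀ x → x ∈ inc H ẽ → c (π x) ≡ x

colorable⁻ : (H : Hypergraph) {n : ℕ} (π : Fin (nV H) → Fin n) → Colorable H π →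
  ∃ λ c → (∀ v → π (c v) ≡ v) × (∀ ẽ → ¬ Mono H π c ẽ)
colorable⁻ H {n} π (T , ind , one) = c , sec , λ ẽ mono → ind ẽ (λ {x} h → subst (_∈ T) (mono x h) (c∈T (π x)))
  where
  pick : ∀ v → ∃ λ x → x ∈ T ∩ Xset H π v × (∀ y → y ∈ T ∩ Xset H π v → y ≡ x)
  pick v = ∣∣≡1⁻ (T ∩ Xset H π v) (one v)
  c : Fin n → Fin (nV H)
  c v = proj₁ (pick v)
  c∈T : ∀ v → c v ∈ T
  c∈T v = proj₁ (Sₚ.x∈p∩q⁻ T (Xset H π v) (proj₁ (proj₂ (pick v))))
  sec : ∀ v → π (c v) ≡ v
  sec v = ∈-Xset⁻ H π (proj₂ (Sₚ.x∈p∩q⁻ T (Xset H π v) (proj₁ (proj₂ (pick v)))))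

colorable⁺ : (H : Hypergraph) {n : ℕ} (π : Fin (nV H) → Fin n) (c : Fin n → Fin (nV H)) →
  (∀ v → π (c v) ≡ v) → (∀ ẽ → ¬ Mono H π c ẽ) → Colorable H π
colorable⁺ H {n} π c sec ind = T , (λ ẽ sub → ind ẽ (λ x h → ∈-compr⁻ T? (sub h))) , one
  where
  T? : ∀ x → Dec (c (π x) ≡ x)
  T? x = c (π x) ≟ x
  T = compr T?
  one : ∀ v → ∣ T ∩ Xset H π v ∣ ≡ 1
  one v = ∣∣≡1⁺ {x = c v} (Sₚ.x∈p∩q⁺ (∈-compr⁺ T? (cong c (sec v)) , ∈-Xset⁺ H π (sec v)))
    (λ y h → let a , b = Sₚ.x∈p∩q⁻ T (Xset H π v) h in trans (sym (∈-compr⁻ T? a)) (cong c (∈-Xset⁻ H π b)))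

punchIn′-≢ : ∀ {n} (i : Fin n) j → punchIn′ i j ≢ i
punchIn′-≢ {suc n} i j eq = Fₚ.punchInᵢ≢i i j eq

punchIn′-surj : ∀ {n} (i j : Fin n) → j ≢ i → ∃ λ k → punchIn′ i k ≡ j
punchIn′-surj {suc n} i j ne = punchOut (λ eq → ne (sym eq)) , Fₚ.punchIn-punchOut (λ eq → ne (sym eq))

Uncolourable : Config → Set
Uncolourable C = ∀ c → (∀ v → proj C (c v) ≡ v) → ¬ (∀ ẽ → ¬ Mono (H C) (proj C) c ẽ)

-- The edge is exempted instead of deleted, so that the other edges keep their numbers.
ColourableWithout : (C : Config) → Fin (nE (H C)) → Set
ColourableWithout C ẽ = ∃ λ c → (∀ v → proj C (c v) ≡ v) × (∀ ẽ′ → ẽ′ ≢ ẽ → ¬ Mono (H C) (proj C) c ẽ′)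

MinUnc : Config → Set
MinUnc C = Uncolourable C × (∀ ẽ → ColourableWithout C ẽ)

minUnc⁻ : ∀ {C} → MinUncolorable C → MinUnc C
minUnc⁻ {C} (unc , del) = (λ c sec ind → unc (colorable⁺ (H C) (proj C) c sec ind)) , λ ẽ → dl ẽ
  where
  dl : ∀ ẽ → ColourableWithout C ẽ
  dl ẽ with colorable⁻ (deleteEdge (H C) ẽ) (proj C) (del ẽ)
  ... | c , sec , ind = c , sec , λ ẽ′ ne → let k , eq = punchIn′-surj ẽ ẽ′ ne
                                           in subst (λ z → ¬ Mono (H C) (proj C) c z) eq (ind k)

minUnc⁺ : ∀ {C} → MinUnc C → MinUncolorable C
minUnc⁺ {C} (unc , del) = (λ col → let c , sec , ind = colorable⁻ (H C) (proj C) col in unc c sec ind) ,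
  λ ẽ → let c , sec , ind = del ẽ in
    colorable⁺ (deleteEdge (H C) ẽ) (proj C) c sec (λ k → ind (punchIn′ ẽ k) (punchIn′-≢ ẽ k))

enum-< : ∀ {n} {f : Fin n → Bool} (En : Enum f) q → f q ≢ true → Enum.size′ En < n
enum-< {suc n} {f} En q ¬fq = s≤s (Fₚ.injective⇒≤ {f = λ i → punchOut (q≢ i)}
    (λ eq → Enum.emb-inj En (Fₚ.punchOut-injective (q≢ _) (q≢ _) eq)))
  where
  q≢ : ∀ i → q ≢ Enum.emb En i
  q≢ i eq = ¬fq (subst (λ z → f z ≡ true) (sym eq) (Enum.emb-true En i))

-- `inside-fV` keeps every chosen edge whole, so its size is still at least 2 after the restriction.
module SubHG (G : Hypergraph) {fV : Fin (nV G) → Bool} {fE : Fin (nE G) → Bool} (EV : Enum fV) (EE : Enum fE)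
  (inside-fV : ∀ {e p} → fE e ≡ true → p ∈ inc G e → fV p ≡ true) where

  private
    module EV = Enum EV
    module EE = Enum EE

  inc′ : Fin EE.size′ → Subset EV.size′
  inc′ i = tabulate (λ j → lookup (inc G (EE.emb i)) (EV.emb j))

  ∈-inc′⁺ : ∀ {i j} → EV.emb j ∈ inc G (EE.emb i) → j ∈ inc′ i
  ∈-inc′⁺ h = ∈-tabulate⁺ ([]=⇒lookup h)

  ∈-inc′⁻ : ∀ {i j} → j ∈ inc′ i → EV.emb j ∈ inc G (EE.emb i)
  ∈-inc′⁻ {i} {j} h = lookup⇒[]= (EV.emb j) (inc G (EE.emb i)) (∈-tabulate⁻ h)

  lift : ∀ {i p} → p ∈ inc G (EE.emb i) → ∃ λ j → j ∈ inc′ i × EV.emb j ≡ p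
  lift {i} {p} h = EV.idx p t , ∈-inc′⁺ (subst (_∈ inc G (EE.emb i)) (sym (EV.emb-idx p t)) h) , EV.emb-idx p t
    where t = inside-fV (EE.emb-true i) h

  subHG : Hypergraph
  subHG = mkHG EV.size′ EE.size′ inc′ size′
    where
    size′ : ∀ i → 2 ≤ ∣ inc′ i ∣
    size′ i =
      let p , q , hp , hq , ne = ∣∣≥2⁻ (size G (EE.emb i))
          j , hj , ej = lift hp
          k , hk , ek = lift hq
      in ∣∣≥2⁺ (λ eq → ne (trans (sym ek) (trans (cong EV.emb (sym eq)) ej))) hj hk

true≢false : true ≢ false
true≢false ()

-- With a second vertex to be reached, every vertex has an edge, so its positive degree bounds a
-- nonempty fibre.
section-exists : (C : Config) → Connected (G C) → DegreeFeasible C → 2 ≤ nV (G C) →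
  ∃ λ (c : Fin (nV (G C)) → Fin (nV (H C))) → ∀ v → proj C (c v) ≡ v
section-exists C con df two = (λ v → proj₁ (pick v)) , (λ v → ∈-Xset⁻ (H C) (proj C) (proj₂ (pick v)))
  where
  pick : ∀ v → Nonempty (X C v)
  pick v =
    let q , ne = another two v
        e , p , _ , hp , _ , p∈ , _ = reach⇒crossing (con v q) (Sₚ.x∈⁅x⁆ v) (λ h → ne (Sₚ.x∈⁅y⁆⇒x≡y v h))
    in ∣∣≥1⁻ (X C v) (ℕ.≤-trans (∣∣≥1⁺ (∈-star⁺ (G C) (subst (_∈ inc (G C) e) (Sₚ.x∈⁅y⁆⇒x≡y v p∈) hp))) (df v))

module Split (C : Config) (con : Connected (G C)) (cov : IsCover C) (df : DegreeFeasible C) (mu : MinUnc C)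
  (c₀ : Fin (nV (G C)) → Fin (nV (H C))) (sec₀ : ∀ v → proj C (c₀ v) ≡ v)
  (v : Fin (nV (G C))) (W : Subset (nV (G C))) (dis : Disconnecting (G C) (_≡ v) W) where

  open Cover C cov
  open Tight df (λ c sec ind → proj₁ mu c sec (λ ẽ m → misses ind ẽ (λ x h → tt , m x h)))

  sV : V → Bool
  sV p = does (p Sₚ.∈? W)

  sV-true : ∀ {p} → sV p ≡ true → p ∈ W
  sV-true {p} = does⁻ (p Sₚ.∈? W)

  sV-false : ∀ {p} → sV p ≡ false → p ∉ W
  sV-false {p} eq h with trans (sym eq) (dec-true (p Sₚ.∈? W) h)
  ... | ()

  abstract
    rep : ∀ e → ∃ λ p → p ∈ᴳ e × p ≢ v
    rep e = let p , q , hp , hq , ne = ∣∣≥2⁻ (size (G C) e) in pk p q hp hq ne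
      where
      pk : ∀ p q → p ∈ᴳ e → q ∈ᴳ e → q ≢ p → ∃ λ p → p ∈ᴳ e × p ≢ v
      pk p q hp hq ne with p ≟ v
      ... | yes refl = q , hq , ne
      ... | no ne′ = p , hp , ne′

  same-side : ∀ {e p q} → p ∈ᴳ e → q ∈ᴳ e → p ≢ v → q ≢ v → sV p ≡ sV q
  same-side {e} {p} {q} hp hq np nq with sV p in ep | sV q in eq
  ... | true | true = refl
  ... | false | false = refl
  ... | true | false = ⊥-elim (proj₂ (proj₂ (proj₂ dis)) (e , p , q , hp , hq , sV-true ep , sV-false eq , nq))
  ... | false | true = ⊥-elim (proj₂ (proj₂ (proj₂ dis)) (e , q , p , hq , hp , sV-true eq , sV-false ep , np))

  sE : E → Bool
  sE e = sV (proj₁ (rep e))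

  sE-spec : ∀ {e p} → p ∈ᴳ e → p ≢ v → sV p ≡ sE e
  sE-spec {e} h ne = same-side h (proj₁ (proj₂ (rep e))) ne (proj₂ (proj₂ (rep e)))

  near₀ : ∃ λ c → Near c v
  near₀ = near-exists df con sec₀ v

  c⁰ : V → VH
  c⁰ = proj₁ near₀

  nr⁰ : Near c⁰ v
  nr⁰ = proj₂ near₀

  -- The fibre over v is divided according to the side whose edges block a vertex.
  sX : VH → Bool
  sX x with π x ≟ v
  ... | yes eq = sE (g (proj₁ (near-blk nr⁰ x eq)))
  ... | no _ = sV (π x)

  sH : EH → Bool
  sH ẽ = sE (g ẽ)

  mix : Bool → (V → VH) → (V → VH) → V → VH
  mix b c d w with sV w B.≟ b
  ... | yes _ = c w
  ... | no _ = d w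

  mix-yes : ∀ {b} c d {w} → sV w ≡ b → mix b c d w ≡ c w
  mix-yes {b} c d {w} eq with sV w B.≟ b
  ... | yes _ = refl
  ... | no ne = ⊥-elim (ne eq)

  mix-no : ∀ {b} c d {w} → sV w ≢ b → mix b c d w ≡ d w
  mix-no {b} c d {w} ne with sV w B.≟ b
  ... | yes eq = ⊥-elim (ne eq)
  ... | no _ = refl

  mix-section : ∀ {b c d} → Section c → Section d → Section (mix b c d)
  mix-section {b} sc sd w with sV w B.≟ b
  ... | yes _ = sc w
  ... | no _ = sd w

  -- Both near-colourings could be combined across v, so the side that blocks x does not depend on the near-colouring.
  side-const : ∀ {c} → Near c v → ∀ {x ẽ} (πx : π x ≡ v) → Blk c (_≢ v) x ẽ →
    sH ẽ ≡ sE (g (proj₁ (near-blk nr⁰ x πx)))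
  side-const {c} (sc , ind) {x} {ẽ} πx b with sH ẽ B.≟ sH (proj₁ (near-blk nr⁰ x πx))
  ... | yes eq = eq
  ... | no ne = ⊥-elim (ne (cong sH (near-unique nr′ πx
          (blk-mono′ b (λ {w} hw nw → mix-yes c c⁰ (sE-spec hw nw)))
          (blk-mono′ (proj₂ (near-blk nr⁰ x πx)) (λ {w} hw nw → mix-no c c⁰ (λ eq → ne (trans (sym eq) (sE-spec hw nw))))))))
    where
    s = sH ẽ
    c′ = mix s c c⁰
    blk-mono′ : ∀ {d ẽ} → Blk d (_≢ v) x ẽ → (∀ {w} → w ∈ᴳ (g ẽ) → w ≢ v → c′ w ≡ d w) → Blk c′ (_≢ v) x ẽ
    blk-mono′ (mkBlk h bl) ag = mkBlk h λ y hy ny → let d , e = bl y hy ny in d , trans (ag (π∈ hy) d) e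
    nr′ : Near c′ v
    nr′ = mix-section sc (proj₁ nr⁰) , mkInd ind′
      where
      ind′ : ∀ ẽ → ¬ Hit c′ (_≢ v) ẽ
      ind′ ẽ₁ hit with sH ẽ₁ B.≟ s
      ... | yes eq = misses ind ẽ₁ (λ y hy → let d , e = hit y hy in d , trans
          (sym (mix-yes c c⁰ (trans (sE-spec (π∈ hy) d) eq))) e)
      ... | no neq = misses (proj₂ nr⁰) ẽ₁ (λ y hy → let d , e = hit y hy in d , trans
          (sym (mix-no c c⁰ (λ q → neq (trans (sym (sE-spec (π∈ hy) d)) q)))) e)

  mono? : ∀ c ẽ → Dec (Mono (H C) π c ẽ)
  mono? c ẽ = Fₚ.all? (λ x → (x Sₚ.∈? inc (H C) ẽ) →-dec (c (π x) ≟ x))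

  -- Over v this is where minimality is used: a colouring of H without ẽ must contain ẽ, so away
  -- from v it is a near-colouring in which ẽ blocks x, and `side-const` applies.
  sX-sH : ∀ {ẽ x} → x ∈ᴴ ẽ → sX x ≡ sH ẽ
  sX-sH {ẽ} {x} h with π x ≟ v
  ... | no ne = sE-spec (π∈ h) ne
  ... | yes πx = let c , sec , ind = proj₂ mu ẽ in go c sec ind (mono? c ẽ)
    where
    go : ∀ c → Section c → (∀ ẽ′ → ẽ′ ≢ ẽ → ¬ Mono (H C) π c ẽ′) → Dec (Mono (H C) π c ẽ) →
      sE (g (proj₁ (near-blk nr⁰ x πx))) ≡ sH ẽ
    go c sec ind (no nm) = ⊥-elim (proj₁ mu c sec all)
      where
      all : ∀ ẽ′ → ¬ Mono (H C) π c ẽ′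
      all ẽ′ with ẽ′ ≟ ẽ
      ... | yes refl = nm
      ... | no ne = ind ẽ′ ne
    go c sec ind (yes m) = sym (side-const (sec , mkInd λ ẽ′ hit → ind ẽ′
        (λ eq → proj₁ (hit x (subst (λ z → x ∈ᴴ z) (sym eq) h)) πx) (λ y hy → proj₂ (hit y hy)))
        πx (mkBlk h λ y hy ne → (λ πy → ne (fibre-unique hy h (trans πy (sym πx)))) , m y hy))

  sX-other : ∀ {x} → π x ≢ v → sX x ≡ sV (π x)
  sX-other {x} ne with π x ≟ v
  ... | yes eq = ⊥-elim (ne eq)
  ... | no _ = refl

  -- Replace c by `c⁰` on the other side and keep `c v`. An edge of the other side does not contain
  -- `c v`, by `sX-sH`, so it is not completed there; the conflict that must exist lies on side b.
  one-side : ∀ {b c} → Section c → sX (c v) ≡ b → ¬ (∀ ẽ → sH ẽ ≡ b → ¬ Mono (H C) π c ẽ)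
  one-side {b} {c} sc sb no-hit = proj₁ mu c′ sc′ no-hit′
    where
    c₁ = mix b c c⁰
    c′ = upd c₁ v (c v)
    sc′ : Section c′
    sc′ = upd-section (mix-section sc (proj₁ nr⁰)) (sc v)
    no-hit′ : ∀ ẽ → ¬ Mono (H C) π c′ ẽ
    no-hit′ ẽ m with sH ẽ B.≟ b
    ... | yes eq = no-hit ẽ eq (λ x h → trans (sym (agree x h)) (m x h))
      where
      agree : ∀ x → x ∈ᴴ ẽ → c′ (π x) ≡ c (π x)
      agree x h with π x ≟ v
      ... | yes e = cong c (sym e)
      ... | no ne = mix-yes c c⁰ (trans (sE-spec (π∈ h) ne) eq)
    ... | no neq = misses (proj₂ nr⁰) ẽ hit
      where
      hit : Hit c⁰ (_≢ v) ẽ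
      hit x h = ne , trans (sym (trans (upd-other c₁ v (c v) ne) (mix-no c c⁰ (λ q → neq (trans (sym (sE-spec (π∈ h) ne)) q)))))
          (m x h)
        where
        ne : π x ≢ v
        ne πx = neq (trans (sym (sX-sH h)) (trans (cong sX (trans (sym (m x h)) (trans (cong c′ πx) (upd-same c₁ v (c v))))) sb))

  module Side (b : Bool) where
    fV? : ∀ p → Dec (p ≡ v ⊎ sV p ≡ b)
    fV? p = (p ≟ v) ⊎-dec (sV p B.≟ b)
    fV : V → Bool
    fV p = does (fV? p)
    fE : E → Bool
    fE e = does (sE e B.≟ b)
    fX : VH → Bool
    fX x = does (sX x B.≟ b)
    fH : EH → Bool
    fH ẽ = does (sH ẽ B.≟ b)
    EV : Enum fV
    EV = enum fV
    EE : Enum fE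
    EE = enum fE
    EX : Enum fX
    EX = enum fX
    EHn : Enum fH
    EHn = enum fH
    module EV = Enum EV
    module EE = Enum EE
    module EX = Enum EX
    module EHn = Enum EHn

    fE-fV : ∀ {e p} → fE e ≡ true → p ∈ᴳ e → fV p ≡ true
    fE-fV {e} {p} fe h with p ≟ v
    ... | yes _ = refl
    ... | no ne = dec-true (sV p B.≟ b) (trans (sE-spec h ne) (does⁻ (sE e B.≟ b) fe))

    fH-fX : ∀ {ẽ x} → fH ẽ ≡ true → x ∈ᴴ ẽ → fX x ≡ true
    fH-fX {ẽ} {x} fh h = dec-true (sX x B.≟ b) (trans (sX-sH h) (does⁻ (sH ẽ B.≟ b) fh))

    fX-fV : ∀ {x} → fX x ≡ true → fV (π x) ≡ true
    fX-fV {x} fx = dec-true (fV? (π x)) (aux (π x ≟ v))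
      where
      aux : Dec (π x ≡ v) → π x ≡ v ⊎ sV (π x) ≡ b
      aux (yes eq) = inj₁ eq
      aux (no ne) = inj₂ (trans (sym (sX-other ne)) (does⁻ (sX x B.≟ b) fx))

    module GS = SubHG (G C) EV EE fE-fV
    module HS = SubHG (H C) EX EHn fH-fX

    π′ : Fin EX.size′ → Fin EV.size′
    π′ x = EV.idx (π (EX.emb x)) (fX-fV (EX.emb-true x))

    emb-π′ : ∀ x → EV.emb (π′ x) ≡ π (EX.emb x)
    emb-π′ x = EV.emb-idx _ _

    C′ : Config
    C′ = mkConfig GS.subHG HS.subHG π′

    g′ : Fin EHn.size′ → Fin EE.size′
    g′ ẽ = EE.idx (g (EHn.emb ẽ)) (EHn.emb-true ẽ)

    emb-g′ : ∀ ẽ → EE.emb (g′ ẽ) ≡ g (EHn.emb ẽ)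
    emb-g′ ẽ = EE.emb-idx _ _

    cov′ : IsCover C′
    cov′ = indep , g′ , proj∈ , one , disj
      where
      proj∈ : ∀ ẽ x → x ∈ HS.inc′ ẽ → π′ x ∈ GS.inc′ (g′ ẽ)
      proj∈ ẽ x h = GS.∈-inc′⁺ (subst₂ (λ p e → p ∈ᴳ e) (sym (emb-π′ x)) (sym (emb-g′ ẽ)) (π∈ (HS.∈-inc′⁻ h)))
      indep : ∀ w ẽ → ¬ (HS.inc′ ẽ ⊆ X C′ w)
      indep w ẽ sub =
        let x , _ , hx , _ = ∣∣≥2⁻ (size (H C) (EHn.emb ẽ))
            y , hy , ne = other-end hx
            x′ , hx′ , ex = HS.lift {ẽ} hx
            y′ , hy′ , ey = HS.lift {ẽ} hy
            at : ∀ {z} z′ → z′ ∈ HS.inc′ ẽ → EX.emb z′ ≡ z → π z ≡ EV.emb w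
            at z′ h e = trans (cong π (sym e)) (trans (sym (emb-π′ z′)) (cong EV.emb (∈-Xset⁻ (H C′) π′ (sub h))))
        in ne (trans (at y′ hy′ ey) (sym (at x′ hx′ ex)))
      one : ∀ ẽ w → w ∈ GS.inc′ (g′ ẽ) → ∣ HS.inc′ ẽ ∩ X C′ w ∣ ≡ 1
      one ẽ w h =
        let x , hx , πx = fibre (EHn.emb ẽ) (subst (λ e → EV.emb w ∈ᴳ e) (emb-g′ ẽ) (GS.∈-inc′⁻ h))
            x′ , hx′ , ex = HS.lift {ẽ} hx
        in ∣∣≡1⁺ {x = x′} (Sₚ.x∈p∩q⁺ (hx′ , ∈-Xset⁺ (H C′) π′ (EV.emb-inj (trans (emb-π′ x′) (trans (cong π ex) πx)))))
             (λ y hy → let a , d = Sₚ.x∈p∩q⁻ (HS.inc′ ẽ) (X C′ w) hy in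
                EX.emb-inj (trans (fibre-unique (HS.∈-inc′⁻ a) hx
                  (trans (sym (emb-π′ y)) (trans (cong EV.emb (∈-Xset⁻ (H C′) π′ d)) (sym πx)))) (sym ex)))
      disj : ∀ ẽ ẽ′ → ẽ ≢ ẽ′ → g′ ẽ ≡ g′ ẽ′ → Empty (HS.inc′ ẽ ∩ HS.inc′ ẽ′)
      disj ẽ ẽ′ ne eq (x , h) =
        let a , d = Sₚ.x∈p∩q⁻ (HS.inc′ ẽ) (HS.inc′ ẽ′) h
        in ne (EHn.emb-inj (matching (HS.∈-inc′⁻ a) (HS.∈-inc′⁻ d)
             (trans (sym (emb-g′ ẽ)) (trans (cong EE.emb eq) (emb-g′ ẽ′)))))

    con′ : Connected (G C′)
    con′ p q = reach-trans (reach-sym (from-v p)) (from-v q)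
      where
      v′ : Fin EV.size′
      v′ = EV.idx v (dec-true (fV? v) (inj₁ refl))
      -- The walk is followed backwards from its end: the edge entering a vertex other than v of
      -- this side belongs to this side, so its other end is v or again on this side. A return to v
      -- ends the search.
      go : ∀ {p} → Reach (G C) v p → ∀ p′ → EV.emb p′ ≡ p → Reach (G C′) v′ p′
      at-v : ∀ {p} p′ → EV.emb p′ ≡ p → p ≡ v → Reach (G C′) v′ p′
      at-v p′ eq p≡v = subst (Reach (G C′) v′) (EV.emb-inj (trans (EV.emb-idx v _) (trans (sym p≡v) (sym eq)))) here
      go here p′ eq = at-v p′ eq refl
      go (step {w} {p} e r hw hp) p′ eq = aux (p ≟ v)
        where
        aux : Dec (p ≡ v) → Reach (G C′) v′ p′
        aux (yes p≡v) = at-v p′ eq p≡v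
        aux (no ne) =
          let side : sV p ≡ b
              side = [ (λ h → ⊥-elim (ne (trans (sym eq) h))) , (λ h → trans (cong sV (sym eq)) h) ]′
                  (does⁻ (fV? (EV.emb p′)) (EV.emb-true p′))
              fe : fE e ≡ true
              fe = dec-true (sE e B.≟ b) (trans (sym (sE-spec hp ne)) side)
              e′ = EE.idx e fe
              hw′ : w ∈ᴳ (EE.emb e′)
              hw′ = ∈ᴳ-resp (sym (EE.emb-idx e fe)) hw
              w′ , kw , ew = GS.lift {e′} hw′
          in step e′ (go r w′ ew) kw (GS.∈-inc′⁺ (subst₂ (λ p e → p ∈ᴳ e) (sym eq) (sym (EE.emb-idx e fe)) hp))
      from-v : ∀ p′ → Reach (G C′) v′ p′
      from-v p′ = go (con v (EV.emb p′)) p′ refl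

    -- A near-colouring with hole p assigns to each edge at p a colour that it blocks. By `sX-sH`
    -- this colour is on the side of the edge, so the assignment restricts to each side.
    df′ : DegreeFeasible C′
    df′ w = ∣∣-mono-rel (star (G C′) w) (X C′ w) R total inj
      where
      p = EV.emb w
      nr : ∃ λ c → Near c p
      nr = near-exists df con sec₀ p
      c = proj₁ nr
      R : Fin EE.size′ → Fin EX.size′ → Set
      R e x = ∃ λ ẽ → Blk c (_≢ p) (EX.emb x) ẽ × g ẽ ≡ EE.emb e
      total : ∀ e → e ∈ star (G C′) w → ∃ λ x → x ∈ X C′ w × R e x
      total e he =
        let x , ẽ , πx , bl , ge = near-edge (proj₂ nr) (EE.emb e) (GS.∈-inc′⁻ (∈-star⁻ (G C′) he))
            fx = dec-true (sX x B.≟ b) (trans (sX-sH (end bl)) (trans (cong sE ge) (does⁻ (sE (EE.emb e) B.≟ b) (EE.emb-true e))))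
            ex = EX.emb-idx x fx
        in EX.idx x fx , ∈-Xset⁺ (H C′) π′ (EV.emb-inj (trans (emb-π′ _) (trans (cong π ex) πx))) ,
           ẽ , subst (λ x → Blk c (_≢ p) x ẽ) (sym ex) bl , ge
      inj : ∀ e e′ x → e ∈ star (G C′) w → e′ ∈ star (G C′) w → R e x → R e′ x → e ≡ e′
      inj e e′ x he he′ (ẽ , bl , ge) (ẽ′ , bl′ , ge′) =
        EE.emb-inj (trans (sym ge) (trans (cong g (near-unique (proj₂ nr) πx bl bl′)) ge′))
        where
        -- Otherwise the uncoloured p would be one of the coloured ends of the edge that blocks x.
        πx : π (EX.emb x) ≡ p
        πx = by-edge (other (size (G C) (g ẽ)) (π∈ (end bl)))
          where
          by-edge : (∃ λ q → q ∈ᴳ (g ẽ) × q ≢ π (EX.emb x)) → π (EX.emb x) ≡ p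
          by-edge _ with π (EX.emb x) ≟ p
          ... | yes eq = eq
          ... | no ne = ⊥-elim (proj₁ (blk-end bl (∈ᴳ-resp (sym ge) (GS.∈-inc′⁻ (∈-star⁻ (G C′) he))) (λ eq → ne (sym eq))) refl)

    mu′ : MinUnc C′
    mu′ = unc′ , del′
      where
      unc′ : Uncolourable C′
      unc′ c sc no-hit = one-side sec (sX-at v (dec-true (fV? v) (inj₁ refl))) no-hit′
        where
        pick : ∀ w (t : Bool) → fV w ≡ t → VH
        pick w true h = EX.emb (c (EV.idx w h))
        -- The values off this side are arbitrary: `one-side` replaces them.
        pick w false _ = c₀ w
        ext : V → VH
        ext w = pick w (fV w) refl
        pick-in : ∀ w (h : fV w ≡ true) t e → pick w t e ≡ EX.emb (c (EV.idx w h))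
        pick-in w h true e = cong (λ z → EX.emb (c z)) (EV.emb-inj (trans (EV.emb-idx w e) (sym (EV.emb-idx w h))))
        pick-in w h false e = ⊥-elim (true≢false (trans (sym h) e))
        ext-in : ∀ w (h : fV w ≡ true) → ext w ≡ EX.emb (c (EV.idx w h))
        ext-in w h = pick-in w h (fV w) refl
        sec : Section ext
        sec w = go (fV w) refl
          where
          go : ∀ t e → π (pick w t e) ≡ w
          go true h = trans (sym (emb-π′ _)) (trans (cong EV.emb (sc _)) (EV.emb-idx w h))
          go false _ = sec₀ w
        sX-at : ∀ w (h : fV w ≡ true) → sX (ext w) ≡ b
        sX-at w h = trans (cong sX (ext-in w h)) (does⁻ (sX (EX.emb (c (EV.idx w h))) B.≟ b) (EX.emb-true _))
        no-hit′ : ∀ ẽ → sH ẽ ≡ b → ¬ Mono (H C) π ext ẽ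
        no-hit′ ẽ sh m = no-hit ẽ′ (λ x h → EX.emb-inj (trans (sym (trans (ext-in (π (EX.emb x)) (fX-fV (EX.emb-true x)))
              refl)) (m (EX.emb x) (subst (λ z → EX.emb x ∈ᴴ z) eẽ (HS.∈-inc′⁻ h)))))
          where
          fh = dec-true (sH ẽ B.≟ b) sh
          ẽ′ = EHn.idx ẽ fh
          eẽ = EHn.emb-idx ẽ fh
      del′ : ∀ ẽ → ColourableWithout C′ ẽ
      del′ ẽ = let c , sc , ind = proj₂ mu (EHn.emb ẽ) in go c sc ind
        where
        sh : sH (EHn.emb ẽ) ≡ b
        sh = does⁻ (sH (EHn.emb ẽ) B.≟ b) (EHn.emb-true ẽ)
        go : ∀ c → Section c → (∀ ẽ′ → ẽ′ ≢ EHn.emb ẽ → ¬ Mono (H C) π c ẽ′) →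
          ColourableWithout C′ ẽ
        go c sc ind = c′ , sc′ , ind′
          where
          -- If `c v` were on the other side, that side would be free of conflicts, as the exempted
          -- edge is not there; this contradicts `one-side`.
          sv : sX (c v) ≡ b
          sv with sX (c v) B.≟ b
          ... | yes eq = eq
          ... | no ne = ⊥-elim (one-side sc refl (λ ẽ₁ s₁ → ind ẽ₁ (λ eq → ne (trans (sym s₁) (trans (cong sH eq) sh)))))
          fx : ∀ w → fX (c (EV.emb w)) ≡ true
          fx w = dec-true (sX (c (EV.emb w)) B.≟ b) ([ (λ eq → trans (cong (λ z → sX (c z)) eq) sv) ,
              (λ eq → at (EV.emb w) eq) ]′ (does⁻ (fV? (EV.emb w)) (EV.emb-true w)))
            where
            at : ∀ w → sV w ≡ b → sX (c w) ≡ b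
            at w eq with w ≟ v
            ... | yes refl = sv
            ... | no ne = trans (sX-other (λ e → ne (trans (sym (sc w)) e))) (trans (cong sV (sc w)) eq)
          c′ : Fin EV.size′ → Fin EX.size′
          c′ w = EX.idx (c (EV.emb w)) (fx w)
          sc′ : ∀ w → π′ (c′ w) ≡ w
          sc′ w = EV.emb-inj (trans (emb-π′ _) (trans (cong π (EX.emb-idx _ (fx w))) (sc _)))
          ind′ : ∀ ẽ′ → ẽ′ ≢ ẽ → ¬ Mono (H C′) π′ c′ ẽ′
          ind′ ẽ′ ne m = ind (EHn.emb ẽ′) (λ eq → ne (EHn.emb-inj eq)) (λ x h →
            let x′ , hx′ , ex = HS.lift {ẽ′} h in
            trans (cong c (trans (cong π (sym ex)) (sym (emb-π′ x′))))
              (trans (sym (EX.emb-idx _ (fx (π′ x′)))) (trans (cong EX.emb (m x′ hx′)) ex)))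

    smaller : (∃ λ q → q ≢ v × sV q ≢ b) → nV (G C′) < nV (G C)
    smaller (q , nq , nb) = enum-< EV q (λ h → [ nq , nb ]′ (does⁻ (fV? q) h))

  module S₁ = Side true
  module S₂ = Side false

  compl : ∀ b → does (b B.≟ false) ≡ not (does (b B.≟ true))
  compl false = refl
  compl true = refl

  conflict : ∀ {b} → b ≡ true → b ≡ false → ⊥₀
  conflict {false} () q
  conflict {true} p ()

  is-merge : IsMerge C S₁.C′ S₂.C′
  is-merge =
    S₁.EV.idx v (dec-true (S₁.fV? v) (inj₁ refl)) , S₂.EV.idx v (dec-true (S₂.fV? v) (inj₁ refl)) ,
    S₁.EV.emb , S₂.EV.emb ,
    proj₁ (enum-↔ S₁.EE S₂.EE (λ e → compl (sE e))) ,
    proj₁ (enum-↔ S₁.EX S₂.EX (λ e → compl (sX e))) ,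
    proj₁ (enum-↔ S₁.EHn S₂.EHn (λ e → compl (sH e))) ,
    (λ x y eq → S₁.EV.emb-inj eq) , (λ x y eq → S₂.EV.emb-inj eq) ,
    trans (S₁.EV.emb-idx v _) (sym (S₂.EV.emb-idx v _)) ,
    (λ x y eq → let m = meet x y eq in
       S₁.EV.emb-inj (trans m (sym (S₁.EV.emb-idx v _))) , S₂.EV.emb-inj (trans (sym eq) (trans m (sym (S₂.EV.emb-idx v _))))) ,
    cover ,
    (λ e z → mk⇔ S₁.GS.lift (λ (x , h , eq) → subst (_∈ᴳ (S₁.EE.emb e)) eq (S₁.GS.∈-inc′⁻ h))) ,
    (λ e z → mk⇔ S₂.GS.lift (λ (x , h , eq) → subst (_∈ᴳ (S₂.EE.emb e)) eq (S₂.GS.∈-inc′⁻ h))) ,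
    (λ e x → mk⇔ S₁.HS.∈-inc′⁺ S₁.HS.∈-inc′⁻) ,
    (λ e y h → conflict (trans (sX-sH h) (does⁻ (sH (S₁.EHn.emb e) B.≟ true) (S₁.EHn.emb-true e)))
       (does⁻ (sX (S₂.EX.emb y) B.≟ false) (S₂.EX.emb-true y))) ,
    (λ e y → mk⇔ S₂.HS.∈-inc′⁺ S₂.HS.∈-inc′⁻) ,
    (λ e x h → conflict (does⁻ (sX (S₁.EX.emb x) B.≟ true) (S₁.EX.emb-true x))
       (trans (sX-sH h) (does⁻ (sH (S₂.EHn.emb e) B.≟ false) (S₂.EHn.emb-true e)))) ,
    (λ x → sym (S₁.emb-π′ x)) , (λ y → sym (S₂.emb-π′ y))
    where
    meet : ∀ x y → S₁.EV.emb x ≡ S₂.EV.emb y → S₁.EV.emb x ≡ v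
    meet x y eq with does⁻ (S₁.fV? (S₁.EV.emb x)) (S₁.EV.emb-true x) | does⁻ (S₂.fV? (S₂.EV.emb y)) (S₂.EV.emb-true y)
    ... | inj₁ h | _ = h
    ... | inj₂ _ | inj₁ k = trans eq k
    ... | inj₂ h | inj₂ k = ⊥-elim (conflict h (trans (cong sV eq) k))
    cover : ∀ z → (∃ λ x → S₁.EV.emb x ≡ z) ⊎ (∃ λ y → S₂.EV.emb y ≡ z)
    cover z with sV z in eq
    ... | true = inj₁ (_ , S₁.EV.emb-idx z (dec-true (S₁.fV? z) (inj₂ eq)))
    ... | false = inj₂ (_ , S₂.EV.emb-idx z (dec-true (S₂.fV? z) (inj₂ eq)))

  split : ∃ λ C₁ → ∃ λ C₂ → IsMerge C C₁ C₂ ×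
    (Feasible C₁ × DegreeFeasible C₁ × MinUnc C₁ × nV (G C₁) < nV (G C)) ×
    (Feasible C₂ × DegreeFeasible C₂ × MinUnc C₂ × nV (G C₂) < nV (G C))
  split = S₁.C′ , S₂.C′ , is-merge ,
    ((S₁.con′ , S₁.cov′) , S₁.df′ , S₁.mu′ ,
      S₁.smaller (let q , q∉ , nq = proj₁ (proj₂ (proj₂ dis)) in q , nq , λ h → q∉ (sV-true h))) ,
    ((S₂.con′ , S₂.cov′) , S₂.df′ , S₂.mu′ ,
      S₂.smaller (let q , q∈ = proj₁ (proj₂ dis) in q , proj₁ dis q q∈ , λ h → sV-false h q∈))

-- Blocks

third : ∀ {n} {p : Subset n} {x y} → ∣ p ∣ ≢ 2 → x ≢ y → x ∈ p → y ∈ p → ∃ λ z → z ∈ p × z ≢ x × z ≢ y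
third {p = p} {x} {y} ≢2 x≢y hx hy with Fₚ.any? (λ z → (z Sₚ.∈? p) ×-dec (¬? (z ≟ x) ×-dec ¬? (z ≟ y)))
... | yes r = r
... | no ¬r = ⊥-elim (≢2 (trans (cong ∣_∣ (Sₚ.⊆-antisym sub sup)) (∣pair∣ x≢y)))
  where
  sub : p ⊆ ⁅ x ⁆ ∪ ⁅ y ⁆
  sub {z} h with z ≟ x | z ≟ y
  ... | yes refl | _ = ∈-pairˡ x y
  ... | no _ | yes refl = ∈-pairʳ x y
  ... | no a | no b = ⊥-elim (¬r (z , h , a , b))
  sup : ⁅ x ⁆ ∪ ⁅ y ⁆ ⊆ p
  sup h with ∈-pair⁻ h
  ... | inj₁ refl = hx
  ... | inj₂ refl = hy

Fin-singleton : ∀ {n} (e : Fin n) → (∀ f → f ≡ e) → n ≡ 1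
Fin-singleton {suc zero} e u = refl
Fin-singleton {suc (suc n)} e u with trans (u zero) (sym (u (suc zero)))
... | ()

all-in⇒⊤ : ∀ {n} (p : Subset n) → (∀ x → x ∈ p) → p ≡ ⊤
all-in⇒⊤ p all = Sₚ.⊆-antisym (λ _ → Sₚ.∈⊤) (λ {x} _ → all x)

record UncolorableBlock (C : Config) : Set where
  field
    con : Connected (G C)
    cov : IsCover C
    df : DegreeFeasible C
    unc : Uncolourable C
    c₀ : Fin (nV (G C)) → Fin (nV (H C))
    sec₀ : ∀ v → proj C (c₀ v) ≡ v
    block : ∀ v → ConnOff (G C) (_≡ v)

module Block {C : Config} (B : UncolorableBlock C) where

  open UncolorableBlock B public

  open Cover C cov public
  open Tight df (λ c sec ind → unc c sec (λ ẽ m → misses ind ẽ (λ x h → tt , m x h))) public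

  abstract
    near-at : ∀ v → ∃ λ c → Near c v
    near-at = near-exists df con sec₀

    -- As a is not separating, greedy colouring towards v can start from the prescribed colour of a.
    near-from : ∀ {a v} x → π x ≡ a → v ≢ a → ∃ λ c → Near c v × c a ≡ x
    near-from {a} {v} x πx ne =
      let c , nr , ag = greedy df (λ w → w ≟ a) (block a) (upd-section sec₀ πx)
            (mkInd λ ẽ hit → let y , _ , hy , _ = ∣∣≥2⁻ (size (H C) ẽ)
                                 z , hz , nz = other-end hy
                             in nz (trans (proj₁ (hit z hz)) (sym (proj₁ (hit y hy))))) ne
      in c , nr , trans (ag refl) (upd-same c₀ a x)

  -- Shifting the uncoloured vertex along a path off e that joins two vertices of e would
  -- recolour v while keeping a third vertex of e fixed, against the matching M_e.
  module Hyperedge (e : E) (large : ∣ inc (G C) e ∣ ≢ 2) where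

    module At (v : V) (v∈e : v ∈ᴳ e) {c : V → VH} (nr : Near c v) {x : VH} {ẽ : EH} (πx : π x ≡ v)
      (b : Blk c (_≢ v) x ẽ) (gẽ : g ẽ ≡ e) where

      R : V → V → Set
      R p q = ∃ λ f → f ≢ e × p ∈ᴳ f × q ∈ᴳ f

      R? : ∀ p q → Dec (R p q)
      R? p q = Fₚ.any? λ f → ¬? (f ≟ e) ×-dec ((p Sₚ.∈? inc (G C) f) ×-dec (q Sₚ.∈? inc (G C) f))

      Good : V → Set
      Good p = ∃ λ c′ → Near c′ p × (∀ {w} → w ∈ᴳ e → w ≢ v → c′ w ≡ c w) × (p ≡ v ⊎ c′ v ≢ x)

      -- The hole moves along an edge f other than e. If it leaves v, the colour given to v is
      -- blocked over f; were this colour x, uniqueness of the blocking edge would force f = e.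
      shifted : ∀ {p q} → Good p → (p ∈ᴳ e → p ≡ v) → R p q → q ≢ p →
        ∃ λ c′ → Near c′ q × (∀ {w} → w ∈ᴳ e → w ≢ v → c′ w ≡ c w) × c′ v ≢ x
      shifted {p} {q} (c′ , nr′ , ag , ne) p∈e (f , f≢e , hp , hq) q≢p =
        let z , f̃ , πz , bz , gf = near-edge nr′ f hp
        in upd c′ p z , shift nr′ πz bz (∈ᴳ-resp (sym gf) hq) q≢p ,
           (λ hw nv → trans (upd-other c′ p z (λ eq → nv (trans eq (p∈e (subst (_∈ᴳ e) eq hw))))) (ag hw nv)) ,
           not-x z f̃ πz bz gf ne
        where
        not-x : ∀ z f̃ → π z ≡ p → Blk c′ (_≢ p) z f̃ → g f̃ ≡ f → p ≡ v ⊎ c′ v ≢ x → upd c′ p z v ≢ x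
        not-x z f̃ πz bz gf ne′ = aux (p ≟ v) ne′
          where
          aux : Dec (p ≡ v) → p ≡ v ⊎ c′ v ≢ x → upd c′ p z v ≢ x
          aux (no nv) (inj₁ eq) = ⊥-elim (nv eq)
          aux (no nv) (inj₂ ne) eq = ne (trans (sym (upd-other c′ p z (λ e → nv (sym e)))) eq)
          aux (yes refl) _ eq = f≢e (trans (sym gf) (trans (cong g (near-unique nr′ πz bz b′)) gẽ))
            where
            z≡x : z ≡ x
            z≡x = trans (sym (upd-same c′ p z)) eq
            b′ : Blk c′ (_≢ p) z ẽ
            b′ = subst (λ z → Blk c′ (_≢ p) z ẽ) (sym z≡x) (mkBlk (end b) (λ y hy ny →
              let d , r = rest b y hy ny
              in d , trans (ag (subst (λ e → π y ∈ᴳ e) gẽ (π∈ hy)) d) r))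

      -- With the hole at an end q of e other than v, some edge ẽ′ over e blocks a colour of q. A
      -- third end w of e still has its old colour, which lies in both ẽ and ẽ′; so the two are
      -- equal and v has the colour x after all.
      avoids : ∀ {q} → (∃ λ c′ → Near c′ q × (∀ {w} → w ∈ᴳ e → w ≢ v → c′ w ≡ c w) × c′ v ≢ x) →
        q ∈ᴳ e → q ≡ v
      avoids {q} (c′ , nr′ , ag , ne) hq with q ≟ v
      ... | yes eq = eq
      ... | no q≢v =
        let y , ẽ′ , πy , b′ , gẽ′ = near-edge nr′ e hq
            w , hw , w≢v , w≢q = third large (λ eq → q≢v (sym eq)) v∈e hq
            cw∈ = proj₂ (blk-end b (∈ᴳ-resp (sym gẽ) hw) (λ eq → w≢v (trans eq πx)))
            cw∈′ = proj₂ (blk-end b′ (∈ᴳ-resp (sym gẽ′) hw) (λ eq → w≢q (trans eq πy)))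
            ẽ≡ẽ′ = matching cw∈ (subst (_∈ᴴ ẽ′) (ag hw w≢v) cw∈′) (trans gẽ (sym gẽ′))
            cv∈ = proj₂ (blk-end b′ (∈ᴳ-resp (sym gẽ′) v∈e) (λ eq → q≢v (sym (trans eq πy))))
        in ⊥-elim (ne (fibre-unique (subst (λ z → c′ v ∈ᴴ z) (sym ẽ≡ẽ′) cv∈) (end b) (trans (proj₁ nr′ v) (sym πx))))

      Invariant : V → Set
      Invariant p = Good p × (p ∈ᴳ e → p ≡ v)

      move : ∀ {p q} → Invariant p → R p q → Invariant q
      move {p} {q} (gp , pe) r = aux (q ≟ p)
        where
        aux : Dec (q ≡ p) → Invariant q
        aux (yes refl) = gp , pe
        aux (no ne) = let sh = shifted gp pe r ne
                          c′ , nr′ , ag , nx = sh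
                      in (c′ , nr′ , ag , inj₂ nx) , avoids sh

      along : ∀ {p q} → Invariant p → Star R p q → Invariant q
      along inv ε = inv
      along inv (r ◅ rs) = along (move inv r) rs

      good : ∀ {p} → Star R v p → Invariant p
      good = along ((c , nr , (λ _ _ → refl) , inj₁ refl) , λ _ → refl)

      cl : Closure R v
      cl = closure R? v

      open Closure cl

      -- The set reached from v by edges other than e meets e in v only. A second edge f at v makes
      -- this set without v nonempty; as v is not separating, an edge leaves it towards a vertex
      -- other than v. That edge is not e, so its far end was reached as well.
      only-edge : ∀ f → v ∈ᴳ f → f ≡ e
      only-edge f hf with f ≟ e
      ... | yes eq = eq
      ... | no f≢e =
        let q , hq , q≢v = other (size (G C) f) hf
            u , hu , u≢v = other (size (G C) e) v∈e
            out : ∀ {w} → w ∉ set - v → w ≢ v → w ∉ set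
            out = λ w∉ ne h → w∉ (Sₚ.x∈p∧x≢y⇒x∈p-y h ne)
            sub : ∀ {w} → w ∈ set - v → w ∈ set × w ≢ v
            sub = λ h → Sₚ.p─q⊆p set ⁅ v ⁆ h , minus h
            f′ , p , r , hp , hr , p∈ , r∉ , r≢v = block v (set - v) (λ h → proj₂ (sub h))
              (q , Sₚ.x∈p∧x≢y⇒x∈p-y (closed source (f , f≢e , hf , hq)) q≢v)
              (u , (λ h → u≢v (proj₂ (good (reach (proj₁ (sub h)))) hu)) , u≢v)
            p∈set , p≢v = sub p∈
            f′≢e = λ eq → p≢v (proj₂ (good (reach p∈set)) (∈ᴳ-resp eq hp))
        in ⊥-elim (out r∉ r≢v (closed p∈set (f′ , f′≢e , hp , hr)))
        where
        minus : ∀ {w} → w ∈ set - v → w ≢ v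
        minus {w} h refl = ℕ.<-irrefl (cong ∣_∣ (Sₚ.p─q─q≡p─q set ⁅ v ⁆)) (Sₚ.x∈p⇒∣p-x∣<∣p∣ h)

    only-edge : ∀ {v} f → v ∈ᴳ e → v ∈ᴳ f → f ≡ e
    only-edge {v} f v∈e hf =
      let c , nr = near-at v
          x , ẽ , πx , b , gẽ = near-edge nr e v∈e
      in At.only-edge v v∈e nr πx b gẽ f hf

    spanning : ∀ v → v ∈ᴳ e
    spanning v with v Sₚ.∈? inc (G C) e
    ... | yes h = h
    ... | no v∉ =
      let u , _ , hu , _ = ∣∣≥2⁻ (size (G C) e)
          f , p , q , hp , hq , p∈ , q∉ , _ = connected⇒connOff con (inc (G C) e) (λ _ ()) (u , hu) (v , v∉ , λ ())
      in ⊥-elim (q∉ (∈ᴳ-resp (only-edge f p∈ hp) hq))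

    all-edges : ∀ f → f ≡ e
    all-edges f = let p , _ , hp , _ = ∣∣≥2⁻ (size (G C) f) in only-edge f (spanning p) hp

    -- Every edge of H lies over e, so the edges that block x and y are identified by `blk-same`.
    fibre-singleton : ∀ x y → π x ≡ π y → x ≡ y
    fibre-singleton x y eq =
      let c , nr = near-at (π x)
          ẽ , b = near-blk nr x refl
          ẽ′ , b′ = near-blk nr y (sym eq)
      in proj₂ (blk-same b b′ (trans (all-edges _) (sym (all-edges _))) eq)

    H-edge : ∃ λ ẽ → ∀ ẽ′ → ẽ′ ≡ ẽ
    H-edge =
      let u , _ , hu , _ = ∣∣≥2⁻ (size (G C) e)
          c , nr = near-at u
          x , ẽ , πx , b , gẽ = near-edge nr e hu
      in ẽ , λ ẽ′ → let y , hy , πy = fibre ẽ′ (∈ᴳ-resp (sym (all-edges (g ẽ′))) hu)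
                    in matching hy (subst (_∈ᴴ ẽ) (fibre-singleton x y (trans πx (sym πy))) (end b))
                         (trans (all-edges _) (sym (all-edges _)))

    e-config : EConfig C
    e-config = Fin-singleton e all-edges ,
      (λ f → subst (λ f → inc (G C) f ≡ ⊤) (sym (all-edges f)) (all-in⇒⊤ (inc (G C) e) spanning)) ,
      (λ v → ∣∣≡1⁺ {x = c₀ v} (∈-Xset⁺ (H C) π (sec₀ v)) (λ y hy → fibre-singleton y (c₀ v)
         (trans (∈-Xset⁻ (H C) π hy) (sym (sec₀ v))))) ,
      Fin-singleton (proj₁ H-edge) (proj₂ H-edge) ,
      λ ẽ → all-in⇒⊤ (inc (H C) ẽ) (λ x → let y , hy , πy = fibre ẽ (subst (λ e → π x ∈ᴳ e) (sym (all-edges (g ẽ))) (spanning (π x)))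
                                         in subst (_∈ᴴ ẽ) (fibre-singleton y x πy) hy)

Adj′ : (G : Hypergraph) → Fin (nV G) → Fin (nV G) → Set
Adj′ G p q = p ≢ q × ∃ λ e → p ∈ inc G e × q ∈ inc G e

adj? : ∀ G p q → Dec (Adj′ G p q)
adj? G p q = ¬? (p ≟ q) ×-dec Fₚ.any? λ e → (p Sₚ.∈? inc G e) ×-dec (q Sₚ.∈? inc G e)

adj-sym : ∀ {G p q} → Adj′ G p q → Adj′ G q p
adj-sym (ne , e , hp , hq) = (λ eq → ne (sym eq)) , e , hq , hp

parallel : (G : Hypergraph) → Fin (nV G) → Fin (nV G) → Subset (nE G)
parallel G u v = compr (λ e → ≡-dec B._≟_ (inc G e) (⁅ u ⁆ ∪ ⁅ v ⁆))

module Graph {G : Hypergraph} (gr : IsGraph G) where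

  ∈-parallel⁺ : ∀ {u v e} → u ≢ v → u ∈ inc G e → v ∈ inc G e → e ∈ parallel G u v
  ∈-parallel⁺ {u} {v} {e} ne hu hv = ∈-compr⁺ (λ e → ≡-dec B._≟_ (inc G e) (⁅ u ⁆ ∪ ⁅ v ⁆)) (∣∣≡2⇒pair (gr e) ne hu hv)

  ∈-parallel⁻ : ∀ {u v e} → e ∈ parallel G u v → u ∈ inc G e × v ∈ inc G e
  ∈-parallel⁻ {u} {v} {e} h with ∈-compr⁻ (λ e → ≡-dec B._≟_ (inc G e) (⁅ u ⁆ ∪ ⁅ v ⁆)) h
  ... | eq = subst (u ∈_) (sym eq) (∈-pairˡ u v) , subst (v ∈_) (sym eq) (∈-pairʳ u v)

  adj⇒mult : ∀ {u v} → Adj′ G u v → 1 ≤ mult G u v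
  adj⇒mult (ne , e , hu , hv) = ∣∣≥1⁺ (∈-parallel⁺ ne hu hv)

  mult⇒adj : ∀ {u v} → u ≢ v → 1 ≤ mult G u v → Adj′ G u v
  mult⇒adj {u} {v} ne le = let e , h = ∣∣≥1⁻ (parallel G u v) le in ne , e , ∈-parallel⁻ h

  ¬adj⇒mult : ∀ {u v} → u ≢ v → ¬ Adj′ G u v → mult G u v ≡ 0
  ¬adj⇒mult {u} {v} ne na = ∣∣≡0⁺ (parallel G u v) (λ (e , h) → na (ne , e , ∈-parallel⁻ h))

  endpoints : ∀ {e u v w} → u ≢ v → u ∈ inc G e → v ∈ inc G e → w ∈ inc G e → w ≡ u ⊎ w ≡ v
  endpoints {e} {w = w} ne hu hv hw = ∈-pair⁻ (subst (w ∈_) (∣∣≡2⇒pair (gr e) ne hu hv) hw)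

  mult≡1⇒unique : ∀ {u v e e′} → mult G u v ≡ 1 → u ≢ v →
    u ∈ inc G e → v ∈ inc G e → u ∈ inc G e′ → v ∈ inc G e′ → e ≡ e′
  mult≡1⇒unique {u} {v} {e} {e′} one ne hu hv hu′ hv′ =
    let _ , _ , only = ∣∣≡1⁻ (parallel G u v) one
    in trans (only e (∈-parallel⁺ ne hu hv)) (sym (only e′ (∈-parallel⁺ ne hu′ hv′)))

section-independent : ∀ {C} → IsGraph (H C) → ∀ {c} → (∀ v → proj C (c v) ≡ v) → (∀ ẽ → ¬ Mono (H C) (proj C) c ẽ) →
  ∀ u v → ¬ Adj′ (H C) (c u) (c v)
section-independent {C} gr {c} sec free u v (ne , ẽ , hu , hv) = free ẽ mono
  where
  mono : Mono (H C) (proj C) c ẽ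
  mono x hx with Graph.endpoints {H C} gr ne hu hv hx
  ... | inj₁ refl = cong c (sec u)
  ... | inj₂ refl = cong c (sec v)

mult-sym : ∀ G u v → mult G u v ≡ mult G v u
mult-sym G u v = cong (λ p → ∣ tabulate (λ e → does (≡-dec B._≟_ (inc G e) p)) ∣) (Sₚ.∪-comm ⁅ u ⁆ ⁅ v ⁆)

module GraphBlock {C : Config} (B : UncolorableBlock C) (gr : IsGraph (G C)) where

  open Block B public
  open Graph {G C} gr public

  A : V → V → Set
  A = Adj′ (G C)

  infix 4 _~_ _~?_
  _~_ : VH → VH → Set
  x ~ y = Adj′ (H C) x y

  _~?_ : ∀ x y → Dec (x ~ y)
  _~?_ = adj? (H C)

  ~-sym : ∀ {x y} → x ~ y → y ~ x
  ~-sym = adj-sym {H C}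

  ~⇒A : ∀ {x y} → x ~ y → A (π x) (π y)
  ~⇒A (ne , ẽ , hx , hy) = (λ eq → ne (fibre-unique hx hy eq)) , g ẽ , π∈ hx , π∈ hy

  ends : ∀ {ẽ x y z} → x ≢ y → x ∈ᴴ ẽ → y ∈ᴴ ẽ → z ∈ᴴ ẽ → z ≡ x ⊎ z ≡ y
  ends ne hx hy hz with endpoints (λ eq → ne (fibre-unique hx hy eq)) (π∈ hx) (π∈ hy) (π∈ hz)
  ... | inj₁ eq = inj₁ (fibre-unique hz hx eq)
  ... | inj₂ eq = inj₂ (fibre-unique hz hy eq)

  H-graph : IsGraph (H C)
  H-graph ẽ =
    let x , y , hx , hy , ne = ∣∣≥2⁻ (size (H C) ẽ)
        ne′ = λ eq → ne (sym eq)
    in trans (cong ∣_∣ (Sₚ.⊆-antisym (λ {z} hz → [ (λ eq → subst (_∈ ⁅ x ⁆ ∪ ⁅ y ⁆) (sym eq) (∈-pairˡ x y)) ,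
       (λ eq → subst (_∈ ⁅ x ⁆ ∪ ⁅ y ⁆) (sym eq) (∈-pairʳ x y)) ]′ (ends ne′ hx hy hz))
         (λ {z} hz → [ (λ eq → subst (_∈ᴴ ẽ) (sym eq) hx) , (λ eq → subst (_∈ᴴ ẽ) (sym eq) hy) ]′ (∈-pair⁻ hz)))) (∣pair∣ ne′)

  nbr-blk : ∀ {c D x y ẽ} → x ≢ y → x ∈ᴴ ẽ → y ∈ᴴ ẽ → D (π y) → c (π y) ≡ y → Blk c D x ẽ
  nbr-blk {c} {D} {x} {y} {ẽ} ne hx hy d e = mkBlk hx r
    where
    r : ∀ z → z ∈ᴴ ẽ → z ≢ x → D (π z) × c (π z) ≡ z
    r z hz nz with ends ne hx hy hz
    ... | inj₁ eq = ⊥-elim (nz eq)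
    ... | inj₂ refl = d , e

  blk-nbr : ∀ {c D x ẽ} → Blk c D x ẽ → ∃ λ u → D u × c u ~ x × π (c u) ≡ u
  blk-nbr {c} {D} {x} {ẽ} b =
    let y , hy , ne = other-end (end b)
        d , e = rest b y hy (λ eq → ne (cong π eq))
    in π y , d , subst (λ z → z ~ x) (sym e) ((λ eq → ne (cong π eq)) , ẽ , hy , end b) , cong π e

  -- Prescribe x at a and leave the hole at u: the edge that blocks a colour of u over e passes
  -- through the colour of its other end, which is x.
  nbr-in : ∀ {x a u} → π x ≡ a → a ≢ u → ∀ e → a ∈ᴳ e → u ∈ᴳ e →
    ∃ λ y → ∃ λ ẽ → π y ≡ u × x ∈ᴴ ẽ × y ∈ᴴ ẽ × g ẽ ≡ e
  nbr-in {x} {a} {u} πx ne e ha hu =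
    let c , nr , ca = near-from {a} {u} x πx (λ eq → ne (sym eq))
        y , ẽ , πy , b , gẽ = near-edge nr e hu
    in y , ẽ , πy , subst (_∈ᴴ ẽ) ca (proj₂ (blk-end b (∈ᴳ-resp (sym gẽ) ha) (λ eq → ne (trans eq πy)))) , end b , gẽ

  nbr : ∀ {x a u} → π x ≡ a → A a u → ∃ λ y → π y ≡ u × x ~ y
  nbr {x} {a} {u} πx (ne , e , ha , hu) =
    let y , ẽ , πy , hx , hy , _ = nbr-in πx ne e ha hu
    in y , πy , (λ eq → ne (trans (sym πx) (trans (cong π eq) πy))) , ẽ , hx , hy

  -- With y prescribed and the hole at `π x`, both edges would block x.
  H-simple : ∀ {x y ẽ ẽ′} → x ≢ y → x ∈ᴴ ẽ → y ∈ᴴ ẽ → x ∈ᴴ ẽ′ → y ∈ᴴ ẽ′ → ẽ ≡ ẽ′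
  H-simple {x} {y} ne hx hy hx′ hy′ =
    let ne′ = λ eq → ne (fibre-unique hx hy eq)
        c , nr , cy = near-from {π y} {π x} y refl ne′
    in near-unique nr refl (nbr-blk ne hx hy (λ eq → ne′ (sym eq)) cy) (nbr-blk ne hx′ hy′ (λ eq → ne′ (sym eq)) cy)

  module HG = Graph {H C} H-graph

  mult-~ : ∀ {x y} → x ~ y → mult (H C) x y ≡ 1
  mult-~ {x} {y} (ne , ẽ , hx , hy) = ∣∣≡1⁺ {p = parallel (H C) x y} {x = ẽ} (HG.∈-parallel⁺ ne hx hy)
    (λ ẽ′ h → let hx′ , hy′ = HG.∈-parallel⁻ h in H-simple ne hx′ hy′ hx hy)

  mult-≁ : ∀ {x y} → x ≢ y → ¬ x ~ y → mult (H C) x y ≡ 0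
  mult-≁ = HG.¬adj⇒mult

  near-nbr : ∀ {c v} → Near c v → ∀ {x} → π x ≡ v → ∃ λ u → u ≢ v × c u ~ x
  near-nbr nr {x} πx = let ẽ , b = near-blk nr x πx
                           u , ne , a , _ = blk-nbr b
                       in u , ne , a

  near-nbr-unique : ∀ {c v} → Near c v → ∀ {x u u′} → π x ≡ v → u ≢ v → u′ ≢ v → c u ~ x → c u′ ~ x → u ≡ u′
  near-nbr-unique {c} nr@(sc , _) {x} {u} {u′} πx nu nu′ (ne , ẽ , hu , hx) (ne′ , ẽ′ , hu′ , hx′)
    with near-unique nr πx (nbr-blk (λ eq → ne (sym eq)) hx hu (λ e → nu (trans (sym (sc u)) e)) (cong c (sc u)))
                           (nbr-blk (λ eq → ne′ (sym eq)) hx′ hu′ (λ e → nu′ (trans (sym (sc u′)) e)) (cong c (sc u′)))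
  ... | refl with ends ne hu hx hu′
  ... | inj₁ eq = trans (sym (sc u)) (trans (cong π (sym eq)) (sc u′))
  ... | inj₂ eq = ⊥-elim (ne′ eq)

  near-ind : ∀ {c v} → Near c v → ∀ {u u′} → u ≢ v → u′ ≢ v → ¬ c u ~ c u′
  near-ind {c} {v} (sc , ind) {u} {u′} nu nu′ (ne , ẽ , hu , hu′) = misses ind ẽ hit
    where
    hit : Hit c (_≢ v) ẽ
    hit z hz with ends ne hu hu′ hz
    ... | inj₁ refl = (λ e → nu (trans (sym (sc u)) e)) , cong c (sc u)
    ... | inj₂ refl = (λ e → nu′ (trans (sym (sc u′)) e)) , cong c (sc u′)

  ind⁺ : ∀ {c D} → (∀ {u u′} → D u → D u′ → ¬ c u ~ c u′) → IndOn c D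
  ind⁺ {c} {D} na = mkInd λ ẽ hit →
    let x , y , hx , hy , ne = ∣∣≥2⁻ (size (H C) ẽ)
        dx , ex = hit x hx
        dy , ey = hit y hy
    in na dx dy (subst₂ _~_ (sym ex) (sym ey) ((λ eq → ne (sym eq)) , ẽ , hx , hy))

  Nb : VH → V → Subset (nV (H C))
  Nb x u = compr (λ y → (π y ≟ u) ×-dec (x ~? y))

  -- The edges of H at x relate neighbours over u to edges of G between a and u. One direction is
  -- injective by `matching`; the other is total by `nbr-in` and injective by `H-simple`.
  ∣Nb∣ : ∀ {x a u} → π x ≡ a → A a u → ∣ Nb x u ∣ ≡ mult (G C) a u
  ∣Nb∣ {x} {a} {u} πx Aau@(ne , _) = ℕ.≤-antisym
    (∣∣-mono-rel (Nb x u) (parallel (G C) a u) (λ y e → R e y)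
      (λ y h → let πy , ny , ẽ , hx , hy = ∈-compr⁻ Nb? h in
         g ẽ , ∈-parallel⁺ ne (subst (_∈ᴳ (g ẽ)) πx (π∈ hx)) (subst (_∈ᴳ (g ẽ)) πy (π∈ hy)) , ẽ , refl , hx , hy , πy)
      (λ y y′ e h h′ (ẽ , gẽ , hx , hy , πy) (ẽ′ , gẽ′ , hx′ , hy′ , πy′) →
         fibre-unique hy (subst (λ z → y′ ∈ᴴ z) (matching hx′ hx (trans gẽ′ (sym gẽ))) hy′)
           (trans πy (sym πy′))))
    (∣∣-mono-rel (parallel (G C) a u) (Nb x u) R
      (λ e h → let ha , hu = ∈-parallel⁻ h
                   y , ẽ , πy , hx , hy , gẽ = nbr-in πx ne e ha hu
               in y , ∈-compr⁺ Nb? (πy , (λ eq → ne (trans (sym πx)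
                  (trans (cong π eq) πy))) , ẽ , hx , hy) , ẽ , gẽ , hx , hy , πy)
      (λ e e′ y h h′ (ẽ , gẽ , hx , hy , πy) (ẽ′ , gẽ′ , hx′ , hy′ , _) →
         trans (sym gẽ) (trans (cong g (H-simple (λ eq → ne (trans (sym πx) (trans (cong π eq) πy))) hx hy hx′ hy′)) gẽ′)))
    where
    Nb? : ∀ y → Dec (π y ≡ u × x ~ y)
    Nb? y = (π y ≟ u) ×-dec (x ~? y)
    R : E → VH → Set
    R e y = ∃ λ ẽ → g ẽ ≡ e × x ∈ᴴ ẽ × y ∈ᴴ ẽ × π y ≡ u

  -- Lovász's argument for Brooks' theorem: otherwise x and y could be coloured first, saving a colour at z.
  common-nbr⇒~ : ∀ {x y z} → π x ≢ π y → ConnOff (G C) (λ w → w ≡ π x ⊎ w ≡ π y) → x ~ z → z ~ y → x ~ y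
  common-nbr⇒~ {x} {y} {z} ne off xz zy with x ~? y
  ... | yes xy = xy
  ... | no ¬xy = ⊥-elim (ne (near-nbr-unique nr {z} {π x} {π y} refl (proj₁ (~⇒A xz)) (λ e → proj₁ (~⇒A zy) (sym e))
                    (subst (_~ z) (sym ex) xz) (subst (_~ z) (sym ey) (~-sym zy))))
    where
    a = π x
    b = π y
    c₁ = upd (upd c₀ a x) b y
    c₁a : c₁ a ≡ x
    c₁a = trans (upd-other (upd c₀ a x) b y ne) (upd-same c₀ a x)
    c₁b : c₁ b ≡ y
    c₁b = upd-same (upd c₀ a x) b y
    na : ∀ {u u′} → u ≡ a ⊎ u ≡ b → u′ ≡ a ⊎ u′ ≡ b → ¬ c₁ u ~ c₁ u′
    na (inj₁ refl) (inj₁ refl) (h , _) = h refl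
    na (inj₁ refl) (inj₂ refl) h = ¬xy (subst₂ _~_ c₁a c₁b h)
    na (inj₂ refl) (inj₁ refl) h = ¬xy (~-sym (subst₂ _~_ c₁b c₁a h))
    na (inj₂ refl) (inj₂ refl) (h , _) = h refl
    z≢ : ¬ (π z ≡ a ⊎ π z ≡ b)
    z≢ (inj₁ e) = proj₁ (~⇒A xz) (sym e)
    z≢ (inj₂ e) = proj₁ (~⇒A zy) e
    ex3 : ∃ λ c′ → Near c′ (π z) × (∀ {w} → w ≡ a ⊎ w ≡ b → c′ w ≡ c₁ w)
    ex3 = greedy df (λ w → (w ≟ a) ⊎-dec (w ≟ b)) off (upd-section (upd-section sec₀ refl) refl) (ind⁺ na) z≢
    c = proj₁ ex3
    nr : Near c (π z)
    nr = proj₁ (proj₂ ex3)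
    ex : c a ≡ x
    ex = trans (proj₂ (proj₂ ex3) (inj₁ refl)) c₁a
    ey : c b ≡ y
    ey = trans (proj₂ (proj₂ ex3) (inj₂ refl)) c₁b

-- Complete graphs

third-vertex : ∀ {n} → 3 ≤ n → (a b : Fin n) → ∃ λ w → w ≢ a × w ≢ b
third-vertex {n} le a b with a ≟ b
... | yes refl = let w , ne = another (ℕ.<⇒≤ le) a in w , ne , ne
... | no ne = let w , _ , p = third {p = ⊤} (λ e → ℕ.<⇒≢ le (trans (sym e) (Sₚ.∣⊤∣≡n n))) ne Sₚ.∈⊤ Sₚ.∈⊤ in w , p

punchOut′ : ∀ {n} {i j : Fin n} → i ≢ j → Fin (n ∸ 1)
punchOut′ {suc n} = punchOut

punchOut′-cong : ∀ {n} {i j k : Fin n} (p : i ≢ j) (q : i ≢ k) → j ≡ k → punchOut′ p ≡ punchOut′ q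
punchOut′-cong {suc n} {i} p q eq = Fₚ.punchOut-cong i eq

punchOut′-injective : ∀ {n} {i j k : Fin n} (p : i ≢ j) (q : i ≢ k) → punchOut′ p ≡ punchOut′ q → j ≡ k
punchOut′-injective {suc n} = Fₚ.punchOut-injective

punchOut′-surj : ∀ {n} (i : Fin n) k → ∃ λ j → Σ (i ≢ j) λ p → punchOut′ p ≡ k
punchOut′-surj {suc n} i k = punchIn i k , (λ eq → Fₚ.punchInᵢ≢i i k (sym eq)) , Fₚ.punchOut-punchIn i

Fin1-unique : ∀ {n} → n ≡ 1 → (i j : Fin n) → i ≡ j
Fin1-unique refl zero zero = refl

module Classes {C : Config} (B : UncolorableBlock C) (gr : IsGraph (G C)) (n≥2 : 2 ≤ nV (G C))
  (part : Fin (nV (H C)) → Fin (nV (G C) ∸ 1)) (complete : ∀ {a b} → a ≢ b → Adj′ (G C) a b)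
  (member : ∀ i a → ∃ λ y → proj C y ≡ a × part y ≡ i)
  (join : ∀ {x y} → proj C x ≢ proj C y → part x ≡ part y → Adj′ (H C) x y)
  (joined : ∀ {x y} → Adj′ (H C) x y → part x ≡ part y) where

  open GraphBlock B gr

  -- Class i inside X_v is the neighbourhood of any of its members over a. The left side does not
  -- mention a, so all pairs at v have the same multiplicity.
  part-size : ∀ i {a v} → a ≢ v → partSize C part v i ≡ mult (G C) a v
  part-size i {a} {v} ne =
    let y , πy , py = member i a in trans (cong ∣_∣ (same y πy py)) (∣Nb∣ πy (complete ne))
    where
    P? : ∀ x → Dec (π x ≡ v × part x ≡ i)
    P? x = (π x ≟ v) ×-dec (part x ≟ i)
    same : ∀ y → π y ≡ a → part y ≡ i → compr P? ≡ Nb y v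
    same y πy py = Sₚ.⊆-antisym
      (λ {x} h → let πx , px = ∈-compr⁻ P? h
                 in ∈-compr⁺ Q? (πx , join (λ e → ne (trans (sym πy) (trans e πx))) (trans py (sym px))))
      (λ {x} h → let πx , xy = ∈-compr⁻ Q? h in ∈-compr⁺ P? (πx , trans (sym (joined xy)) py))
      where
      Q? : ∀ x → Dec (π x ≡ v × y ~ x)
      Q? x = (π x ≟ v) ×-dec (y ~? x)

  k-config : KConfig C
  k-config = t , adj⇒mult (complete pq) , ℕ.<⇒≤ n≥2 , (gr , mult-all) , part ,
    (λ v i → let a , na = another n≥2 v in trans (part-size i na) (mult-all a v na)) ,
    H-graph ,
    λ x y ne → (λ (πne , eq) → mult-~ (join πne eq)) , λ h → mult-≁ ne (λ xy → h (proj₁ (~⇒A xy) , joined xy))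
    where
    p = fromℕ< (ℕ.<⇒≤ n≥2)
    q = proj₁ (another n≥2 p)
    qp : q ≢ p
    qp = proj₂ (another n≥2 p)
    pq : p ≢ q
    pq e = qp (sym e)
    t = mult (G C) p q
    mult-const : ∀ {a b v} → a ≢ v → b ≢ v → mult (G C) a v ≡ mult (G C) b v
    mult-const na nb = trans (sym (part-size (part (c₀ p)) na)) (part-size (part (c₀ p)) nb)
    mult-all : ∀ a b → a ≢ b → mult (G C) a b ≡ t
    mult-all a b ab with p ≟ b
    ... | yes refl = trans (mult-const ab qp) (mult-sym (G C) q p)
    ... | no pb = trans (mult-const ab pb) (trans (mult-sym (G C) p b)
                    (trans (mult-const (λ e → pb (sym e)) qp) (mult-sym (G C) q p)))

module Complete {C : Config} (B : UncolorableBlock C) (gr : IsGraph (G C)) (big : 3 ≤ nV (G C))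
  (off₂ : ∀ a b → a ≢ b → ConnOff (G C) (λ w → w ≡ a ⊎ w ≡ b)) where

  open GraphBlock B gr

  ~-trans : ∀ {x y z} → π x ≢ π y → x ~ z → z ~ y → x ~ y
  ~-trans {x} {y} ne = common-nbr⇒~ ne (off₂ (π x) (π y) ne)

  -- A colour of b has neighbours over a and over w, and these are adjacent in H.
  A-trans : ∀ {a b w} → a ≢ w → A a b → A b w → A a w
  A-trans {a} {b} {w} ne ab bw =
    let x , πx , yx = nbr (sec₀ b) (adj-sym {G C} ab)
        z , πz , yz = nbr (sec₀ b) bw
    in subst₂ A πx πz (~⇒A (~-trans (λ e → ne (trans (sym πx) (trans e πz))) (~-sym yx) yz))

  complete : ∀ {a b} → a ≢ b → A a b
  complete {a} {b} = go (con a b)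
    where
    go : ∀ {b} → Reach (G C) a b → a ≢ b → A a b
    go here ne = ⊥-elim (ne refl)
    go (step {w} {b} e r hw hb) ne = aux (a ≟ w) (w ≟ b)
      where
      aux : Dec (a ≡ w) → Dec (w ≡ b) → A a b
      aux (yes refl) _ = ne , e , hw , hb
      aux (no aw) (yes refl) = go r aw
      aux (no aw) (no wb) = A-trans ne (go r aw) (wb , e , hw , hb)

  nbr-at : ∀ x {w} → π x ≢ w → ∃ λ y → π y ≡ w × x ~ y
  nbr-at x ne = nbr refl (complete ne)

  -- The classes of ≈ are the complete multipartite graphs H¹, …, Hⁿ⁻¹.
  infix 4 _≈_
  _≈_ : VH → VH → Set
  x ≈ y = ∃ λ z → x ~ z × z ~ y

  ≈-sym : ∀ {x y} → x ≈ y → y ≈ x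
  ≈-sym (z , p , q) = z , ~-sym q , ~-sym p

  ≈⇒~ : ∀ {x y} → π x ≢ π y → x ≈ y → x ~ y
  ≈⇒~ ne (z , p , q) = ~-trans ne p q

  ~⇒≈ : ∀ {x y} → x ~ y → x ≈ y
  ~⇒≈ {x} {y} xy =
    let w , nx , ny = third-vertex big (π x) (π y)
        z , πz , xz = nbr-at x (λ e → nx (sym e))
    in z , xz , ~-trans (λ e → ny (trans (sym πz) e)) (~-sym xz) xy

  ~-≈ : ∀ {z x y} → π z ≢ π y → z ~ x → x ≈ y → z ~ y
  ~-≈ {z} {x} {y} zy zx (q , xq , qy) = aux (π x ≟ π y) (π q ≟ π z)
    where
    aux : Dec (π x ≡ π y) → Dec (π q ≡ π z) → z ~ y
    aux (no ne) _ = ~-trans zy zx (~-trans ne xq qy)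
    aux (yes _) (no ne) = ~-trans zy (~-trans (λ e → ne (sym e)) zx xq) qy
    -- Here q cannot be used, as it lies over `π z`; a neighbour r of q over a third vertex is
    -- adjacent to both x and y and takes its place.
    aux (yes πxy) (yes πqz) =
      let p , px , pz = third-vertex big (π x) (π z)
          r , πr , qr = nbr-at q (λ e → pz (trans (sym e) πqz))
          rx = ~-trans (λ e → px (trans (sym πr) e)) (~-sym qr) (~-sym xq)
          ry = ~-trans (λ e → px (trans (sym πr) (trans e (sym πxy)))) (~-sym qr) qy
      in ~-trans zy (~-trans (λ e → pz (trans (sym πr) (sym e))) zx (~-sym rx)) ry

  ≈-trans : ∀ {x y w} → x ≈ y → y ≈ w → x ≈ w
  ≈-trans {x} {y} {w} xy yw =
    let u , ux , uw = third-vertex big (π x) (π w)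
        z , πz , xz = nbr-at x (λ e → ux (sym e))
    in aux z (λ e → ux (trans (sym πz) e)) (λ e → uw (trans (sym πz) e)) xz (π z ≟ π y)
    where
    aux : ∀ z → π z ≢ π x → π z ≢ π w → x ~ z → Dec (π z ≡ π y) → x ≈ w
    aux z zx zw xz (no zy) = z , xz , ~-≈ zw (~-≈ zy (~-sym xz) xy) yw
    aux z zx zw xz (yes zy) = y , ≈⇒~ (λ e → zx (trans zy (sym e))) xy , ≈⇒~ (λ e → zw (trans zy e)) yw

  v₀ : V
  v₀ = go big
    where
    go : ∀ {n} → 3 ≤ n → Fin n
    go (s≤s _) = zero

  c : V → VH
  c = proj₁ (near-at v₀)

  nr : Near c v₀
  nr = proj₂ (near-at v₀)

  πc : ∀ u → π (c u) ≡ u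
  πc = proj₁ nr

  -- A near-colouring with hole `v₀` represents every class once: each colour of `v₀` is blocked,
  -- hence adjacent to a chosen colour, and the chosen colours are pairwise nonadjacent. The n - 1
  -- classes are thus named by the vertices other than `v₀`.
  class : ∀ x → ∃ λ u → v₀ ≢ u × c u ≈ x
  class x with π x ≟ v₀
  ... | yes eq = let u , ne , cx = near-nbr nr eq in u , (λ e → ne (sym e)) , ~⇒≈ cx
  ... | no ne =
    let z , πz , xz = nbr-at x ne
        u , nu , cz = near-nbr nr πz
    in u , (λ e → nu (sym e)) , ≈-trans (~⇒≈ cz) (~⇒≈ (~-sym xz))

  class-unique : ∀ {u u′} → v₀ ≢ u → v₀ ≢ u′ → c u ≈ c u′ → u ≡ u′
  class-unique {u} {u′} nu nu′ h with u ≟ u′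
  ... | yes e = e
  ... | no ne = ⊥-elim (near-ind nr (λ e → nu (sym e)) (λ e → nu′ (sym e))
      (≈⇒~ (λ e → ne (trans (sym (πc u)) (trans e (πc u′)))) h))

  part : VH → Fin (nV (G C) ∸ 1)
  part x = punchOut′ (proj₁ (proj₂ (class x)))

  part⁺ : ∀ {x y} → x ≈ y → part x ≡ part y
  part⁺ {x} {y} h =
    let u , nu , cx = class x
        u′ , nu′ , cy = class y
    in punchOut′-cong nu nu′ (class-unique nu nu′ (≈-trans cx (≈-trans h (≈-sym cy))))

  part⁻ : ∀ {x y} → part x ≡ part y → x ≈ y
  part⁻ {x} {y} eq =
    let u , nu , cx = class x
        u′ , nu′ , cy = class y
    in ≈-trans (≈-sym cx) (subst (λ w → c w ≈ y) (sym (punchOut′-injective nu nu′ eq)) cy)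

  member : ∀ i a → ∃ λ y → π y ≡ a × part y ≡ i
  member i a =
    let u , nu , eq = punchOut′-surj v₀ i
        u′ , nu′ , cc = class (c u)
        pc : part (c u) ≡ i
        pc = trans (punchOut′-cong nu′ nu (class-unique nu′ nu cc)) eq
    in aux u pc (u ≟ a)
    where
    aux : ∀ u → part (c u) ≡ i → Dec (u ≡ a) → ∃ λ y → π y ≡ a × part y ≡ i
    aux u pc (yes refl) = c u , πc u , pc
    aux u pc (no ne) = let y , πy , cy = nbr-at (c u) (λ e → ne (trans (sym (πc u)) e))
                       in y , πy , trans (part⁺ (≈-sym (~⇒≈ cy))) pc

  k-config : KConfig C
  k-config = Classes.k-config B gr (ℕ.<⇒≤ big) part complete member (λ ne eq → ≈⇒~ ne (part⁻ eq)) (λ xy → part⁺ (~⇒≈ xy))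

module TwoVertices {C : Config} (B : UncolorableBlock C) (gr : IsGraph (G C)) (two : nV (G C) ≡ 2) where

  open GraphBlock B gr

  same-other : ∀ {a b v : V} → a ≢ v → b ≢ v → a ≡ b
  same-other {a} av bv = [ (λ e → ⊥-elim (av e)) , (λ e → e) ]′ (∈-pair⁻ (subst (a ∈_)
    (∣∣≡2⇒pair (trans (Sₚ.∣⊤∣≡n (nV (G C))) two) (λ e → bv (sym e)) Sₚ.∈⊤ Sₚ.∈⊤) Sₚ.∈⊤))

  all-~ : ∀ {x y} → π x ≢ π y → x ~ y
  all-~ {x} {y} ne =
    let c , nr , cy = near-from {π y} {π x} y refl ne
        u , nu , a = near-nbr nr {x} refl
    in ~-sym (subst (_~ x) (trans (cong c (same-other nu (λ e → ne (sym e)))) cy) a)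

  n≥2 : 2 ≤ nV (G C)
  n≥2 = ℕ.≤-reflexive (sym two)

  k-config : KConfig C
  k-config = Classes.k-config B gr n≥2
    -- Some element of a one-element type; `nV (G C)` is only provably equal to 2, so `zero` does
    -- not typecheck.
    (λ x → punchOut′ (λ e → proj₂ (another n≥2 (π x)) (sym e)))
    (λ {a} {b} ne → subst₂ A (sec₀ a) (sec₀ b) (~⇒A (all-~ (λ e → ne (trans (sym (sec₀ a)) (trans e (sec₀ b)))))))
    (λ i a → c₀ a , sec₀ a , Fin1-unique (cong pred two) _ _)
    (λ ne _ → all-~ ne) (λ _ → Fin1-unique (cong pred two) _ _)

-- Separating pairs

record TwoNbrs (G : Hypergraph) (a : Fin (nV G)) : Set where
  field
    nb₁ nb₂ : Fin (nV G)
    nb₁≢nb₂ : nb₁ ≢ nb₂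
    adj₁ : Adj′ G a nb₁
    adj₂ : Adj′ G a nb₂
    only : ∀ {q} → Adj′ G a q → q ≡ nb₁ ⊎ q ≡ nb₂

module Separated {C : Config} (B : UncolorableBlock C) (gr : IsGraph (G C)) where

  open GraphBlock B gr

  A-sym : ∀ {p q} → A p q → A q p
  A-sym = adj-sym {G C}

  Sep : V → V → Subset (nV (G C)) → Set
  Sep a b I = Disconnecting (G C) (λ w → w ≡ a ⊎ w ≡ b) I

  swap : ∀ {a b I} → Sep a b I → Sep b a I
  swap {a} {b} (out , ne , (q , q∉ , nq) , nc) =
    (λ p h e → out p h (flip e)) , ne , (q , q∉ , λ e → nq (flip e)) ,
    λ (e , p , q , hp , hq , p∈ , q∉ , nq) → nc (e , p , q , hp , hq , p∈ , q∉ , λ e → nq (flip e))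
    where
    flip : ∀ {w a b : V} → w ≡ a ⊎ w ≡ b → w ≡ b ⊎ w ≡ a
    flip (inj₁ e) = inj₂ e
    flip (inj₂ e) = inj₁ e

  stay : ∀ {a b I} → Sep a b I → ∀ {p q} → p ∈ I → A p q → q ≢ a → q ≢ b → q ∈ I
  stay {I = I} (_ , _ , _ , nc) {p} {q} hp (_ , e , pe , qe) na nb with q Sₚ.∈? I
  ... | yes h = h
  ... | no q∉ = ⊥-elim (nc (e , p , q , pe , qe , hp , q∉ , [ na , nb ]′))

  outside-a : ∀ {a b I} → Sep a b I → a ∉ I
  outside-a (out , _) h = out _ h (inj₁ refl)

  outside-b : ∀ {a b I} → Sep a b I → b ∉ I
  outside-b (out , _) h = out _ h (inj₂ refl)

  record Complement (a b : V) (I : Subset (nV (G C))) : Set where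
    field
      J : Subset (nV (G C))
      sep : Sep a b J
      J⇒∉I : ∀ {p} → p ∈ J → p ∉ I
      ∉I⇒J : ∀ {p} → p ∉ I → p ≢ a → p ≢ b → p ∈ J

  complement : ∀ {a b I} → Sep a b I → Complement a b I
  complement {a} {b} {I} s@(out , (z , hz) , (q , q∉ , nq) , nc) = record
    { J = compr J?
    ; sep = (λ p h → proj₂ (∈-compr⁻ J? h)) , (q , ∈-compr⁺ J? (q∉ , nq)) ,
            (z , (λ h → proj₁ (∈-compr⁻ J? h) hz) , out z hz) ,
            (λ (e , p , q , hp , hq , p∈ , q∉J , nq) → nc (e , q , p , hq , hp , in-I q∉J nq , ∈-compr⁻ J? p∈))
    ; J⇒∉I = λ h → proj₁ (∈-compr⁻ J? h)
    ; ∉I⇒J = λ p∉ na nb → ∈-compr⁺ J? (p∉ , [ na , nb ]′)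
    }
    where
    J? : ∀ p → Dec (p ∉ I × ¬ (p ≡ a ⊎ p ≡ b))
    J? p = ¬? (p Sₚ.∈? I) ×-dec ¬? ((p ≟ a) ⊎-dec (p ≟ b))
    in-I : ∀ {q} → q ∉ compr J? → ¬ (q ≡ a ⊎ q ≡ b) → q ∈ I
    in-I {q} q∉ nq with q Sₚ.∈? I
    ... | yes h = h
    ... | no h = ⊥-elim (q∉ (∈-compr⁺ J? (h , nq)))

  -- If no vertex of I were adjacent to a, then b alone would cut I off.
  attached : ∀ {a b I} → a ≢ b → Sep a b I → ∃ λ u → u ∈ I × A a u
  attached {a} {b} {I} ab s@(out , ne , _ , nc) =
    let e , p , q , hp , hq , p∈ , q∉ , nq = block b I (λ h e → out _ h (inj₂ e)) ne (a , outside-a s , ab)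
    in p , p∈ , (λ eq → outside-a s (subst (_∈ I) (sym eq) p∈)) , e ,
       subst (_∈ᴳ e) (is-a e p q hp hq p∈ q∉ nq) hq , hp
    where
    is-a : ∀ e p q → p ∈ᴳ e → q ∈ᴳ e → p ∈ I → q ∉ I → q ≢ b → q ≡ a
    is-a e p q hp hq p∈ q∉ nq with q ≟ a
    ... | yes eq = eq
    ... | no na = ⊥-elim (q∉ (stay s p∈ ((λ eq → q∉ (subst (_∈ I) eq p∈)) , e , hp , hq) na nq))

  -- Neighbours over u and over w of one colour of a would be adjacent by `common-nbr⇒~` if G stayed
  -- connected without u and w. Of the two parts that result, one without a is taken.
  nonadjacent⇒sep : ∀ {a u w} → A a u → A a w → u ≢ w → ¬ A u w → ∃ λ Z → Sep u w Z × a ∉ Z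
  nonadjacent⇒sep {a} {u} {w} au aw uw ¬uw with connOff? (G C) (λ z → (z ≟ u) ⊎-dec (z ≟ w))
  ... | inj₁ off =
    let x , πx , ax = nbr (sec₀ a) au
        y , πy , ay = nbr (sec₀ a) aw
        xy = common-nbr⇒~ (λ e → uw (trans (sym πx) (trans e πy)))
            (subst₂ (λ p q → ConnOff (G C) (λ z → z ≡ p ⊎ z ≡ q)) (sym πx) (sym πy) off) (~-sym ax) ay
    in ⊥-elim (¬uw (subst₂ A πx πy (~⇒A xy)))
  ... | inj₂ (Z , s) with a Sₚ.∈? Z
  ... | no a∉ = Z , s , a∉
  ... | yes a∈ = let open Complement (complement s) in J , sep , λ h → J⇒∉I h a∈

  -- Otherwise Z ∩ I is separated from the rest by u alone.
  no-inside : ∀ {a b I u w Z} → Sep a b I → u ∈ I → A a u → w ∉ I → w ≢ b → A a w → Sep u w Z → a ∉ Z → b ∉ Z →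
    ∀ {z} → z ∈ Z → z ∉ I
  no-inside {a} {b} {I} {u} {w} {Z} sI u∈ au w∉ wb aw sZ a∉ b∉ {z} hz hI =
    let e , p , q , hp , hq , p∈ , q∉ , nq = block u (Z ∩ I) (λ h e → proj₁ sZ _ (proj₁ (Sₚ.x∈p∩q⁻ Z I h)) (inj₁ e))
          (z , Sₚ.x∈p∩q⁺ (hz , hI)) (a , (λ h → a∉ (proj₁ (Sₚ.x∈p∩q⁻ Z I h))) , proj₁ au)
        pZ , pI = Sₚ.x∈p∩q⁻ Z I p∈
        pq : A p q
        pq = (λ eq → q∉ (subst (_∈ Z ∩ I) eq p∈)) , e , hp , hq
        qw : q ≢ w
        qw = λ eq → w∉ (stay sI pI (subst (A p) eq pq) (λ e → proj₁ aw (sym e)) wb)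
        qZ = stay sZ pZ pq nq qw
    in q∉ (Sₚ.x∈p∩q⁺ (qZ , stay sI pI pq (λ e → a∉ (subst (_∈ Z) e qZ)) (λ e → b∉ (subst (_∈ Z) e qZ))))

  -- As u and w are on different sides of a and b, they are nonadjacent. If Z missed b too,
  -- `no-inside`, used for I and for its complement, would leave no room for any vertex of Z.
  separator : ∀ {a b I u w} → Sep a b I → u ∈ I → A a u → w ∉ I → w ≢ b → A a w →
    ∃ λ Z → Sep u w Z × a ∉ Z × b ∈ Z
  separator {a} {b} {I} {u} {w} sI u∈ au w∉ wb aw =
    let Z , sZ , a∉ = nonadjacent⇒sep au aw (λ e → w∉ (subst (_∈ I) e u∈))
          (λ uw → w∉ (stay sI u∈ uw (λ e → proj₁ aw (sym e)) wb))
    in Z , sZ , a∉ , b∈ sZ a∉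
    where
    open Complement (complement sI)
    b∈ : ∀ {Z} → Sep u w Z → a ∉ Z → b ∈ Z
    b∈ {Z} sZ a∉ with b Sₚ.∈? Z
    ... | yes h = h
    ... | no b∉ =
      let z , hz = proj₁ (proj₂ sZ)
          z∉I = no-inside sI u∈ au w∉ wb aw sZ a∉ b∉ hz
      in ⊥-elim (no-inside sep (∉I⇒J w∉ (λ e → proj₁ aw (sym e)) wb) aw (λ h → J⇒∉I h u∈)
           (λ e → outside-b sI (subst (_∈ I) e u∈)) au (swap sZ) a∉ b∉ hz
           (∉I⇒J z∉I (λ e → a∉ (subst (_∈ Z) e hz)) (λ e → b∉ (subst (_∈ Z) e hz))))

  -- The set Z contains b and not a, and can be left through u and w only.
  separator-nonadjacent : ∀ {a b I u w} → Sep a b I → u ∈ I → A a u → w ∉ I → w ≢ b → A a w → ¬ A a b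
  separator-nonadjacent sI u∈ au w∉ wb aw ab =
    let Z , sZ , a∉ , b∈ = separator sI u∈ au w∉ wb aw
    in a∉ (stay sZ b∈ (A-sym ab) (proj₁ au) (proj₁ aw))

  -- With two neighbours of a in I, both separators below meet in a set that w alone cuts off.
  nbr-unique : ∀ {a b I u u′ w} → Sep a b I → u ∈ I → A a u → u′ ∈ I → A a u′ → w ∉ I → w ≢ b → A a w → u ≡ u′
  nbr-unique {a} {b} {I} {u} {u′} {w} sI u∈ au u′∈ au′ w∉ wb aw with u ≟ u′
  ... | yes eq = eq
  ... | no ne =
    let Z , sZ , a∉ , b∈ = separator sI u∈ au w∉ wb aw
        Z′ , sZ′ , a∉′ , b∈′ = separator sI u′∈ au′ w∉ wb aw
        split : ∀ {p} → p ∈ Z ∩ Z′ → p ∈ Z × p ∈ Z′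
        split = Sₚ.x∈p∩q⁻ Z Z′
        e , p , q , hp , hq , p∈ , q∉ , nq = block w (Z ∩ Z′) (λ h e → proj₁ sZ _ (proj₁ (split h)) (inj₂ e))
          (b , Sₚ.x∈p∩q⁺ (b∈ , b∈′)) (a , (λ h → a∉ (proj₁ (split h))) , proj₁ aw)
        pZ , pZ′ = split p∈
        pq : A p q
        pq = (λ eq → q∉ (subst (_∈ Z ∩ Z′) eq p∈)) , e , hp , hq
        qu : q ≢ u
        qu = λ eq → a∉′ (stay sZ′ (stay sZ′ pZ′ (subst (A p) eq pq) ne (λ e → w∉ (subst (_∈ I) e u∈))) (A-sym au) (proj₁ au′)
            (proj₁ aw))
        qu′ : q ≢ u′
        qu′ = λ eq → a∉ (stay sZ (stay sZ pZ (subst (A p) eq pq) (λ e → ne (sym e)) (λ e → w∉ (subst (_∈ I) e u′∈))) (A-sym au′)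
            (proj₁ au) (proj₁ aw))
    in ⊥-elim (q∉ (Sₚ.x∈p∩q⁺ (stay sZ pZ pq qu nq , stay sZ′ pZ′ pq qu′ nq)))

  HasSep : V → Set
  HasSep a = ∃ λ b → ∃ λ I → a ≢ b × Sep a b I

  module At {a} (hs : HasSep a) where
    private
      b = proj₁ hs
      I = proj₁ (proj₂ hs)
      ab : a ≢ b
      ab = proj₁ (proj₂ (proj₂ hs))
      s : Sep a b I
      s = proj₂ (proj₂ (proj₂ hs))
      open Complement (complement s)
      ua = attached ab s
      wa = attached ab sep
      u = proj₁ ua
      w = proj₁ wa
      u∈ = proj₁ (proj₂ ua)
      au = proj₂ (proj₂ ua)
      w∈ = proj₁ (proj₂ wa)
      aw = proj₂ (proj₂ wa)
      w∉ : w ∉ I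
      w∉ = J⇒∉I w∈
      wb : w ≢ b
      wb e = outside-b sep (subst (_∈ J) e w∈)
      ub : u ≢ b
      ub e = outside-b s (subst (_∈ I) e u∈)
      uw : u ≢ w
      uw e = w∉ (subst (_∈ I) e u∈)
      u∉J : u ∉ J
      u∉J h = J⇒∉I h u∈

    two-nbrs : TwoNbrs (G C) a
    two-nbrs = record { nb₁ = u ; nb₂ = w ; nb₁≢nb₂ = uw ; adj₁ = au ; adj₂ = aw ; only = only }
      where
      only : ∀ {q} → A a q → q ≡ u ⊎ q ≡ w
      only {q} aq with q Sₚ.∈? I
      ... | yes h = inj₁ (nbr-unique s h aq u∈ au w∉ wb aw)
      ... | no h = inj₂ (nbr-unique sep (∉I⇒J h (λ e → proj₁ aq (sym e)) qb) aq w∈ aw u∉J ub au)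
        where
        qb : q ≢ b
        qb refl = separator-nonadjacent s u∈ au w∉ wb aw aq

    open TwoNbrs two-nbrs using (only)

    -- The two neighbours of a cut it off from b. So each of them belongs to a separating pair in
    -- turn, and the property spreads over the connected G.
    sep-nbrs : Sep u w ⁅ a ⁆
    sep-nbrs = (λ p h e → [ (λ e′ → proj₁ au (trans (sym (isa h)) e′)) , (λ e′ → proj₁ aw (trans (sym (isa h)) e′)) ]′ e) ,
      (a , Sₚ.x∈⁅x⁆ a) , (b , (λ h → ab (sym (isa h))) , [ (λ e → ub (sym e)) , (λ e → wb (sym e)) ]′) ,
      λ (e , p , q , hp , hq , p∈ , q∉ , nq) → nq (only ((λ eq → q∉ (subst (_∈ ⁅ a ⁆) eq (Sₚ.x∈⁅x⁆ a))) , e , subst (_∈ᴳ e)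
          (isa p∈) hp , hq))
      where
      isa : ∀ {p} → p ∈ ⁅ a ⁆ → p ≡ a
      isa = Sₚ.x∈⁅y⁆⇒x≡y a

    spread : ∀ {q} → A a q → HasSep q
    spread aq with only aq
    ... | inj₁ refl = w , ⁅ a ⁆ , uw , sep-nbrs
    ... | inj₂ refl = u , ⁅ a ⁆ , (λ e → uw (sym e)) , swap sep-nbrs

    four : 4 ≤ nV (G C)
    four = subst (4 ≤_) (Sₚ.∣⊤∣≡n (nV (G C)))
      (ℕ.≤-trans (s≤s (ℕ.≤-trans (s≤s (ℕ.≤-trans (s≤s (∣∣≥1⁺ w₃)) (Sₚ.x∈p⇒∣p-x∣<∣p∣ u₂))) (Sₚ.x∈p⇒∣p-x∣<∣p∣ b₁))) (Sₚ.x∈p⇒∣p-x∣<∣p∣ (Sₚ.∈⊤ {x = a})))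
      where
      rm : ∀ {p : Subset (nV (G C))} {x y} → x ∈ p → x ≢ y → x ∈ p - y
      rm = Sₚ.x∈p∧x≢y⇒x∈p-y
      b₁ : b ∈ ⊤ - a
      b₁ = rm Sₚ.∈⊤ (λ e → ab (sym e))
      u₂ : u ∈ ⊤ - a - b
      u₂ = rm (rm Sₚ.∈⊤ (λ e → proj₁ au (sym e))) ub
      w₃ : w ∈ ⊤ - a - b - u
      w₃ = rm (rm (rm Sₚ.∈⊤ (λ e → proj₁ aw (sym e))) wb) (λ e → uw (sym e))

  all-sep : ∀ {a} → HasSep a → ∀ q → HasSep q
  all-sep {a} hs q = go (con a q)
    where
    go : ∀ {q} → Reach (G C) a q → HasSep q
    go here = hs
    go (step {w} {q} e r hw hq) = aux (w ≟ q)
      where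
      aux : Dec (w ≡ q) → HasSep q
      aux (yes refl) = go r
      aux (no ne) = At.spread (go r) (ne , e , hw , hq)

-- Cycles

par : ℕ → Bool
par zero = false
par (suc n) = not (par n)

module CycleColours {C : Config} (B : UncolorableBlock C) (gr : IsGraph (G C)) (two : ∀ v → TwoNbrs (G C) v) where

  open GraphBlock B gr

  record Mid (a b c : V) : Set where
    field
      ba : A b a
      bc : A b c
      a≢c : a ≢ c
      only : ∀ {q} → A b q → q ≡ a ⊎ q ≡ c

  mid-sym : ∀ {a b c} → Mid a b c → Mid c b a
  mid-sym m = record { ba = bc ; bc = ba ; a≢c = λ e → a≢c (sym e) ; only = λ h → [ inj₂ , inj₁ ]′ (only h) }
    where open Mid m

  module Middle {a b c} (m : Mid a b c) where
    open Mid m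

    private
      b≢a : b ≢ a
      b≢a = proj₁ ba
      b≢c : b ≢ c
      b≢c = proj₁ bc

    abstract
      non-nbr : ∀ {x} → π x ≡ a → ∃ λ y → π y ≡ b × ¬ x ~ y
      non-nbr {x} πx =
        let d , nr , da = near-from {a} {c} x πx (λ e → a≢c (sym e))
        in d b , proj₁ nr b , λ h → near-ind nr a≢c b≢c (subst (_~ d b) (sym da) h)

    -- Colour a by x and b by y₀ with the hole at c, then move the hole to b through z.
    abstract
      both-ends : ∀ {x y₀ z} → π x ≡ a → π y₀ ≡ b → π z ≡ c → ¬ x ~ y₀ → y₀ ~ z →
        ∃ λ d → Near d b × d a ≡ x × d c ≡ z
      both-ends {x} {y₀} {z} πx πy₀ πz ¬xy₀ y₀z = c₃ , nr₃ , c₃a , c₃c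
        where
        c₁ : V → VH
        c₁ = proj₁ (near-from {a} {c} x πx (λ e → a≢c (sym e)))
        nr₁ : Near c₁ c
        nr₁ = proj₁ (proj₂ (near-from {a} {c} x πx (λ e → a≢c (sym e))))
        c₁a : c₁ a ≡ x
        c₁a = proj₂ (proj₂ (near-from {a} {c} x πx (λ e → a≢c (sym e))))
        c₂ : V → VH
        c₂ = upd c₁ b y₀
        sec₂ : Section c₂
        sec₂ = upd-section (proj₁ nr₁) πy₀
        at-b : ∀ {u} → u ≢ c → u ≢ b → ¬ c₂ u ~ y₀
        at-b {u} uc ub h with only (subst₂ A πy₀ (sec₂ u) (~⇒A (~-sym h)))
        ... | inj₁ refl = ¬xy₀ (subst (_~ y₀) (trans (upd-other c₁ b y₀ ub) c₁a) h)
        ... | inj₂ e = uc e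
        na : ∀ {u u′} → u ≢ c → u′ ≢ c → ¬ c₂ u ~ c₂ u′
        na {u} {u′} uc uc′ h = aux (u ≟ b) (u′ ≟ b)
          where
          aux : Dec (u ≡ b) → Dec (u′ ≡ b) → ⊥₀
          aux (yes refl) (yes refl) = proj₁ h refl
          aux (yes refl) (no ne) = at-b uc′ ne (~-sym (subst (_~ c₂ u′) (upd-same c₁ b y₀) h))
          aux (no ne) (yes refl) = at-b uc ne (subst (c₂ u ~_) (upd-same c₁ b y₀) h)
          aux (no ne) (no ne′) = near-ind nr₁ uc uc′ (subst₂ _~_ (upd-other c₁ b y₀ ne) (upd-other c₁ b y₀ ne′) h)
        nr₂ : Near c₂ c
        nr₂ = sec₂ , ind⁺ na
        blk₂ : Blk c₂ (_≢ c) z (proj₁ (proj₂ y₀z))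
        blk₂ = nbr-blk (λ e → proj₁ y₀z (sym e)) (proj₂ (proj₂ (proj₂ y₀z))) (proj₁ (proj₂ (proj₂ y₀z)))
                 (λ e → b≢c (trans (sym πy₀) e)) (trans (cong c₂ πy₀) (upd-same c₁ b y₀))
        c₃ : V → VH
        c₃ = upd c₂ c z
        nr₃ : Near c₃ b
        nr₃ = shift nr₂ πz blk₂ (subst (_∈ᴳ _) πy₀ (π∈ (proj₁ (proj₂ (proj₂ y₀z))))) b≢c
        c₃a : c₃ a ≡ x
        c₃a = trans (upd-other c₂ c z a≢c) (trans (upd-other c₁ b y₀ (λ e → b≢a (sym e))) c₁a)
        c₃c : c₃ c ≡ z
        c₃c = upd-same c₂ c z

    -- In the near-colouring of `both-ends` the colour y of the hole b is blocked exactly once, and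
    -- only x and z, the colours of the two neighbours of b, can do it.
    exactly-one : ∀ {x y₀ z} → π x ≡ a → π y₀ ≡ b → π z ≡ c → ¬ x ~ y₀ → y₀ ~ z →
      ∀ {y} → π y ≡ b → (y ~ x → ¬ y ~ z) × (¬ y ~ x → y ~ z)
    exactly-one {x} {y₀} {z} πx πy₀ πz ¬xy₀ y₀z {y} πy =
      let d , nr , da , dc = both-ends πx πy₀ πz ¬xy₀ y₀z
          u , ub , uy = near-nbr nr {y} πy
      in (λ yx yz → a≢c (near-nbr-unique nr πy (λ e → b≢a (sym e)) (λ e → b≢c (sym e))
                      (subst (_~ y) (sym da) (~-sym yx)) (subst (_~ y) (sym dc) (~-sym yz)))) ,
         λ ¬yx → [ (λ e → ⊥-elim (¬yx (~-sym (subst (_~ y) (trans (cong d e) da) uy)))) ,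
                   (λ e → ~-sym (subst (_~ y) (trans (cong d e) dc) uy)) ]′
                 (only (subst₂ A πy (proj₁ nr u) (~⇒A (~-sym uy))))

  adjB : VH → VH → Bool
  adjB x y = does (x ~? y)

  adjB-sym : ∀ x y → adjB x y ≡ adjB y x
  adjB-sym x y = does-⇔ (mk⇔ ~-sym ~-sym) (x ~? y) (y ~? x)

  -- As subsets of X_b, f and h are equal if s is `false` and complementary if s is `true`.
  Linear : V → (VH → Bool) → (VH → Bool) → Set
  Linear b f h = ∃ λ s → ∀ y → π y ≡ b → f y ≡ s xor h y

  xor-shift : ∀ s a b → a ≡ s xor b → b ≡ s xor a
  xor-shift false a b e = sym e
  xor-shift true a false refl = refl
  xor-shift true a true refl = refl

  linear-sym : ∀ {b f h} → Linear b f h → Linear b h f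
  linear-sym {b} {f} {h} (s , l) = s , λ y πy → xor-shift s (f y) (h y) (l y πy)

  linear-trans : ∀ {b f h k} → Linear b f h → Linear b h k → Linear b f k
  linear-trans {k = k} (s , l) (s′ , l′) = s xor s′ , λ y πy → trans (l y πy)
      (trans (cong (s xor_) (l′ y πy)) (sym (Bₚ.xor-assoc s s′ (k y))))

  complementary : ∀ {b x z} → (∀ {y} → π y ≡ b → (y ~ x → ¬ y ~ z) × (¬ y ~ x → y ~ z)) → Linear b (adjB x) (adjB z)
  complementary {b} {x} {z} ex = true , λ y πy → aux y (x ~? y) (z ~? y) (proj₁ (ex πy)) (proj₂ (ex πy))
    where
    aux : ∀ y (d : Dec (x ~ y)) (e : Dec (z ~ y)) → (y ~ x → ¬ y ~ z) → (¬ y ~ x → y ~ z) → does d ≡ true xor does e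
    aux y (yes p) (yes q) f h = ⊥-elim (f (~-sym p) (~-sym q))
    aux y (yes p) (no q) f h = refl
    aux y (no p) (yes q) f h = refl
    aux y (no p) (no q) f h = ⊥-elim (q (~-sym (h (λ k → p (~-sym k)))))

  -- A colour of b adjacent to just one of x and z meets the premises of `exactly-one`, which makes
  -- the neighbourhoods complementary; if there is none, they are equal.
  across : ∀ {a b c} → Mid a b c → ∀ {x z} → π x ≡ a → π z ≡ c → Linear b (adjB x) (adjB z)
  across {a} {b} {c} m {x} {z} πx πz with Fₚ.any? (λ y → (π y ≟ b) ×-dec (¬? (x ~? y) ×-dec (y ~? z)))
  ... | yes (y₀ , πy₀ , nx , yz) = complementary (Middle.exactly-one m πx πy₀ πz nx yz)
  ... | no ¬p with Fₚ.any? (λ y → (π y ≟ b) ×-dec (¬? (z ~? y) ×-dec (y ~? x)))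
  ... | yes (y₀ , πy₀ , nz , yx) = linear-sym (complementary (Middle.exactly-one (mid-sym m) πz πy₀ πx nz yx))
  ... | no ¬q = false , λ y πy → does-⇔ (mk⇔ (to y πy) (from y πy)) (x ~? y) (z ~? y)
    where
    to : ∀ y → π y ≡ b → x ~ y → z ~ y
    to y πy h with z ~? y
    ... | yes k = k
    ... | no k = ⊥-elim (¬q (y , πy , k , ~-sym h))
    from : ∀ y → π y ≡ b → z ~ y → x ~ y
    from y πy h with x ~? y
    ... | yes k = k
    ... | no k = ⊥-elim (¬p (y , πy , k , ~-sym h))

  mid : ∀ v → Mid (TwoNbrs.nb₁ (two v)) v (TwoNbrs.nb₂ (two v))
  mid v = record { ba = adj₁ ; bc = adj₂ ; a≢c = nb₁≢nb₂ ; only = only }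
    where open TwoNbrs (two v)

  ref : V → VH
  ref v = c₀ (TwoNbrs.nb₁ (two v))

  -- All neighbourhoods in X_v are equal or complementary, so that of one reference vertex divides X_v into its two classes.
  bit : VH → Bool
  bit y = adjB (ref (π y)) y

  to-bit : ∀ v {f} → Linear v f (adjB (ref v)) → Linear v f bit
  to-bit v (s , l) = s , λ y πy → trans (l y πy) (cong (λ w → s xor adjB (ref w) y) (sym πy))

  -- `across` compares colours on opposite sides of v only; two on the same side are compared
  -- through a colour on the other side.
  bit-linear : ∀ {u v x} → A v u → π x ≡ u → Linear v (adjB x) bit
  bit-linear {u} {v} {x} vu πx with Mid.only (mid v) vu
  ... | inj₁ refl = to-bit v (linear-trans (across (mid v) πx (sec₀ _)) (linear-sym (across (mid v) (sec₀ _) (sec₀ _))))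
  ... | inj₂ refl = to-bit v (linear-sym (across (mid v) (sec₀ _) πx))

  xor-solve : ∀ a b d e f → a xor d ≡ e xor f → a xor b ≡ (e xor d) xor (f xor b)
  xor-solve false b false false false _ = refl
  xor-solve false b false true true _ = lem b
    where
    lem : ∀ b → b ≡ true xor (true xor b)
    lem false = refl
    lem true = refl
  xor-solve false b true false true _ = xor-solve false b false true true refl
  xor-solve false b true true false _ = refl
  xor-solve true b true false false _ = refl
  xor-solve true b true true true _ = refl
  xor-solve true b false true false _ = refl
  xor-solve true b false false true _ = refl

  -- For fixed x, adjacency is a constant plus `bit y`; for the fixed colour `y₀` it is a constant
  -- plus `bit x`. Comparing both at the pair of x and `y₀` shows how the first constant depends on
  -- x.
  sign : ∀ {u v} → A u v → ∃ λ s → ∀ x y → π x ≡ u → π y ≡ v → adjB x y ≡ s xor (bit x xor bit y)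
  sign {u} {v} uv = e xor bit y₀ , λ x y πx πy →
      let a , la = bit-linear (adj-sym {G C} uv) πx
      in trans (la y πy) (xor-solve a (bit y) (bit y₀) e (bit x)
           (trans (sym (la y₀ (sec₀ v))) (trans (adjB-sym x y₀) (proj₂ hx x πx))))
    where
    y₀ = c₀ v
    hx : Linear u (adjB y₀) bit
    hx = bit-linear uv (sec₀ v)
    e = proj₁ hx

  both-bits : ∀ v i → ∃ λ y → π y ≡ v × bit y ≡ i
  both-bits v true = let y , πy , h = nbr (sec₀ _) (adj-sym {G C} (Mid.ba (mid v)))
                     in y , πy , dec-true (ref (π y) ~? y) (subst (λ w → ref w ~ y) (sym πy) h)
  both-bits v false = let y , πy , h = Middle.non-nbr (mid v) (sec₀ _)
                      in y , πy , dec-false (ref (π y) ~? y) (λ k → h (subst (λ w → ref w ~ y) πy k))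

  -- the value of bit x for which x is joined exactly to the y with bit i
  partner : Bool → Bool → Bool
  partner s i = s xor not i

  partner-⇔ : ∀ s i b → (s xor (partner s i xor b) ≡ true → b ≡ i) × (b ≡ i → s xor (partner s i xor b) ≡ true)
  partner-⇔ false false false = (λ _ → refl) , λ _ → refl
  partner-⇔ false false true = (λ ()) , λ ()
  partner-⇔ false true false = (λ ()) , λ ()
  partner-⇔ false true true = (λ _ → refl) , λ _ → refl
  partner-⇔ true false false = (λ _ → refl) , λ _ → refl
  partner-⇔ true false true = (λ ()) , λ ()
  partner-⇔ true true false = (λ ()) , λ ()
  partner-⇔ true true true = (λ _ → refl) , λ _ → refl

  -- Each bit class of X_v is the neighbourhood of a colour of u, namely of one with bit
  -- `partner s i`.
  bit-size : ∀ v i {u} → A u v → ∣ compr (λ y → (π y ≟ v) ×-dec (bit y B.≟ i)) ∣ ≡ mult (G C) u v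
  bit-size v i {u} uv =
    let s , l = sign uv
        x , πx , bx = both-bits u (partner s i)
        eq : ∀ y → π y ≡ v → adjB x y ≡ s xor (partner s i xor bit y)
        eq y πy = trans (l x y πx πy) (cong (λ t → s xor (t xor bit y)) bx)
    in trans (cong ∣_∣ (Sₚ.⊆-antisym
         (λ {y} h → let πy , b = ∈-compr⁻ P? h in ∈-compr⁺ (Q? x)
            (πy , does⁻ (x ~? y) (trans (eq y πy) (proj₂ (partner-⇔ s i (bit y)) b))))
         (λ {y} h → let πy , a = ∈-compr⁻ (Q? x) h in ∈-compr⁺ P?
            (πy , proj₁ (partner-⇔ s i (bit y)) (trans (sym (eq y πy)) (dec-true (x ~? y) a))))))
         (∣Nb∣ πx uv)
    where
    P? : ∀ y → Dec (π y ≡ v × bit y ≡ i)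
    P? y = (π y ≟ v) ×-dec (bit y B.≟ i)
    Q? : ∀ x y → Dec (π y ≡ v × x ~ y)
    Q? x y = (π y ≟ v) ×-dec (x ~? y)

  -- `bit-size` counts the same class from either neighbour of v, so the multiplicity does not
  -- change along a walk.
  mult-const : ∀ {p q} → A p q → ∀ {a b} → A a b → mult (G C) a b ≡ mult (G C) p q
  mult-const {p} {q} pq {a} {b} ab = go (con q b) ab
    where
    t = mult (G C) p q
    same : ∀ {u w v} → A u v → A w v → mult (G C) u v ≡ mult (G C) w v
    same {v = v} uv wv = trans (sym (bit-size v false uv)) (bit-size v false wv)
    go : ∀ {b} → Reach (G C) q b → ∀ {a} → A a b → mult (G C) a b ≡ t
    go here ab = same ab pq
    go (step {w} {b} e r hw hb) {a} ab = aux (w ≟ b)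
      where
      aux : Dec (w ≡ b) → mult (G C) a b ≡ t
      aux (yes refl) = go r ab
      aux (no ne) = let wb = ne , e , hw , hb
                    in trans (same ab wb) (trans (mult-sym (G C) w b) (go r (adj-sym {G C} wb)))

-- The cyclic order of a connected graph with two neighbours everywhere

module CycleOrder {G : Hypergraph} (con : Connected G) (two : ∀ v → TwoNbrs G v) (v₀ : Fin (nV G)) where

  private
    n = nV G
    V = Fin n
    A : V → V → Set
    A = Adj′ G
    A-sym : ∀ {p q} → A p q → A q p
    A-sym = adj-sym {G}

  next : V → V → V
  next prev cur with TwoNbrs.nb₁ (two cur) ≟ prev
  ... | yes _ = TwoNbrs.nb₂ (two cur)
  ... | no _ = TwoNbrs.nb₁ (two cur)

  next-adj : ∀ prev cur → A cur (next prev cur)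
  next-adj prev cur with TwoNbrs.nb₁ (two cur) ≟ prev
  ... | yes _ = TwoNbrs.adj₂ (two cur)
  ... | no _ = TwoNbrs.adj₁ (two cur)

  next-≢ : ∀ prev cur → next prev cur ≢ prev
  next-≢ prev cur with TwoNbrs.nb₁ (two cur) ≟ prev
  ... | yes refl = λ e → TwoNbrs.nb₁≢nb₂ (two cur) (sym e)
  ... | no ne = ne

  two-only : ∀ {v p q r} → A v p → A v q → p ≢ q → A v r → r ≡ p ⊎ r ≡ q
  two-only {v} vp vq ne vr with TwoNbrs.only (two v) vp | TwoNbrs.only (two v) vq | TwoNbrs.only (two v) vr
  ... | inj₁ refl | inj₁ refl | _ = ⊥-elim (ne refl)
  ... | inj₂ refl | inj₂ refl | _ = ⊥-elim (ne refl)
  ... | inj₁ refl | inj₂ refl | r = r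
  ... | inj₂ refl | inj₁ refl | inj₁ e = inj₂ e
  ... | inj₂ refl | inj₁ refl | inj₂ e = inj₁ e

  -- The walk that never turns back. It is defined on all of ℕ and is at its start again after n
  -- steps.
  s : ℕ → V
  s 0 = v₀
  s 1 = TwoNbrs.nb₁ (two v₀)
  s (suc (suc i)) = next (s i) (s (suc i))

  s-adj : ∀ i → A (s i) (s (suc i))
  s-adj 0 = TwoNbrs.adj₁ (two v₀)
  s-adj (suc i) = next-adj (s i) (s (suc i))

  s-≢ : ∀ i → s (suc (suc i)) ≢ s i
  s-≢ i = next-≢ (s i) (s (suc i))

  s-nbrs : ∀ i {q} → A (s (suc i)) q → q ≡ s i ⊎ q ≡ s (suc (suc i))
  s-nbrs i = two-only (A-sym (s-adj i)) (s-adj (suc i)) (λ e → s-≢ i (sym e))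

  Inj : ℕ → Set
  Inj k = ∀ {i j} → i < k → j < k → s i ≡ s j → i ≡ j

  -- For i > 0 both neighbours of s i already lie on the walk, next to it.
  return : ∀ k → Inj k → ∀ i → i < k → s k ≡ s i → i ≡ 0
  return k inj zero _ _ = refl
  return (suc k) inj (suc i) (s≤s i<k) eq = ⊥-elim (aux (s-nbrs i (A-sym (subst (A (s k)) eq (s-adj k)))))
    where
    aux : s k ≡ s i ⊎ s k ≡ s (suc (suc i)) → ⊥₀
    aux (inj₁ e) = ℕ.<⇒≢ i<k (sym (inj ℕ.≤-refl (ℕ.m<n⇒m<1+n i<k) e))
    aux (inj₂ e) with ℕ.m≤n⇒m<n∨m≡n i<k
    ... | inj₂ refl = proj₁ (s-adj (suc i)) (sym eq)
    ... | inj₁ lt with inj ℕ.≤-refl (s≤s lt) e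
    ... | refl = s-≢ (suc i) eq

  CycNat : ℕ → ℕ → ℕ → Set
  CycNat k i j = (j ≡ suc i ⊎ (suc i ≡ k × j ≡ 0)) ⊎ (i ≡ suc j ⊎ (suc j ≡ k × i ≡ 0))

  -- A segment that closes up contains all neighbours of its vertices; for `s 0` the second
  -- neighbour is the last vertex of the segment. Closing up with k = 1 would be a loop, with k = 2
  -- a turn back.
  closed : ∀ k → Inj k → s k ≡ s 0 → ∀ i → i < k → ∀ {q} → A (s i) q → ∃ λ j → j < k × s j ≡ q × CycNat k i j
  closed k inj eq (suc i) i<k {q} aq with s-nbrs i aq
  ... | inj₁ refl = i , ℕ.<-trans ℕ.≤-refl i<k , refl , inj₂ (inj₁ refl)
  ... | inj₂ refl with ℕ.m≤n⇒m<n∨m≡n i<k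
  ... | inj₁ lt = suc (suc i) , lt , refl , inj₁ (inj₁ refl)
  ... | inj₂ refl = 0 , s≤s z≤n , sym eq , inj₁ (inj₂ (refl , refl))
  closed 1 inj eq zero _ aq = ⊥-elim (proj₁ (s-adj 0) (sym eq))
  closed 2 inj eq zero _ aq = ⊥-elim (s-≢ 0 eq)
  closed (suc (suc (suc k))) inj eq zero _ {q} aq
    with two-only (s-adj 0) (A-sym (subst (A (s (suc (suc k)))) eq (s-adj (suc (suc k)))))
           (λ e → 1≢ (inj (s≤s (s≤s z≤n)) ℕ.≤-refl e)) aq
    where
    1≢ : 1 ≢ suc (suc k)
    1≢ ()
  ... | inj₁ refl = 1 , s≤s (s≤s z≤n) , refl , inj₁ (inj₁ refl)
  ... | inj₂ refl = suc (suc k) , ℕ.≤-refl , refl , inj₂ (inj₂ (refl , refl))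

  covers : ∀ k → Inj k → 0 < k → s k ≡ s 0 → ∀ q → ∃ λ j → j < k × s j ≡ q
  covers k inj pos eq q = go (con v₀ q)
    where
    go : ∀ {q} → Reach G v₀ q → ∃ λ j → j < k × s j ≡ q
    go here = 0 , pos , refl
    go (step {w} {q} e r hw hq) = aux (w ≟ q)
      where
      aux : Dec (w ≡ q) → ∃ λ j → j < k × s j ≡ q
      aux (yes refl) = go r
      aux (no ne) = let i , lt , si = go r
                        j , lt′ , sj , _ = closed k inj eq i lt (subst (λ z → A z q) (sym si) (ne , e , hw , hq))
                    in j , lt′ , sj

  covers⇒≤ : ∀ k → (∀ q → ∃ λ j → j < k × s j ≡ q) → n ≤ k
  covers⇒≤ k cov = Fₚ.injective⇒≤ {f = λ q → fromℕ< (proj₁ (proj₂ (cov q)))}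
    (λ {p} {q} eq → trans (sym (proj₂ (proj₂ (cov p)))) (trans (cong s (Fₚ.fromℕ<-injective _ _ _ _ eq)) (proj₂ (proj₂ (cov q)))))

  -- By `return` the walk would come back to `s 0`; the closed segment of k vertices would then, by
  -- connectedness, be all of G.
  no-return : ∀ k → Inj k → k < n → ∀ {j} → j < k → s k ≢ s j
  no-return k inj k<n {j} j<k e =
    ℕ.<⇒≱ k<n (covers⇒≤ k (covers k inj (ℕ.≤-<-trans z≤n j<k) (trans e (cong s (return k inj j j<k e)))))

  inj-all : ∀ k → k ≤ n → Inj k
  inj-all (suc k) le {i} {j} (s≤s i≤) (s≤s j≤) e with ℕ.m≤n⇒m<n∨m≡n i≤ | ℕ.m≤n⇒m<n∨m≡n j≤
  ... | inj₂ refl | inj₂ refl = refl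
  ... | inj₁ i< | inj₁ j< = inj-all k (ℕ.<⇒≤ le) i< j< e
  ... | inj₂ refl | inj₁ j< = ⊥-elim (no-return k (inj-all k (ℕ.<⇒≤ le)) le j< e)
  ... | inj₁ i< | inj₂ refl = ⊥-elim (no-return k (inj-all k (ℕ.<⇒≤ le)) le i< (sym e))

  inj : Inj n
  inj = inj-all n ℕ.≤-refl

  abstract
    pos : ∀ v → ∃ λ i → i < n × s i ≡ v
    pos v = let i , _ , e = rel-surjective ⊤ ⊤ (λ (i : Fin n) v → s (toℕ i) ≡ v) (λ i _ → s (toℕ i) , Sₚ.∈⊤ , refl)
                  (λ i j v _ _ e e′ → Fₚ.toℕ-injective (inj {toℕ i} {toℕ j} (Fₚ.toℕ<n i) (Fₚ.toℕ<n j)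
                     (trans e (sym e′)))) ℕ.≤-refl v Sₚ.∈⊤
            in toℕ i , Fₚ.toℕ<n i , e

  -- The first n vertices are all vertices, so `s n` is one of them, and `return` leaves only the
  -- first.
  wrap : s n ≡ s 0
  wrap = let i , lt , e = pos (s n) in trans (sym e) (cong s (return n inj i lt (sym e)))

  φ : Fin n ↔ V
  φ = mk↔ₛ′ (λ i → s (toℕ i)) (λ v → fromℕ< (proj₁ (proj₂ (pos v))))
        (λ v → trans (cong s (Fₚ.toℕ-fromℕ< (proj₁ (proj₂ (pos v))))) (proj₂ (proj₂ (pos v))))
        (λ i → Fₚ.toℕ-injective (trans (Fₚ.toℕ-fromℕ< (proj₁ (proj₂ (pos (s (toℕ i))))))
           (inj {proj₁ (pos (s (toℕ i)))} {toℕ i} (proj₁ (proj₂ (pos (s (toℕ i))))) (Fₚ.toℕ<n i)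
              (proj₂ (proj₂ (pos (s (toℕ i))))))))

  adj⇒cyc : ∀ {i j} → i < n → j < n → A (s i) (s j) → CycNat n i j
  adj⇒cyc {i} {j} li lj a =
    let j′ , lj′ , e , c = closed n inj wrap i li a in subst (CycNat n i) (inj {j′} {j} lj′ lj e) c

  cyc⇒adj : ∀ {i j} → CycNat n i j → A (s i) (s j)
  cyc⇒adj {i} (inj₁ (inj₁ refl)) = s-adj i
  cyc⇒adj {i} (inj₁ (inj₂ (e , refl))) = subst (A (s i)) (trans (cong s e) wrap) (s-adj i)
  cyc⇒adj {j = j} (inj₂ (inj₁ refl)) = A-sym (s-adj j)
  cyc⇒adj {j = j} (inj₂ (inj₂ (e , refl))) = A-sym (subst (A (s j)) (trans (cong s e) wrap) (s-adj j))

-- The cyclic order is cut at position 0; tw records whether the closing pair is crossed.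
record CycleForm (C : Config) : Set where
  n : ℕ
  n = nV (G C)
  π : Fin (nV (H C)) → Fin n
  π = proj C
  field
    p : Fin n → ℕ
    p<n : ∀ v → p v < n
    p-inj : ∀ {u v} → p u ≡ p v → u ≡ v
    at : ∀ {i} → i < n → ∃ λ v → p v ≡ i
    n≥4 : 4 ≤ n
    part : Fin (nV (H C)) → Bool
    tw : Bool
    member : ∀ v b → ∃ λ x → π x ≡ v × part x ≡ b
    H-graph : IsGraph (H C)
    separate : ∀ {x y} → Adj′ (H C) x y → π x ≢ π y
    simple : ∀ {x y ẽ ẽ′} → x ≢ y → x ∈ inc (H C) ẽ → y ∈ inc (H C) ẽ → x ∈ inc (H C) ẽ′ → y ∈ inc (H C) ẽ′ → ẽ ≡ ẽ′

  Next : Fin n → Fin n → Set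
  Next u v = p v ≡ suc (p u) ⊎ (suc (p u) ≡ n × p v ≡ 0)

  field
    cyc : ∀ {x y} → Adj′ (H C) x y → Next (π x) (π y) ⊎ Next (π y) (π x)
    straight⁺ : ∀ {x y} → p (π y) ≡ suc (p (π x)) → part x ≡ part y → Adj′ (H C) x y
    straight⁻ : ∀ {x y} → p (π y) ≡ suc (p (π x)) → Adj′ (H C) x y → part x ≡ part y
    last⁺ : ∀ {x y} → suc (p (π x)) ≡ n → p (π y) ≡ 0 → part x xor part y ≡ tw → Adj′ (H C) x y
    last⁻ : ∀ {x y} → suc (p (π x)) ≡ n → p (π y) ≡ 0 → Adj′ (H C) x y → part x xor part y ≡ tw

xor-cancelʳ : ∀ a b → (a xor b) xor b ≡ a
xor-cancelʳ false false = refl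
xor-cancelʳ false true = refl
xor-cancelʳ true false = refl
xor-cancelʳ true true = refl

module Form {C : Config} (F : CycleForm C) where
  open CycleForm F

  private
    ~sym : ∀ {x y} → Adj′ (H C) x y → Adj′ (H C) y x
    ~sym = adj-sym {H C}

  module Labelled (ℓ : ℕ → Bool) (c : Fin n → Fin (nV (H C))) (sec : ∀ v → π (c v) ≡ v) (lab : ∀ v → part (c v) ≡ ℓ (p v)) where

    conflict : ∀ {ẽ} → Mono (H C) π c ẽ → ∃ λ x → ∃ λ y → x ≢ y × x ∈ inc (H C) ẽ × y ∈ inc (H C) ẽ × c (π x) ≡ x × c (π y) ≡ y ×
      ((p (π y) ≡ suc (p (π x)) × ℓ (p (π x)) ≡ ℓ (suc (p (π x)))) ⊎
       (suc (p (π x)) ≡ n × p (π y) ≡ 0 × ℓ (p (π x)) xor ℓ 0 ≡ tw))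
    conflict {ẽ} m =
      let x , y , hx , hy , ne = ∣∣≥2⁻ (size (H C) ẽ)
          xy : Adj′ (H C) x y
          xy = (λ e → ne (sym e)) , ẽ , hx , hy
      in [ (λ nx → x , y , proj₁ xy , hx , hy , m x hx , m y hy , kind (m x hx) (m y hy) xy nx) ,
           (λ nx → y , x , ne , hy , hx , m y hy , m x hx , kind (m y hy) (m x hx) (~sym xy) nx) ]′ (cyc xy)
      where
      lab′ : ∀ {x} → c (π x) ≡ x → part x ≡ ℓ (p (π x))
      lab′ {x} e = trans (cong part (sym e)) (lab (π x))
      kind : ∀ {x y} → c (π x) ≡ x → c (π y) ≡ y → Adj′ (H C) x y → Next (π x) (π y) →
        (p (π y) ≡ suc (p (π x)) × ℓ (p (π x)) ≡ ℓ (suc (p (π x)))) ⊎ (suc (p (π x)) ≡ n × p (π y) ≡ 0 × ℓ (p (π x)) xor ℓ 0 ≡ tw)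
      kind ex ey xy (inj₁ e) = inj₁ (e , trans (sym (lab′ ex)) (trans (straight⁻ e xy) (trans (lab′ ey) (cong ℓ e))))
      kind ex ey xy (inj₂ (e , z)) = inj₂ (e , z , trans (cong₂ _xor_ (sym (lab′ ex)) (trans (cong ℓ (sym z)) (sym (lab′ ey))))
          (last⁻ e z xy))

  -- Alternating labels conflict at the closing pair at most, and there only if `tw` is the parity
  -- of n - 1.
  uncolourable⇒tw : Uncolourable C → tw ≡ par (pred n)
  uncolourable⇒tw unc with tw B.≟ par (pred n)
  ... | yes e = e
  ... | no ne = ⊥-elim (unc (λ v → proj₁ (member v (par (p v)))) (λ v → proj₁ (proj₂ (member v (par (p v))))) hit)
    where
    open Labelled par (λ v → proj₁ (member v (par (p v)))) (λ v → proj₁ (proj₂ (member v (par (p v)))))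
        (λ v → proj₂ (proj₂ (member v (par (p v)))))
    hit : ∀ ẽ → ¬ Mono (H C) π (λ v → proj₁ (member v (par (p v)))) ẽ
    hit ẽ m with conflict m
    ... | _ , _ , _ , _ , _ , _ , _ , inj₁ (_ , e) = Bₚ.not-¬ refl e
    ... | x , _ , _ , _ , _ , _ , _ , inj₂ (e , _ , t) = ne (trans (sym t)
        (trans (Bₚ.xor-identityʳ _) (cong (λ k → par (pred k)) e)))

  module _ (tight : tw ≡ par (pred n)) where

    -- Without a conflict the classes must alternate from position 0 to n - 1; the two ends then
    -- differ by the parity of n - 1, which is `tw`, and so are joined.
    uncolourable : Uncolourable C
    uncolourable c sec free =
      non z̄ z (last⁺ (trans (cong (λ w → suc (p w)) (sec z̄)) (trans (cong suc pz̄) suc-pred)) (trans (cong p (sec z)) pz)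
        (trans (cong (_xor part (c z)) (alternate (pred n) z̄ pz̄))
           (trans (xor-cancelʳ (par (pred n)) (part (c z))) (sym tight))))
      where
      pos : 0 < n
      pos = ℕ.≤-trans (s≤s z≤n) n≥4
      suc-pred : suc (pred n) ≡ n
      suc-pred = ℕ.suc-pred n ⦃ >-nonZero pos ⦄
      z z̄ : Fin n
      z = proj₁ (at pos)
      z̄ = proj₁ (at {pred n} (ℕ.≤-reflexive suc-pred))
      pz : p z ≡ 0
      pz = proj₂ (at pos)
      pz̄ : p z̄ ≡ pred n
      pz̄ = proj₂ (at {pred n} (ℕ.≤-reflexive suc-pred))
      non : ∀ u w → ¬ Adj′ (H C) (c u) (c w)
      non = section-independent {C} H-graph sec free
      alternate : ∀ i u → p u ≡ i → part (c u) ≡ par i xor part (c z)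
      alternate zero u e = cong (λ w → part (c w)) (p-inj (trans e (sym pz)))
      alternate (suc i) u e =
        let w , pw = at {i} (ℕ.<-trans ℕ.≤-refl (subst (_< n) e (p<n u)))
            ne : part (c w) ≢ part (c u)
            ne = λ eq → non w u (straight⁺ (trans (cong p (sec u))
                (trans e (cong suc (trans (sym pw) (cong p (sym (sec w))))))) eq)
        in trans (Bₚ.¬-not (λ e → ne (sym e))) (trans (cong not (alternate i w pw)) (Bₚ.not-distribˡ-xor (par i) (part (c z))))

    private
      Conf : (ℕ → Bool) → ℕ → ℕ → Set
      Conf ℓ i j = (j ≡ suc i × ℓ i ≡ ℓ (suc i)) ⊎ (suc i ≡ n × j ≡ 0 × ℓ i xor ℓ 0 ≡ tw)

      -- The colours x and y are placed over their vertices, and every other vertex takes some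
      -- colour with its label. The labels conflict at this pair only, and there x and y span no
      -- edge but ẽ.
      through : ∀ {x y ẽ} → x ≢ y → x ∈ inc (H C) ẽ → y ∈ inc (H C) ẽ → (ℓ : ℕ → Bool) → ℓ (p (π x)) ≡ part x → ℓ
          (p (π y)) ≡ part y →
        (∀ {i j} → i < n → j < n → Conf ℓ i j → i ≡ p (π x) × j ≡ p (π y)) → ColourableWithout C ẽ
      through {x} {y} {ẽ} ne hx hy ℓ lx ly only = c , sec , free
        where
        d : Fin n → Fin (nV (H C))
        d w = proj₁ (member w (ℓ (p w)))
        c₁ = upd d (π y) y
        c = upd c₁ (π x) x
        sec : ∀ v → π (c v) ≡ v
        sec v with v ≟ π x
        ... | yes e = sym e
        ... | no _ with v ≟ π y
        ... | yes e = sym e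
        ... | no _ = proj₁ (proj₂ (member v (ℓ (p v))))
        lab : ∀ v → part (c v) ≡ ℓ (p v)
        lab v with v ≟ π x
        ... | yes refl = sym lx
        ... | no _ with v ≟ π y
        ... | yes refl = sym ly
        ... | no _ = proj₂ (proj₂ (member v (ℓ (p v))))
        πne : π y ≢ π x
        πne e = separate {x} {y} (ne , ẽ , hx , hy) (sym e)
        cx : c (π x) ≡ x
        cx = upd-same c₁ (π x) x
        cy : c (π y) ≡ y
        cy = trans (upd-other c₁ (π x) x πne) (upd-same d (π y) y)
        free : ∀ ẽ′ → ẽ′ ≢ ẽ → ¬ Mono (H C) π c ẽ′
        free ẽ′ nẽ m =
          let x′ , y′ , ne′ , hx′ , hy′ , ex , ey , k = Labelled.conflict ℓ c sec lab m
              i , j = only (p<n (π x′)) (p<n (π y′)) k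
              x′≡ : x′ ≡ x
              x′≡ = trans (sym ex) (trans (cong c (p-inj i)) cx)
              y′≡ : y′ ≡ y
              y′≡ = trans (sym ey) (trans (cong c (p-inj j)) cy)
          in nẽ (simple ne (subst (_∈ inc (H C) ẽ′) x′≡ hx′) (subst (_∈ inc (H C) ẽ′) y′≡ hy′) hx hy)

      -- Flipping the alternating labels up to position i moves their single conflict to the pair i, i+1.
      module Shifted (i : ℕ) (si<n : suc i < n) (b : Bool) where
        le : ℕ → Bool
        le k = does (k ℕ.≤? i)
        ℓ : ℕ → Bool
        ℓ k = (par k xor le k) xor b

        le-yes : ∀ {k} → k ≤ i → le k ≡ true
        le-yes {k} h = dec-true (k ℕ.≤? i) h
        le-no : ∀ {k} → i < k → le k ≡ false
        le-no {k} h = dec-false (k ℕ.≤? i) (ℕ.<⇒≱ h)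

        at-i : ℓ i ≡ ℓ (suc i)
        at-i = cong (_xor b) (trans (cong (par i xor_) (le-yes ℕ.≤-refl))
            (trans (lem (par i)) (sym (trans (cong (not (par i) xor_) (le-no ℕ.≤-refl)) (Bₚ.xor-identityʳ _)))))
          where
          lem : ∀ a → a xor true ≡ not a
          lem false = refl
          lem true = refl

        step-ne : ∀ {k} → k ≢ i → ℓ k ≢ ℓ (suc k)
        step-ne {k} ne eq = Bₚ.not-¬ refl (trans eq (trans (cong (λ t → (not (par k) xor t) xor b) same)
          (trans (cong (_xor b) (sym (Bₚ.not-distribˡ-xor (par k) (le k)))) (sym (Bₚ.not-distribˡ-xor (par k xor le k) b)))))
          where
          same : le (suc k) ≡ le k
          same with ℕ.<-cmp k i
          ... | tri< lt _ _ = trans (le-yes lt) (sym (le-yes (ℕ.<⇒≤ lt)))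
          ... | tri≈ _ e _ = ⊥-elim (ne e)
          ... | tri> _ _ gt = trans (le-no (ℕ.m<n⇒m<1+n gt)) (sym (le-no gt))

        last-ne : ∀ {k} → suc k ≡ n → ℓ k xor ℓ 0 ≢ tw
        last-ne {k} e eq = bad (par k) b (trans (cong₂ (λ s t → ((par k xor s) xor b) xor ((false xor t) xor b))
            (sym (le-no i<k)) (sym (le-yes z≤n)))
                                 (trans eq (trans tight (cong (λ m → par (pred m)) (sym e)))))
          where
          i<k : i < k
          i<k = ℕ.≤-pred (subst (suc i <_) (sym e) si<n)
          bad : ∀ a b → ((a xor false) xor b) xor (true xor b) ≢ a
          bad false false ()
          bad false true ()
          bad true false ()
          bad true true ()

        only : ∀ {k j} → Conf ℓ k j → k ≡ i × j ≡ suc i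
        only {k} (inj₁ (e , eq)) with k ℕ.≟ i
        ... | yes refl = refl , e
        ... | no ne = ⊥-elim (step-ne ne eq)
        only (inj₂ (e , _ , eq)) = ⊥-elim (last-ne e eq)

      del-next : ∀ {x y ẽ} → x ≢ y → x ∈ inc (H C) ẽ → y ∈ inc (H C) ẽ → Next (π x) (π y) → ColourableWithout C ẽ
      del-next {x} {y} {ẽ} ne hx hy (inj₁ e) = through ne hx hy ℓ ℓx
          (trans (cong ℓ e) (trans (sym at-i) (trans ℓx (straight⁻ e (ne , ẽ , hx , hy)))))
          (λ _ _ k → let a , b = only k in a , trans b (sym e))
        where
        i = p (π x)
        -- Solved from the requirement that `ℓ i` be `part x`.
        b₀ = part x xor (par i xor true)
        open Shifted i (subst (_< n) e (p<n (π y))) b₀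
        ℓx : ℓ i ≡ part x
        ℓx = trans (cong (λ t → (par i xor t) xor b₀) (le-yes ℕ.≤-refl)) (lem (par i xor true) (part x))
          where
          lem : ∀ a b → a xor (b xor a) ≡ b
          lem false false = refl
          lem false true = refl
          lem true false = refl
          lem true true = refl
      del-next {x} {y} {ẽ} ne hx hy (inj₂ (e , z)) = through ne hx hy ℓ
          (trans (cong (_xor part y) (trans (cong (λ m → par (pred m)) e) (sym tight)))
            (trans (cong (_xor part y) (sym (last⁻ e z (ne , ẽ , hx , hy)))) (xor-cancelʳ (part x) (part y))))
          (cong ℓ z) only
        where
        ℓ : ℕ → Bool
        ℓ k = par k xor part y
        only : ∀ {i j} → i < n → j < n → Conf ℓ i j → i ≡ p (π x) × j ≡ p (π y)
        only {i} _ _ (inj₁ (_ , eq)) = ⊥-elim (Bₚ.not-¬ refl (trans eq (sym (Bₚ.not-distribˡ-xor (par i) (part y)))))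
        only _ _ (inj₂ (e′ , z′ , _)) = ℕ.suc-injective (trans e′ (sym e)) , trans z′ (sym z)

    deletion : ∀ ẽ → ColourableWithout C ẽ
    deletion ẽ =
      let x , y , hx , hy , ne = ∣∣≥2⁻ (size (H C) ẽ)
          ne′ = λ e → ne (sym e)
      in [ del-next ne′ hx hy , del-next ne hy hx ]′ (cyc (ne′ , ẽ , hx , hy))

    form-minUnc : MinUnc C
    form-minUnc = uncolourable , deletion

  -- Deleting such an edge yields an independent set that omits v only.
  edge-at : ∀ v → ∃ λ ẽ → ∃ λ x → x ∈ inc (H C) ẽ × π x ≡ v
  edge-at v with ℕ.m≤n⇒m<n∨m≡n (p<n v)
  ... | inj₁ lt =
    let w , pw = at lt
        x , πx , _ = member v false
        y , πy , _ = member w (part x)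
        _ , ẽ , hx , _ = straight⁺ {x} {y} (trans (cong p πy) (trans pw (cong (λ z → suc (p z)) (sym πx))))
            (sym (proj₂ (proj₂ (member w (part x)))))
    in ẽ , x , hx , πx
  ... | inj₂ eq =
    let w , pw = at (ℕ.≤-trans (s≤s z≤n) n≥4)
        x , πx , _ = member v false
        y , πy , py = member w (part x xor tw)
        _ , ẽ , hx , _ = last⁺ {x} {y} (trans (cong (λ z → suc (p z)) πx) eq) (trans (cong p πy) pw)
            (trans (cong (part x xor_) py) (lem (part x) tw))
    in ẽ , x , hx , πx
    where
    lem : ∀ a b → a xor (a xor b) ≡ b
    lem false b = refl
    lem true false = refl
    lem true true = refl

-- Bits, parities and the links of C-configurations

≡⇒xor : ∀ {a b} → a ≡ b → a xor b ≡ false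
≡⇒xor {a} refl = Bₚ.xor-same a

xor⇒≡ : ∀ {a b} → a xor b ≡ false → a ≡ b
xor⇒≡ {false} {false} _ = refl
xor⇒≡ {true} {true} _ = refl

≢⇒xor : ∀ {a b} → a ≢ b → a xor b ≡ true
≢⇒xor {false} {false} h = ⊥-elim (h refl)
≢⇒xor {false} {true} h = refl
≢⇒xor {true} {false} h = refl
≢⇒xor {true} {true} h = ⊥-elim (h refl)

xor⇒≢ : ∀ {a b} → a xor b ≡ true → a ≢ b
xor⇒≢ {a} h refl = true≢false (trans (sym h) (Bₚ.xor-same a))

toF : Bool → Fin 2
toF false = zero
toF true = suc zero

fromF : Fin 2 → Bool
fromF zero = false
fromF (suc zero) = true

fromF-toF : ∀ b → fromF (toF b) ≡ b
fromF-toF false = refl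
fromF-toF true = refl

toF-fromF : ∀ i → toF (fromF i) ≡ i
toF-fromF zero = refl
toF-fromF (suc zero) = refl

par-odd : ∀ n → par n ≡ true → n % 2 ≡ 1
par-odd 1 _ = refl
par-odd (suc (suc n)) h = par-odd n (trans (sym (Bₚ.not-involutive (par n))) h)

par-even : ∀ n → par n ≡ false → n % 2 ≡ 0
par-even 0 _ = refl
par-even (suc (suc n)) h = par-even n (trans (sym (Bₚ.not-involutive (par n))) h)

odd-par : ∀ n → n % 2 ≡ 1 → par n ≡ true
odd-par n h with par n in e
... | true = refl
... | false with trans (sym h) (par-even n e)
... | ()

even-par : ∀ n → n % 2 ≡ 0 → par n ≡ false
even-par n h with par n in e
... | false = refl
... | true with trans (sym h) (par-odd n e)
... | ()

par-pred : ∀ {n} → 1 ≤ n → par n ≡ not (par (pred n))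
par-pred (s≤s _) = refl

EvenLink : (C : Config) (part : Fin (nV (H C)) → Fin 2) (w w′ : Fin (nV (G C))) → Fin (nV (H C)) → Fin (nV (H C)) → Set
EvenLink C part w w′ x y = Adj (G C) (proj C x) (proj C y) ×
  (((proj C x ≡ w × proj C y ≡ w′) ⊎ (proj C x ≡ w′ × proj C y ≡ w)) → part x ≢ part y) ×
  (¬ ((proj C x ≡ w × proj C y ≡ w′) ⊎ (proj C x ≡ w′ × proj C y ≡ w)) → part x ≡ part y)

Adj-sym : ∀ {G u v} → Adj G u v → Adj G v u
Adj-sym {G} {u} {v} (ne , le) = (λ e → ne (sym e)) , subst (1 ≤_) (mult-sym G u v) le

evenLink-sym : ∀ {C part w w′ x y} → EvenLink C part w w′ x y → EvenLink C part w w′ y x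
evenLink-sym {C} {x = x} {y} (a , f , h) = Adj-sym {G C} a , (λ k e → f (fl k) (sym e)) , λ k → sym (h (λ l → k (fl l)))
  where
  fl : ∀ {P Q R S : Set} → (P × Q) ⊎ (R × S) → (S × R) ⊎ (Q × P)
  fl = [ (λ (p , q) → inj₂ (q , p)) , (λ (r , s) → inj₁ (s , r)) ]′

evenLink-swap : ∀ {C part w w′ x y} → EvenLink C part w w′ x y → EvenLink C part w′ w x y
evenLink-swap (a , f , h) = a , (λ k → f (Sum.swap k)) , λ k → h (λ l → k (Sum.swap l))

xor-straight : ∀ σ f x y → (x xor f) xor (y xor (f xor (true xor σ))) ≡ true xor (σ xor (x xor y))
xor-straight = solve 4 (λ σ f x y → (x :+ f) :+ (y :+ (f :+ (con true :+ σ))) := con true :+ (σ :+ (x :+ y))) refl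
  where open xor-∧-Solver

xor-last : ∀ σ f x y → (x xor f) xor (y xor false) ≡ (f xor (true xor σ)) xor (true xor (σ xor (x xor y)))
xor-last = solve 4 (λ σ f x y → (x :+ f) :+ (y :+ con false) := (f :+ (con true :+ σ)) :+ (con true :+ (σ :+ (x :+ y)))) refl
  where open xor-∧-Solver

module CycleConfig {C : Config} (B : UncolorableBlock C) (gr : IsGraph (G C)) (two : ∀ v → TwoNbrs (G C) v)
    (n≥4 : 4 ≤ nV (G C)) where

  open GraphBlock B gr
  open CycleColours B gr two

  v₀ : V
  v₀ = fromℕ< (ℕ.≤-trans (s≤s z≤n) n≥4)

  open CycleOrder {G C} con two v₀

  private
    n = nV (G C)

  p : V → ℕ
  p v = proj₁ (pos v)

  s-p : ∀ v → s (p v) ≡ v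
  s-p v = proj₂ (proj₂ (pos v))

  p-s : ∀ {i} → i < n → p (s i) ≡ i
  p-s {i} lt = inj (proj₁ (proj₂ (pos (s i)))) lt (s-p (s i))

  σ : ℕ → Bool
  σ i = proj₁ (sign (s-adj i))

  adj-σ : ∀ i {x y} → π x ≡ s i → π y ≡ s (suc i) → adjB x y ≡ σ i xor (bit x xor bit y)
  adj-σ i πx πy = proj₂ (sign (s-adj i)) _ _ πx πy

  -- The signs are summed along the path from position 0, so that colours over consecutive vertices
  -- are adjacent exactly when their values of `part` agree. What cannot be absorbed at the closing
  -- pair is `tw`.
  flips : ℕ → Bool
  flips zero = false
  flips (suc i) = flips i xor (true xor σ i)

  part : VH → Bool
  part x = bit x xor flips (p (π x))

  tw : Bool
  tw = flips (pred n) xor (true xor σ (pred n))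

  straight-part : ∀ {x y} → p (π y) ≡ suc (p (π x)) → part x xor part y ≡ true xor adjB x y
  straight-part {x} {y} e = trans (cong (λ k → part x xor (bit y xor flips k)) e)
    (trans (xor-straight (σ (p (π x))) (flips (p (π x))) (bit x) (bit y))
      (cong (true xor_) (sym (adj-σ (p (π x)) (sym (s-p (π x))) (trans (sym (s-p (π y))) (cong s e))))))

  last-part : ∀ {x y} → suc (p (π x)) ≡ n → p (π y) ≡ 0 → part x xor part y ≡ tw xor (true xor adjB x y)
  last-part {x} {y} e z =
    trans (cong₂ (λ i k → (bit x xor flips i) xor (bit y xor flips k)) pn z)
      (trans (xor-last (σ (pred n)) (flips (pred n)) (bit x) (bit y))
        (cong (λ a → tw xor (true xor a)) (sym (trans (adj-σ (p (π x)) (sym (s-p (π x)))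
           (trans (sym (s-p (π y))) (trans (cong s z) (trans (sym wrap) (cong s (sym e))))))
          (cong (λ i → σ i xor (bit x xor bit y)) pn)))))
    where
    pn : p (π x) ≡ pred n
    pn = cong pred e

  not-true : ∀ {a} → true xor a ≡ false → a ≡ true
  not-true {true} _ = refl

  cancel : ∀ a b → a xor b ≡ a → b ≡ false
  cancel false b h = h
  cancel true false h = refl

  form : CycleForm C
  form = record
    { p = p
    ; p<n = λ v → proj₁ (proj₂ (pos v))
    ; p-inj = λ {u} {v} e → trans (sym (s-p u)) (trans (cong s e) (s-p v))
    ; at = λ {i} lt → s i , p-s lt
    ; n≥4 = n≥4
    ; part = part
    ; tw = tw
    ; member = λ v b → let y , πy , by = both-bits v (b xor flips (p v))
                       in y , πy , trans (cong₂ (λ c w → c xor flips (p w)) by πy) (xor-cancelʳ b (flips (p v)))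
    ; H-graph = H-graph
    ; separate = λ h → proj₁ (~⇒A h)
    ; simple = H-simple
    ; cyc = λ {x} {y} h → adj⇒cyc (proj₁ (proj₂ (pos (π x)))) (proj₁ (proj₂ (pos (π y))))
        (subst₂ A (sym (s-p (π x))) (sym (s-p (π y))) (~⇒A h))
    ; straight⁺ = λ {x} {y} e eq → does⁻ (x ~? y) (not-true (trans (sym (straight-part e)) (≡⇒xor eq)))
    ; straight⁻ = λ {x} {y} e h → xor⇒≡ (trans (straight-part e) (cong (true xor_) (dec-true (x ~? y) h)))
    ; last⁺ = λ {x} {y} e z eq → does⁻ (x ~? y) (not-true (cancel tw _ (trans (sym (last-part e z)) eq)))
    ; last⁻ = λ {x} {y} e z h → trans (last-part e z) (trans (cong (λ a → tw xor (true xor a)) (dec-true (x ~? y) h))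
        (Bₚ.xor-identityʳ tw))
    }

  open CycleForm form using (Next; cyc; straight⁺; straight⁻; last⁺; last⁻; p-inj; p<n)

  A⇒next : ∀ {u v} → A u v → Next u v ⊎ Next v u
  A⇒next {u} {v} h = adj⇒cyc (p<n u) (p<n v) (subst₂ A (sym (s-p u)) (sym (s-p v)) h)

  t : ℕ
  t = mult (G C) (s 0) (s 1)

  is-tc : IsTC t (G C)
  is-tc = gr , φ , λ i j ne → (λ c → mult-const (s-adj 0) (cyc⇒adj c)) ,
    λ nc → ¬adj⇒mult (λ e → ne (Fₚ.toℕ-injective (inj (Fₚ.toℕ<n i) (Fₚ.toℕ<n j) e)))
        (λ a → nc (adj⇒cyc (Fₚ.toℕ<n i) (Fₚ.toℕ<n j) a))

  part₂ : VH → Fin 2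
  part₂ x = toF (part x)

  sizes : ∀ v i → partSize C part₂ v i ≡ t
  sizes v i = trans (cong ∣_∣ (Sₚ.⊆-antisym
      (λ {x} h → let πx , e = ∈-compr⁻ P? h in ∈-compr⁺ Q? (πx , to x πx e))
      (λ {x} h → let πx , e = ∈-compr⁻ Q? h in ∈-compr⁺ P? (πx , from x πx e))))
    (trans (bit-size v (fromF i xor flips (p v)) (adj-sym {G C} (TwoNbrs.adj₁ (two v))))
       (mult-const (s-adj 0) (adj-sym {G C} (TwoNbrs.adj₁ (two v)))))
    where
    P? : ∀ x → Dec (π x ≡ v × part₂ x ≡ i)
    P? x = (π x ≟ v) ×-dec (part₂ x ≟ i)
    Q? : ∀ x → Dec (π x ≡ v × bit x ≡ fromF i xor flips (p v))
    Q? x = (π x ≟ v) ×-dec (bit x B.≟ (fromF i xor flips (p v)))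
    to : ∀ x → π x ≡ v → part₂ x ≡ i → bit x ≡ fromF i xor flips (p v)
    to x πx e = trans (sym (xor-cancelʳ (bit x) (flips (p v)))) (cong (_xor flips (p v))
      (trans (cong (λ w → bit x xor flips (p w)) (sym πx)) (trans (sym (fromF-toF (part x))) (cong fromF e))))
    from : ∀ x → π x ≡ v → bit x ≡ fromF i xor flips (p v) → part₂ x ≡ i
    from x πx e = trans (cong toF (trans (cong₂ (λ b w → b xor flips (p w)) e πx) (xor-cancelʳ (fromF i) (flips (p v)))))
        (toF-fromF i)

  A⇒Adj : ∀ {u v} → A u v → Adj (G C) u v
  A⇒Adj h = proj₁ h , adj⇒mult h

  Adj⇒A : ∀ {u v} → Adj (G C) u v → A u v
  Adj⇒A (ne , le) = mult⇒adj ne le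

  part₂⁻ : ∀ {x y} → part₂ x ≡ part₂ y → part x ≡ part y
  part₂⁻ {x} {y} e = trans (sym (fromF-toF (part x))) (trans (cong fromF e) (fromF-toF (part y)))

  two-part : ∀ {Link} → (∀ {x y} → x ~ y → Link x y) → (∀ {x y} → Link x y → x ~ y) → TwoPartH C t part₂ Link
  two-part f h = sizes , H-graph , λ x y ne → (λ l → mult-~ (h l)) , λ nl → mult-≁ ne (λ xy → nl (f xy))

  n≥1 : 1 ≤ n
  n≥1 = ℕ.≤-trans (s≤s z≤n) n≥4

  odd-link⁺ : tw ≡ false → ∀ {x y} → x ~ y → Adj (G C) (π x) (π y) × part₂ x ≡ part₂ y
  odd-link⁺ tw≡ {x} {y} h = A⇒Adj (~⇒A h) , cong toF ([ go h , (λ nx → sym (go (~-sym h) nx)) ]′ (cyc h))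
    where
    go : ∀ {x y} → x ~ y → Next (π x) (π y) → part x ≡ part y
    go h (inj₁ e) = straight⁻ e h
    go h (inj₂ (e , z)) = xor⇒≡ (trans (last⁻ e z h) tw≡)

  odd-link⁻ : tw ≡ false → ∀ {x y} → Adj (G C) (π x) (π y) × part₂ x ≡ part₂ y → x ~ y
  odd-link⁻ tw≡ {x} {y} (a , e₂) = [ go (part₂⁻ e₂) , (λ nx → ~-sym (go (sym (part₂⁻ e₂)) nx)) ]′ (A⇒next (Adj⇒A a))
    where
    go : ∀ {x y} → part x ≡ part y → Next (π x) (π y) → x ~ y
    go eq (inj₁ e) = straight⁺ e eq
    go eq (inj₂ (e , z)) = last⁺ e z (trans (≡⇒xor eq) (sym tw≡))

  -- All consecutive pairs are straight by the choice of `part`, so the crossed pair is the closing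
  -- one.
  w w′ : V
  w = s (pred n)
  w′ = s 0

  suc-pred : suc (pred n) ≡ n
  suc-pred = ℕ.suc-pred n ⦃ >-nonZero n≥1 ⦄

  pw : p w ≡ pred n
  pw = p-s (ℕ.≤-reflexive suc-pred)

  pw′ : p w′ ≡ 0
  pw′ = p-s n≥1

  not-pair : ∀ {x y} → p (π y) ≡ suc (p (π x)) → ¬ ((π x ≡ w × π y ≡ w′) ⊎ (π x ≡ w′ × π y ≡ w))
  not-pair e (inj₁ (_ , πy)) with trans (sym e) (trans (cong p πy) pw′)
  ... | ()
  not-pair e (inj₂ (πx , πy)) = ℕ.<⇒≢ (ℕ.≤-trans (s≤s (s≤s (s≤s z≤n))) n≥4)
    (trans (cong suc (trans (cong suc (trans (sym pw′) (cong p (sym πx)))) (trans (sym e) (trans (cong p πy) pw)))) suc-pred)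

  even-link⁺ : tw ≡ true → ∀ {x y} → x ~ y → EvenLink C part₂ w w′ x y
  even-link⁺ tw≡ {x} {y} h = [ go h , (λ nx → evenLink-sym {C} (go (~-sym h) nx)) ]′ (cyc h)
    where
    go : ∀ {x y} → x ~ y → Next (π x) (π y) → EvenLink C part₂ w w′ x y
    go {x} {y} h (inj₁ e) = A⇒Adj (~⇒A h) , (λ pr → ⊥-elim (not-pair {x} {y} e pr)) , λ _ → cong toF (straight⁻ e h)
    go h (inj₂ (e , z)) = A⇒Adj (~⇒A h) , (λ _ eq → xor⇒≢ (trans (last⁻ e z h) tw≡) (part₂⁻ eq)) ,
      λ np → ⊥-elim (np (inj₁ (p-inj (trans (cong pred e) (sym pw)) , p-inj (trans z (sym pw′)))))

  even-link⁻ : tw ≡ true → ∀ {x y} → EvenLink C part₂ w w′ x y → x ~ y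
  even-link⁻ tw≡ {x} {y} l = [ go l , (λ nx → ~-sym (go (evenLink-sym {C} l) nx)) ]′ (A⇒next (Adj⇒A (proj₁ l)))
    where
    go : ∀ {x y} → EvenLink C part₂ w w′ x y → Next (π x) (π y) → x ~ y
    go {x} {y} (_ , _ , f) (inj₁ e) = straight⁺ e (part₂⁻ (f (not-pair {x} {y} e)))
    go (_ , f , _) (inj₂ (e , z)) = last⁺ e z (trans (≢⇒xor (λ eq → f
        (inj₁ (p-inj (trans (cong pred e) (sym pw)) , p-inj (trans z (sym pw′)))) (cong toF eq))) (sym tw≡))

  c-config : CConfig C
  c-config = by-parity (par (pred n)) refl
    where
    tw≡ : tw ≡ par (pred n)
    tw≡ = Form.uncolourable⇒tw form unc
    t≥1 : 1 ≤ t
    t≥1 = adj⇒mult (s-adj 0)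
    by-parity : ∀ b → par (pred n) ≡ b → CConfig C
    by-parity false e = inj₁ (t , t≥1 , n≥5 , par-odd n par-n , is-tc , part₂ , two-part (odd-link⁺ (trans tw≡ e))
        (odd-link⁻ (trans tw≡ e)))
      where
      par-n : par n ≡ true
      par-n = trans (par-pred n≥1) (cong not e)
      n≥5 : 5 ≤ n
      n≥5 with ℕ.m≤n⇒m<n∨m≡n n≥4
      ... | inj₁ lt = lt
      ... | inj₂ eq with trans (cong par eq) par-n
      ... | ()
    by-parity true e = inj₂ (t , t≥1 , n≥4 , par-even n (trans (par-pred n≥1) (cong not e)) , is-tc , part₂ , w , w′ ,
      A⇒Adj (adj-sym {G C} (cyc⇒adj {0} {pred n} (inj₂ (inj₂ (suc-pred , refl))))) ,
      two-part (even-link⁺ (trans tw≡ e)) (even-link⁻ (trans tw≡ e)))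

-- Cycle forms of C-configurations

Adj-dec : ∀ G u v → Dec (Adj G u v)
Adj-dec G u v = ¬? (u ≟ v) ×-dec (1 ℕ.≤? mult G u v)

evenLink-dec : ∀ C part w w′ x y → Dec (EvenLink C part w w′ x y)
evenLink-dec C part w w′ x y = Adj-dec (G C) (proj C x) (proj C y) ×-dec
    ((pair? →-dec ¬? (part x ≟ part y)) ×-dec (¬? pair? →-dec (part x ≟ part y)))
  where
  pair? : Dec ((proj C x ≡ w × proj C y ≡ w′) ⊎ (proj C x ≡ w′ × proj C y ≡ w))
  pair? = ((proj C x ≟ w) ×-dec (proj C y ≟ w′)) ⊎-dec ((proj C x ≟ w′) ×-dec (proj C y ≟ w))

succ-dec : ∀ n (i j : Fin n) → Dec (Succ n i j)
succ-dec n i j = (toℕ j ℕ.≟ suc (toℕ i)) ⊎-dec ((suc (toℕ i) ℕ.≟ n) ×-dec (toℕ j ℕ.≟ 0))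

module FromCycle {C : Config} {t : ℕ} (t≥1 : 1 ≤ t) (n≥4 : 4 ≤ nV (G C)) (tc : IsTC t (G C)) (part₂ : Fin (nV (H C)) → Fin 2)
  {Link : Fin (nV (H C)) → Fin (nV (H C)) → Set} (link? : ∀ x y → Dec (Link x y))
  (link-Adj : ∀ {x y} → Link x y → Adj (G C) (proj C x) (proj C y)) (tp : TwoPartH C t part₂ Link) where

  private
    n = nV (G C)
    V = Fin n
    VH = Fin (nV (H C))
    π : VH → V
    π = proj C

  φ : V ↔ V
  φ = proj₁ (proj₂ tc)

  H-graph : IsGraph (H C)
  H-graph = proj₁ (proj₂ tp)

  module HG = Graph {H C} H-graph

  p : V → ℕ
  p v = toℕ (Inverse.from φ v)

  Next : V → V → Set
  Next u v = p v ≡ suc (p u) ⊎ (suc (p u) ≡ n × p v ≡ 0)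

  to-from : ∀ v → Inverse.to φ (Inverse.from φ v) ≡ v
  to-from v = Inverse.strictlyInverseˡ φ v

  p-inj : ∀ {u v} → p u ≡ p v → u ≡ v
  p-inj {u} {v} e = trans (sym (to-from u)) (trans (cong (Inverse.to φ) (Fₚ.toℕ-injective e)) (to-from v))

  Adj⇒next : ∀ {u v} → Adj (G C) u v → Next u v ⊎ Next v u
  Adj⇒next {u} {v} (ne , le) with succ-dec n (Inverse.from φ u) (Inverse.from φ v) ⊎-dec succ-dec n (Inverse.from φ v)
      (Inverse.from φ u)
  ... | yes c = c
  ... | no nc = ⊥-elim (ℕ.<⇒≢ le (sym (subst₂ (λ a b → mult (G C) a b ≡ 0) (to-from u) (to-from v)
          (proj₂ (proj₂ (proj₂ tc) (Inverse.from φ u) (Inverse.from φ v) (λ e → ne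
             (trans (sym (to-from u)) (trans (cong (Inverse.to φ) e) (to-from v))))) nc))))

  next-≢ : ∀ {u v} → Next u v → u ≢ v
  next-≢ (inj₁ e) refl = ℕ.<⇒≢ ℕ.≤-refl e
  next-≢ (inj₂ (e , z)) refl = ℕ.<⇒≢ (ℕ.≤-trans (s≤s (s≤s z≤n)) n≥4) (trans (cong suc (sym z)) e)

  next⇒Adj : ∀ {u v} → Next u v → Adj (G C) u v
  next⇒Adj {u} {v} nx = next-≢ nx , subst (1 ≤_) (sym (subst₂ (λ a b → mult (G C) a b ≡ t) (to-from u) (to-from v)
    (proj₁ (proj₂ (proj₂ tc) (Inverse.from φ u) (Inverse.from φ v) (λ e → next-≢ nx
       (trans (sym (to-from u)) (trans (cong (Inverse.to φ) e) (to-from v))))) (inj₁ nx)))) t≥1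

  link⇒~ : ∀ {x y} → π x ≢ π y → Link x y → Adj′ (H C) x y
  link⇒~ {x} {y} ne l = HG.mult⇒adj (λ e → ne (cong π e)) (ℕ.≤-reflexive
      (sym (proj₁ (proj₂ (proj₂ tp) x y (λ e → ne (cong π e))) l)))

  ~⇒link : ∀ {x y} → Adj′ (H C) x y → Link x y
  ~⇒link {x} {y} h with link? x y
  ... | yes l = l
  ... | no nl = ⊥-elim (ℕ.<⇒≢ (HG.adj⇒mult h) (sym (proj₂ (proj₂ (proj₂ tp) x y (proj₁ h)) nl)))

  part : VH → Bool
  part x = fromF (part₂ x)

  part⁻ : ∀ {x y} → part x ≡ part y → part₂ x ≡ part₂ y
  part⁻ {x} {y} e = trans (sym (toF-fromF (part₂ x))) (trans (cong toF e) (toF-fromF (part₂ y)))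

  member : ∀ v b → ∃ λ x → π x ≡ v × part x ≡ b
  member v b =
    let x , h = ∣∣≥1⁻ (compr P?) (subst (1 ≤_) (sym (proj₁ tp v (toF b))) t≥1)
        πx , e = ∈-compr⁻ P? h
    in x , πx , trans (cong fromF e) (fromF-toF b)
    where
    P? : ∀ x → Dec (π x ≡ v × part₂ x ≡ toF b)
    P? x = (π x ≟ v) ×-dec (part₂ x ≟ toF b)

  -- The colour classes may be flipped up to position m to straighten a crossed pair.
  form-with : (flip : ℕ → Bool) (tw : Bool) →
    (∀ {x y} → p (π y) ≡ suc (p (π x)) → (part x xor flip (p (π x)) ≡ part y xor flip (suc (p (π x))) → Link x y) ×
                                         (Link x y → part x xor flip (p (π x)) ≡ part y xor flip (suc (p (π x))))) →
    (∀ {x y} → suc (p (π x)) ≡ n → p (π y) ≡ 0 → ((part x xor flip (p (π x))) xor (part y xor flip 0) ≡ tw → Link x y) ×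
                                         (Link x y → (part x xor flip (p (π x))) xor (part y xor flip 0) ≡ tw)) →
    CycleForm C
  form-with flip tw st ls = record
    { p = p
    ; p<n = λ v → Fₚ.toℕ<n (Inverse.from φ v)
    ; p-inj = p-inj
    ; at = λ {i} lt → Inverse.to φ (fromℕ< lt) , trans (cong toℕ (Inverse.strictlyInverseʳ φ (fromℕ< lt))) (Fₚ.toℕ-fromℕ< lt)
    ; n≥4 = n≥4
    ; part = part′
    ; tw = tw
    ; member = λ v b → let x , πx , e = member v (b xor flip (p v))
                       in x , πx , trans (cong₂ (λ c w → c xor flip (p w)) e πx) (xor-cancelʳ b (flip (p v)))
    ; H-graph = H-graph
    ; separate = λ h → proj₁ (link-Adj (~⇒link h))
    ; simple = simple
    ; cyc = λ h → Adj⇒next (link-Adj (~⇒link h))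
    ; straight⁺ = λ {x} {y} e eq → link⇒~ (next-≢ (inj₁ e)) (proj₁ (st e) (trans eq (cong (λ k → part y xor flip k) e)))
    ; straight⁻ = λ {x} {y} e h → trans (proj₂ (st e) (~⇒link h)) (cong (λ k → part y xor flip k) (sym e))
    ; last⁺ = λ {x} {y} e z eq → link⇒~ (next-≢ (inj₂ (e , z)))
        (proj₁ (ls e z) (trans (cong (λ k → part′ x xor (part y xor flip k)) (sym z)) eq))
    ; last⁻ = λ {x} {y} e z h → trans (cong (λ k → part′ x xor (part y xor flip k)) z) (proj₂ (ls e z) (~⇒link h))
    }
    where
    part′ : VH → Bool
    part′ x = part x xor flip (p (π x))
    simple : ∀ {x y ẽ ẽ′} → x ≢ y → x ∈ inc (H C) ẽ → y ∈ inc (H C) ẽ → x ∈ inc (H C) ẽ′ → y ∈ inc (H C) ẽ′ → ẽ ≡ ẽ′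
    simple {x} {y} {ẽ} ne hx hy = HG.mult≡1⇒unique (proj₁ (proj₂ (proj₂ tp) x y ne) (~⇒link (ne , ẽ , hx , hy))) ne hx hy

n≥4⇒n≥1 : ∀ {n} → 4 ≤ n → 1 ≤ n
n≥4⇒n≥1 = ℕ.≤-trans (s≤s z≤n)

TightForm : Config → Set
TightForm C = Σ (CycleForm C) λ F → CycleForm.tw F ≡ par (pred (nV (G C)))

odd⇒form : ∀ {C} → OddCConfig C → TightForm C
odd⇒form {C} (t , t≥1 , n≥5 , odd , tc , part₂ , tp) = form , tight
  where
  n≥4 : 4 ≤ nV (G C)
  n≥4 = ℕ.≤-trans (ℕ.n≤1+n 4) n≥5
  open FromCycle {C} t≥1 n≥4 tc part₂ (λ x y → Adj-dec (G C) (proj C x) (proj C y) ×-dec (part₂ x ≟ part₂ y)) proj₁ tp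
  form : CycleForm C
  form = form-with (λ _ → false) false
    (λ {x} {y} e → (λ eq → next⇒Adj (inj₁ e) , part⁻ (trans (sym (Bₚ.xor-identityʳ (part x)))
       (trans eq (Bₚ.xor-identityʳ (part y))))) ,
                   λ (_ , eq) → cong (λ i → fromF i xor false) eq)
    (λ {x} {y} e z → (λ eq → next⇒Adj (inj₂ (e , z)) , part⁻
       (trans (sym (Bₚ.xor-identityʳ (part x))) (trans (xor⇒≡ eq) (Bₚ.xor-identityʳ (part y))))) ,
                   λ (_ , eq) → ≡⇒xor (cong (λ i → fromF i xor false) eq))
  tight : false ≡ par (pred (nV (G C)))
  tight = lem _ (trans (sym (par-pred (n≥4⇒n≥1 n≥4))) (odd-par (nV (G C)) odd))
    where
    lem : ∀ b → not b ≡ true → false ≡ b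
    lem false _ = refl

module Even {C : Config} {t : ℕ} (t≥1 : 1 ≤ t) (n≥4 : 4 ≤ nV (G C)) (even : nV (G C) % 2 ≡ 0) (tc : IsTC t (G C))
  (part₂ : Fin (nV (H C)) → Fin 2) (w w′ : Fin (nV (G C))) (tp : TwoPartH C t part₂ (EvenLink C part₂ w w′)) where

  open FromCycle {C} t≥1 n≥4 tc part₂ (evenLink-dec C part₂ w w′) proj₁ tp public

  private
    n = nV (G C)
    π : Fin (nV (H C)) → Fin n
    π = proj C

  module Cut (nx : Next w w′) where
    m : ℕ
    m = p w

    le : ℕ → Bool
    le k = does (k ℕ.≤? m)

    le-yes : ∀ {k} → k ≤ m → le k ≡ true
    le-yes {k} h = dec-true (k ℕ.≤? m) h

    le-no : ∀ {k} → m < k → le k ≡ false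
    le-no {k} h = dec-false (k ℕ.≤? m) (ℕ.<⇒≱ h)

    Pair : Fin (nV (H C)) → Fin (nV (H C)) → Set
    Pair x y = (π x ≡ w × π y ≡ w′) ⊎ (π x ≡ w′ × π y ≡ w)

    not-back : ∀ {x y} → Next (π x) (π y) → ¬ (π x ≡ w′ × π y ≡ w)
    not-back {x} {y} nxy (e , f) = go nx (subst₂ Next e f nxy)
      where
      3≤ : 3 ≤ n
      3≤ = ℕ.≤-trans (ℕ.n≤1+n 3) n≥4
      go : Next w w′ → Next w′ w → ⊥₀
      go (inj₁ a) (inj₁ b) = ℕ.<⇒≢ (ℕ.m<n⇒m<1+n (ℕ.n<1+n (p w))) (trans b (cong suc a))
      go (inj₁ a) (inj₂ (b , z)) = ℕ.<⇒≢ 3≤ (trans (cong suc (sym (trans a (cong suc z)))) b)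
      go (inj₂ (a , z)) (inj₁ b) = ℕ.<⇒≢ 3≤ (trans (cong suc (sym (trans b (cong suc z)))) a)
      go (inj₂ (a , z)) (inj₂ (b , z′)) = ℕ.<⇒≢ (ℕ.≤-trans (s≤s (s≤s z≤n)) n≥4) (trans (cong suc (sym z)) b)

    pair⇒first : ∀ {x y} → Next (π x) (π y) → Pair x y → π x ≡ w
    pair⇒first _ (inj₁ (e , _)) = e
    pair⇒first {x} {y} nxy (inj₂ b) = ⊥-elim (not-back {x} {y} nxy b)

    crossed⁺ : ∀ {x y} → Next (π x) (π y) → Pair x y → part x ≢ part y → EvenLink C part₂ w w′ x y
    crossed⁺ nxy pr ne = next⇒Adj nxy , (λ _ eq → ne (cong fromF eq)) , λ np → ⊥-elim (np pr)

    plain⁺ : ∀ {x y} → Next (π x) (π y) → ¬ Pair x y → part x ≡ part y → EvenLink C part₂ w w′ x y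
    plain⁺ nxy np eq = next⇒Adj nxy , (λ pr → ⊥-elim (np pr)) , λ _ → part⁻ eq

    crossed⁻ : ∀ {x y} → Pair x y → EvenLink C part₂ w w′ x y → part x ≢ part y
    crossed⁻ pr (_ , f , _) eq = f pr (part⁻ eq)

    plain⁻ : ∀ {x y} → ¬ Pair x y → EvenLink C part₂ w w′ x y → part x ≡ part y
    plain⁻ np (_ , _ , f) = cong fromF (f np)

    xor-move : ∀ a b → a xor true ≡ b xor false → a ≢ b
    xor-move false false ()
    xor-move false true _ ()
    xor-move true false _ ()
    xor-move true true ()

    xor-move⁻ : ∀ a b → a ≢ b → a xor true ≡ b xor false
    xor-move⁻ false false h = ⊥-elim (h refl)
    xor-move⁻ false true h = refl
    xor-move⁻ true false h = refl
    xor-move⁻ true true h = ⊥-elim (h refl)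

    xor-cancel : ∀ a b f → a xor f ≡ b xor f → a ≡ b
    xor-cancel a b f e = trans (sym (xor-cancelʳ a f)) (trans (cong (_xor f) e) (xor-cancelʳ b f))

    Straight : Fin (nV (H C)) → Fin (nV (H C)) → Bool → Bool → Set
    Straight x y f f′ = (part x xor f ≡ part y xor f′ → EvenLink C part₂ w w′ x y) ×
        (EvenLink C part₂ w w′ x y → part x xor f ≡ part y xor f′)

    -- Exchanging the two classes at positions up to m uncrosses the pair that follows m; for every
    -- other consecutive pair both ends or neither are exchanged.
    straight : ∀ {x y} → p (π y) ≡ suc (p (π x)) → Straight x y (le (p (π x))) (le (suc (p (π x))))
    straight {x} {y} e with ℕ.<-cmp (p (π x)) m
    ... | tri≈ _ k≡m _ = subst₂ (Straight x y) (sym (le-yes (ℕ.≤-reflexive k≡m))) (sym (le-no (s≤s (ℕ.≤-reflexive (sym k≡m)))))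
            ((λ eq → crossed⁺ (inj₁ e) pr (xor-move _ _ eq)) , λ l → xor-move⁻ _ _ (crossed⁻ pr l))
      where
      pr : Pair x y
      pr = inj₁ (p-inj k≡m , [ (λ nx₁ → p-inj (trans e (trans (cong suc k≡m) (sym nx₁)))) ,
        (λ (sm , _) → ⊥-elim (ℕ.<⇒≢ (Fₚ.toℕ<n (Inverse.from φ (π y))) (trans e (trans (cong suc k≡m) sm)))) ]′ nx)
    ... | tri< lt ne _ = subst₂ (Straight x y) (sym (le-yes (ℕ.<⇒≤ lt))) (sym (le-yes lt))
            ((λ eq → plain⁺ (inj₁ e) np (xor-cancel _ _ true eq)) , λ l → cong (_xor true) (plain⁻ np l))
      where
      np : ¬ Pair x y
      np pr = ne (cong p (pair⇒first {x} {y} (inj₁ e) pr))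
    ... | tri> _ ne gt = subst₂ (Straight x y) (sym (le-no gt)) (sym (le-no (ℕ.m<n⇒m<1+n gt)))
            ((λ eq → plain⁺ (inj₁ e) np (xor-cancel _ _ false eq)) , λ l → cong (_xor false) (plain⁻ np l))
      where
      np : ¬ Pair x y
      np pr = ne (cong p (pair⇒first {x} {y} (inj₁ e) pr))

    Last : Fin (nV (H C)) → Fin (nV (H C)) → Bool → Bool → Set
    Last x y f f′ = ((part x xor f) xor (part y xor f′) ≡ true → EvenLink C part₂ w w′ x y) ×
        (EvenLink C part₂ w w′ x y → (part x xor f) xor (part y xor f′) ≡ true)

    -- Position 0 is always exchanged. Position n - 1 is not if m is smaller, which crosses the
    -- straight closing pair; if m = n - 1, both are, and the closing pair is the one crossed from
    -- the start.
    last-pair : ∀ {x y} → suc (p (π x)) ≡ n → p (π y) ≡ 0 → Last x y (le (p (π x))) (le 0)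
    last-pair {x} {y} e z with ℕ.<-cmp (p (π x)) m
    ... | tri< lt _ _ = ⊥-elim (ℕ.<⇒≱ (Fₚ.toℕ<n (Inverse.from φ w)) (subst (_≤ m) e lt))
    ... | tri≈ _ k≡m _ = subst₂ (Last x y) (sym (le-yes (ℕ.≤-reflexive k≡m))) (sym (le-yes z≤n))
            ((λ eq → crossed⁺ (inj₂ (e , z)) pr (λ h → xor⇒≢ eq (cong (_xor true) h))) ,
             λ l → ≢⇒xor (λ h → crossed⁻ pr l (xor-cancel _ _ true h)))
      where
      pr : Pair x y
      pr = inj₁ (p-inj k≡m , [ (λ nx₁ → ⊥-elim (ℕ.<⇒≢ (Fₚ.toℕ<n (Inverse.from φ w′))
          (trans nx₁ (trans (cong suc (sym k≡m)) e)))) ,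
        (λ (_ , z′) → p-inj (trans z (sym z′))) ]′ nx)
    ... | tri> _ ne gt = subst₂ (Last x y) (sym (le-no gt)) (sym (le-yes z≤n))
            ((λ eq → plain⁺ (inj₂ (e , z)) np (lem _ _ eq)) , λ l → lem⁻ _ _ (plain⁻ np l))
      where
      np : ¬ Pair x y
      np pr = ne (cong p (pair⇒first {x} {y} (inj₂ (e , z)) pr))
      lem : ∀ a b → (a xor false) xor (b xor true) ≡ true → a ≡ b
      lem false false _ = refl
      lem true true _ = refl
      lem⁻ : ∀ a b → a ≡ b → (a xor false) xor (b xor true) ≡ true
      lem⁻ false _ refl = refl
      lem⁻ true _ refl = refl

    tight-form : TightForm C
    tight-form = form-with le true straight last-pair , (lem _ (trans (sym (par-pred (n≥4⇒n≥1 n≥4))) (even-par n even)))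
      where
      lem : ∀ b → not b ≡ false → true ≡ b
      lem true _ = refl

-- The pair w, w′ may run with the cyclic order or against it; exchanging the names reduces the
-- second case to the first.
even⇒form : ∀ {C} → EvenCConfig C → TightForm C
even⇒form {C} (t , t≥1 , n≥4 , even , tc , part₂ , w , w′ , ww′ , tp) =
  [ E.Cut.tight-form , E′.Cut.tight-form ]′ (E.Adj⇒next ww′)
  where
  tp′ : TwoPartH C t part₂ (EvenLink C part₂ w′ w)
  tp′ = proj₁ tp , proj₁ (proj₂ tp) , λ x y ne → (λ l → proj₁ (proj₂ (proj₂ tp) x y ne) (evenLink-swap {C} l)) ,
    λ nl → proj₂ (proj₂ (proj₂ tp) x y ne) (λ l → nl (evenLink-swap {C} l))
  module E = Even {C} t≥1 n≥4 even tc part₂ w w′ tp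
  module E′ = Even {C} t≥1 n≥4 even tc part₂ w′ w tp′

-- The converse

-- An independent set meeting every X_u except X_v; a set rather than a choice function because the fibres may be empty.
record Partial (C : Config) (v : Fin (nV (G C))) : Set where
  field
    T : Subset (nV (H C))
    avoids : ∀ {x} → x ∈ T → proj C x ≢ v
    meets : ∀ u → u ≢ v → ∃ λ x → x ∈ T × proj C x ≡ u
    independent : ∀ ẽ → ¬ (∀ x → x ∈ inc (H C) ẽ → x ∈ T)

Critical : Config → Set
Critical C = MinUnc C × (∀ v → Partial C v)

-- Take a colouring of H without ẽ and drop its colour over `π x`: the rest misses x and therefore
-- cannot contain ẽ either.
edge⇒partial : ∀ {C} → MinUnc C → ∀ {ẽ x} → x ∈ inc (H C) ẽ → Partial C (proj C x)
edge⇒partial {C} mu {ẽ} {x} hx = from-deletion (proj₂ mu ẽ)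
  where
  from-deletion : ColourableWithout C ẽ → Partial C (proj C x)
  from-deletion (c , sec , free) = record
    { T = compr T?
    ; avoids = λ h → proj₁ (∈-compr⁻ T? h)
    ; meets = λ u ne → c u , ∈-compr⁺ T? ((λ e → ne (trans (sym (sec u)) e)) , cong c (sec u)) , sec u
    ; independent = ind
    }
    where
    T? : ∀ y → Dec (proj C y ≢ proj C x × c (proj C y) ≡ y)
    T? y = ¬? (proj C y ≟ proj C x) ×-dec (c (proj C y) ≟ y)
    ind : ∀ ẽ′ → ¬ (∀ y → y ∈ inc (H C) ẽ′ → y ∈ compr T?)
    ind ẽ′ sub with ẽ′ ≟ ẽ
    ... | yes refl = proj₁ (∈-compr⁻ T? (sub x hx)) refl
    ... | no ne = free ẽ′ ne (λ y hy → proj₂ (∈-compr⁻ T? (sub y hy)))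

form⇒critical : ∀ {C} → TightForm C → Critical C
form⇒critical {C} (F , tight) = mu , λ v →
  let ẽ , x , hx , πx = Form.edge-at F v in subst (Partial C) πx (edge⇒partial {C} mu hx)
  where
  mu : MinUnc C
  mu = Form.form-minUnc F tight

e⇒critical : ∀ {C} → EConfig C → Critical C
e⇒critical {C} (one-e , spanning , single , one-ẽ , spanning-ẽ) = (unc , del) , part
  where
  pick : ∀ v → ∃ λ x → x ∈ X C v × (∀ y → y ∈ X C v → y ≡ x)
  pick v = ∣∣≡1⁻ (X C v) (single v)
  c : Fin (nV (G C)) → Fin (nV (H C))
  c v = proj₁ (pick v)
  sec : ∀ v → proj C (c v) ≡ v
  sec v = ∈-Xset⁻ (H C) (proj C) (proj₁ (proj₂ (pick v)))
  ẽ₀ : Fin (nE (H C))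
  ẽ₀ = subst Fin (sym one-ẽ) zero
  unc : Uncolourable C
  unc c′ sec′ free = free ẽ₀ (λ x _ → trans (proj₂ (proj₂ (pick (proj C x))) _ (∈-Xset⁺ (H C) (proj C) (sec′ (proj C x))))
                                     (sym (proj₂ (proj₂ (pick (proj C x))) x (∈-Xset⁺ (H C) (proj C) refl))))
  del : ∀ ẽ → ColourableWithout C ẽ
  del ẽ = c , sec , λ ẽ′ ne → ⊥-elim (ne (Fin1-unique one-ẽ ẽ′ ẽ))
  part : ∀ v → Partial C v
  part v = record
    { T = compr T?
    ; avoids = ∈-compr⁻ T?
    ; meets = λ u ne → c u , ∈-compr⁺ T? (λ e → ne (trans (sym (sec u)) e)) , sec u
    ; independent = λ ẽ sub → ∈-compr⁻ T? (sub (c v) (subst (c v ∈_) (sym (spanning-ẽ ẽ)) Sₚ.∈⊤)) (sec v)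
    }
    where
    T? : ∀ x → Dec (proj C x ≢ v)
    T? x = ¬? (proj C x ≟ v)

module FromK {C : Config} (kc : KConfig C) where
  private
    n = nV (G C)
    π = proj C
    t = proj₁ kc
    t≥1 : 1 ≤ t
    t≥1 = proj₁ (proj₂ kc)
    n≥1 : 1 ≤ n
    n≥1 = proj₁ (proj₂ (proj₂ kc))
    part : Fin (nV (H C)) → Fin (n ∸ 1)
    part = proj₁ (proj₂ (proj₂ (proj₂ (proj₂ kc))))
    rest = proj₂ (proj₂ (proj₂ (proj₂ (proj₂ kc))))
    H-graph : IsGraph (H C)
    H-graph = proj₁ (proj₂ rest)

  module HG = Graph {H C} H-graph

  _~_ : Fin (nV (H C)) → Fin (nV (H C)) → Set
  _~_ = Adj′ (H C)

  link⇒~ : ∀ {x y} → π x ≢ π y → part x ≡ part y → x ~ y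
  link⇒~ {x} {y} ne eq = HG.mult⇒adj (λ e → ne (cong π e)) (ℕ.≤-reflexive
      (sym (proj₁ (proj₂ (proj₂ rest) x y (λ e → ne (cong π e))) (ne , eq))))

  ~⇒link : ∀ {x y} → x ~ y → π x ≢ π y × part x ≡ part y
  ~⇒link {x} {y} h with ¬? (π x ≟ π y) ×-dec (part x ≟ part y)
  ... | yes l = l
  ... | no nl = ⊥-elim (ℕ.<⇒≢ (HG.adj⇒mult h) (sym (proj₂ (proj₂ (proj₂ rest) x y (proj₁ h)) nl)))

  simple : ∀ {x y ẽ ẽ′} → x ≢ y → x ∈ inc (H C) ẽ → y ∈ inc (H C) ẽ → x ∈ inc (H C) ẽ′ → y ∈ inc (H C) ẽ′ → ẽ ≡ ẽ′
  simple {x} {y} {ẽ} ne hx hy = HG.mult≡1⇒unique (proj₁ (proj₂ (proj₂ rest) x y ne) (~⇒link (ne , ẽ , hx , hy))) ne hx hy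

  member : ∀ v i → ∃ λ x → π x ≡ v × part x ≡ i
  member v i = let x , h = ∣∣≥1⁻ (compr P?) (subst (1 ≤_) (sym (proj₁ rest v i)) t≥1) in x , ∈-compr⁻ P? h
    where
    P? : ∀ x → Dec (π x ≡ v × part x ≡ i)
    P? x = (π x ≟ v) ×-dec (part x ≟ i)

  -- There are n vertices and n - 1 classes, so two chosen colours share a class and are adjacent.
  unc : Uncolourable C
  unc c sec free = collide (Fₚ.pigeonhole (ℕ.≤-reflexive (ℕ.suc-pred n ⦃ >-nonZero n≥1 ⦄)) (λ v → part (c v)))
    where
    collide : (∃ λ u → ∃ λ w → u Data.Fin.< w × part (c u) ≡ part (c w)) → ⊥₀
    collide (u , w , lt , eq) = section-independent {C} H-graph sec free u w
      (link⇒~ (λ e → Fₚ.<⇒≢ lt (trans (sym (sec u)) (trans e (sec w)))) eq)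

  -- Colour u and v by the ends x, y of the deleted edge, and the other vertices injectively by the
  -- remaining n − 2 classes: punch v out of V and exchange the class of u with that of x.
  module Delete {ẽ x y} (ne : x ≢ y) (hx : x ∈ inc (H C) ẽ) (hy : y ∈ inc (H C) ẽ) where
    u v : Fin n
    u = π x
    v = π y
    link : u ≢ v × part x ≡ part y
    link = ~⇒link (ne , ẽ , hx , hy)
    u≢v : u ≢ v
    u≢v = proj₁ link
    i : Fin (n ∸ 1)
    i = part x

    q : ∀ {w} → w ≢ v → Fin (n ∸ 1)
    q ne = punchOut′ (λ e → ne (sym e))

    -- Punching v out gives u the class `q u≢v`, which u does not use; the vertex that would have
    -- had class i takes it.
    exchange : ∀ j → Dec (j ≡ i) → Fin (n ∸ 1)
    exchange j (yes _) = q u≢v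
    exchange j (no _) = j

    data Kind (w : Fin n) : Set where
      is-u : w ≡ u → Kind w
      is-v : w ≡ v → Kind w
      else : w ≢ u → w ≢ v → Kind w

    kind : ∀ w → Kind w
    kind w with w ≟ u | w ≟ v
    ... | yes e | _ = is-u e
    ... | no _ | yes e = is-v e
    ... | no a | no b = else a b

    ℓ : ∀ {w} → Kind w → Fin (n ∸ 1)
    ℓ (is-u _) = i
    ℓ (is-v _) = i
    ℓ (else _ nv) = exchange (q nv) (q nv ≟ i)

    c′ : ∀ {w} → Kind w → Fin (nV (H C))
    c′ (is-u _) = x
    c′ (is-v _) = y
    c′ {w} k@(else _ _) = proj₁ (member w (ℓ k))

    c : Fin n → Fin (nV (H C))
    c w = c′ (kind w)

    sec′ : ∀ {w} (k : Kind w) → π (c′ k) ≡ w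
    sec′ (is-u e) = sym e
    sec′ (is-v e) = sym e
    sec′ {w} k@(else _ _) = proj₁ (proj₂ (member w (ℓ k)))

    lab : ∀ {w} (k : Kind w) → part (c′ k) ≡ ℓ k
    lab (is-u _) = refl
    lab (is-v _) = sym (proj₂ link)
    lab {w} k@(else _ _) = proj₂ (proj₂ (member w (ℓ k)))

    exchange-≢ : ∀ {w} (nu : w ≢ u) (nv : w ≢ v) d → exchange (q nv) d ≢ i
    exchange-≢ nu nv (yes e) h = nu (sym (punchOut′-injective _ _ (trans h (sym e))))
    exchange-≢ nu nv (no ne) h = ne h

    exchange-inj : ∀ {w w′} (nu : w ≢ u) (nv : w ≢ v) (nu′ : w′ ≢ u) (nv′ : w′ ≢ v) d d′ →
      exchange (q nv) d ≡ exchange (q nv′) d′ → w ≡ w′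
    exchange-inj nu nv nu′ nv′ (yes e) (yes e′) h = punchOut′-injective _ _ (trans e (sym e′))
    exchange-inj nu nv nu′ nv′ (yes _) (no _) h = ⊥-elim (nu′ (sym (punchOut′-injective _ _ h)))
    exchange-inj nu nv nu′ nv′ (no _) (yes _) h = ⊥-elim (nu (punchOut′-injective _ _ h))
    exchange-inj nu nv nu′ nv′ (no _) (no _) h = punchOut′-injective _ _ h

    clash : ∀ {w w′} (k : Kind w) (k′ : Kind w′) → w ≢ w′ → ℓ k ≡ ℓ k′ → (c′ k ≡ x × c′ k′ ≡ y) ⊎ (c′ k ≡ y × c′ k′ ≡ x)
    clash (is-u e) (is-u e′) n _ = ⊥-elim (n (trans e (sym e′)))
    clash (is-u _) (is-v _) n _ = inj₁ (refl , refl)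
    clash (is-u _) (else nu nv) n h = ⊥-elim (exchange-≢ nu nv (q nv ≟ i) (sym h))
    clash (is-v _) (is-u _) n _ = inj₂ (refl , refl)
    clash (is-v e) (is-v e′) n _ = ⊥-elim (n (trans e (sym e′)))
    clash (is-v _) (else nu nv) n h = ⊥-elim (exchange-≢ nu nv (q nv ≟ i) (sym h))
    clash (else nu nv) (is-u _) n h = ⊥-elim (exchange-≢ nu nv (q nv ≟ i) h)
    clash (else nu nv) (is-v _) n h = ⊥-elim (exchange-≢ nu nv (q nv ≟ i) h)
    clash (else nu nv) (else nu′ nv′) n h = ⊥-elim (n (exchange-inj nu nv nu′ nv′ (q nv ≟ i) (q nv′ ≟ i) h))

    free : ∀ ẽ′ → ẽ′ ≢ ẽ → ¬ Mono (H C) π c ẽ′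
    free ẽ′ nẽ m =
      let a , b , ha , hb , nab = ∣∣≥2⁻ (size (H C) ẽ′)
          ab = λ e → nab (sym e)
          πne , eq = ~⇒link (ab , ẽ′ , ha , hb)
          ea = m a ha
          eb = m b hb
          same : ℓ (kind (π a)) ≡ ℓ (kind (π b))
          same = trans (sym (lab (kind (π a)))) (trans (cong part ea) (trans eq (trans (cong part (sym eb)) (lab (kind (π b))))))
      in nẽ ([ (λ (p , r) → simple ne (at ha (trans (sym ea) p)) (at hb (trans (sym eb) r)) hx hy) ,
               (λ (p , r) → simple ne (at hb (trans (sym eb) r)) (at ha (trans (sym ea) p)) hx hy) ]′
             (clash (kind (π a)) (kind (π b)) πne same))
      where
      at : ∀ {a z} → a ∈ inc (H C) ẽ′ → a ≡ z → z ∈ inc (H C) ẽ′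
      at h refl = h

    result : ColourableWithout C ẽ
    result = c , (λ w → sec′ (kind w)) , free

  mu : MinUnc C
  mu = unc , λ ẽ → let a , b , ha , hb , ne = ∣∣≥2⁻ (size (H C) ẽ) in Delete.result (λ e → ne (sym e)) ha hb

  critical : Critical C
  critical = mu , partials
    where
    partials : ∀ v → Partial C v
    partials v with Fₚ.any? (λ u → ¬? (u ≟ v))
    ... | yes (u , ne) =
      let i = punchOut′ ne
          x , πx , px = member v i
          y , πy , py = member u i
          _ , ẽ , hx , _ = link⇒~ {x} {y} (λ e → ne (trans (sym πy) (trans (sym e) πx))) (trans px (sym py))
      in subst (Partial C) πx (edge⇒partial {C} mu hx)
    -- For a single vertex there are no classes to choose a colour from, but the empty set meets
    -- every fibre except the one at v.
    ... | no alone = record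
      { T = ⊥
      ; avoids = λ h → ⊥-elim (Sₚ.∉⊥ h)
      ; meets = λ u ne → ⊥-elim (alone (u , ne))
      ; independent = λ ẽ sub → let x , _ , hx , _ = ∣∣≥2⁻ (size (H C) ẽ) in Sₚ.∉⊥ (sub x hx)
      }

-- Merging preserves criticality

record Glue (C C₁ C₂ : Config) : Set where
  field
    v₁ : Fin (nV (G C₁))
    v₂ : Fin (nV (G C₂))
    α : Fin (nV (G C₁)) → Fin (nV (G C))
    β : Fin (nV (G C₂)) → Fin (nV (G C))
    γ₁ : Fin (nV (H C₁)) → Fin (nV (H C))
    γ₂ : Fin (nV (H C₂)) → Fin (nV (H C))
    δ₁ : Fin (nE (H C₁)) → Fin (nE (H C))
    δ₂ : Fin (nE (H C₂)) → Fin (nE (H C))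
    α-inj : ∀ {x y} → α x ≡ α y → x ≡ y
    β-inj : ∀ {x y} → β x ≡ β y → x ≡ y
    glue : α v₁ ≡ β v₂
    meet : ∀ {x y} → α x ≡ β y → x ≡ v₁ × y ≡ v₂
    cover : ∀ z → (∃ λ x → α x ≡ z) ⊎ (∃ λ y → β y ≡ z)
    γ₁-inj : ∀ {x y} → γ₁ x ≡ γ₁ y → x ≡ y
    γ₂-inj : ∀ {x y} → γ₂ x ≡ γ₂ y → x ≡ y
    γ-disj : ∀ {x y} → γ₁ x ≢ γ₂ y
    γ-cover : ∀ z → (∃ λ x → γ₁ x ≡ z) ⊎ (∃ λ y → γ₂ y ≡ z)
    δ-cover : ∀ e → (∃ λ e₁ → δ₁ e₁ ≡ e) ⊎ (∃ λ e₂ → δ₂ e₂ ≡ e)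
    inc₁⁺ : ∀ {e x} → x ∈ inc (H C₁) e → γ₁ x ∈ inc (H C) (δ₁ e)
    inc₁⁻ : ∀ {e x} → γ₁ x ∈ inc (H C) (δ₁ e) → x ∈ inc (H C₁) e
    cross₁ : ∀ {e y} → ¬ (γ₂ y ∈ inc (H C) (δ₁ e))
    inc₂⁺ : ∀ {e x} → x ∈ inc (H C₂) e → γ₂ x ∈ inc (H C) (δ₂ e)
    inc₂⁻ : ∀ {e x} → γ₂ x ∈ inc (H C) (δ₂ e) → x ∈ inc (H C₂) e
    cross₂ : ∀ {e y} → ¬ (γ₁ y ∈ inc (H C) (δ₂ e))
    π₁ : ∀ x → proj C (γ₁ x) ≡ α (proj C₁ x)
    π₂ : ∀ y → proj C (γ₂ y) ≡ β (proj C₂ y)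

-- `IsMerge` is unpacked into data symmetric in the two parts, so that each argument below is made
-- for the first part only.
glue-sym : ∀ {C C₁ C₂} → Glue C C₁ C₂ → Glue C C₂ C₁
glue-sym g = record
  { v₁ = v₂ ; v₂ = v₁ ; α = β ; β = α ; γ₁ = γ₂ ; γ₂ = γ₁ ; δ₁ = δ₂ ; δ₂ = δ₁ ; α-inj = β-inj ; β-inj = α-inj
  ; glue = sym glue ; meet = λ e → let a , b = meet (sym e) in b , a ; cover = λ z → Sum.swap (cover z)
  ; γ₁-inj = γ₂-inj ; γ₂-inj = γ₁-inj ; γ-disj = λ e → γ-disj (sym e) ; γ-cover = λ z → Sum.swap
      (γ-cover z) ; δ-cover = λ z → Sum.swap (δ-cover z)
  ; inc₁⁺ = inc₂⁺ ; inc₁⁻ = inc₂⁻ ; cross₁ = cross₂ ; inc₂⁺ = inc₁⁺ ; inc₂⁻ = inc₁⁻ ; cross₂ = cross₁ ; π₁ = π₂ ; π₂ = π₁ }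
  where
  open Glue g

isMerge⇒glue : ∀ {C C₁ C₂} → IsMerge C C₁ C₂ → Glue C C₁ C₂
isMerge⇒glue {C} {C₁} {C₂} (v₁ , v₂ , α , β , ε′ , γ , δ , α-inj , β-inj , glue , meet , cover , _ , _ , i₁ , x₁ , i₂ , x₂ , π₁ , π₂) = record
  { v₁ = v₁ ; v₂ = v₂ ; α = α ; β = β
  ; γ₁ = λ x → Inverse.to γ (inj₁ x) ; γ₂ = λ y → Inverse.to γ (inj₂ y) ; δ₁ = λ x → Inverse.to δ
      (inj₁ x) ; δ₂ = λ y → Inverse.to δ (inj₂ y)
  ; α-inj = α-inj _ _ ; β-inj = β-inj _ _ ; glue = glue ; meet = meet _ _ ; cover = cover
  ; γ₁-inj = λ e → inj₁-injective (to-inj γ e) ; γ₂-inj = λ e → inj₂-injective (to-inj γ e)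
  ; γ-disj = λ e → disj (to-inj γ e) ; γ-cover = covers γ ; δ-cover = covers δ
  ; inc₁⁺ = λ {e} {x} → Equivalence.from (i₁ e x) ; inc₁⁻ = λ {e} {x} → Equivalence.to (i₁ e x) ; cross₁ = x₁ _ _
  ; inc₂⁺ = λ {e} {x} → Equivalence.from (i₂ e x) ; inc₂⁻ = λ {e} {x} → Equivalence.to (i₂ e x) ; cross₂ = x₂ _ _
  ; π₁ = π₁ ; π₂ = π₂ }
  where
  to-inj : ∀ {A B : Set} (f : A ↔ B) {a b} → Inverse.to f a ≡ Inverse.to f b → a ≡ b
  to-inj f {a} {b} e = trans (sym (Inverse.strictlyInverseʳ f a)) (trans (cong (Inverse.from f) e) (Inverse.strictlyInverseʳ f b))
  disj : ∀ {A B : Set} {a : A} {b : B} → inj₁ a ≢ inj₂ b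
  disj ()
  covers : ∀ {A B D : Set} (f : (A ⊎ B) ↔ D) z → (∃ λ a → Inverse.to f (inj₁ a) ≡ z) ⊎ (∃ λ b → Inverse.to f (inj₂ b) ≡ z)
  covers f z with Inverse.from f z in eq
  ... | inj₁ a = inj₁ (a , trans (cong (Inverse.to f) (sym eq)) (Inverse.strictlyInverseˡ f z))
  ... | inj₂ b = inj₂ (b , trans (cong (Inverse.to f) (sym eq)) (Inverse.strictlyInverseˡ f z))

module Glued {C C₁ C₂} (gl : Glue C C₁ C₂) where
  open Glue gl

  -- If the colour of the identified vertex came from `H C₁`, so would the colours of all vertices
  -- of `G C₁`, and c would restrict to a colouring of `C₁`.
  not-first : MinUnc C₁ → ∀ c → (∀ v → proj C (c v) ≡ v) → (∀ ẽ → ¬ Mono (H C) (proj C) c ẽ) → ∀ x → c (α v₁) ≢ γ₁ x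
  not-first mu c sec free x₁ eq = proj₁ mu c₁ sec₁ (λ e m → free (δ₁ e) (lift e m))
    where
    pull : ∀ u → ∃ λ y → γ₁ y ≡ c (α u)
    pull u with γ-cover (c (α u))
    ... | inj₁ r = r
    ... | inj₂ (y , e) = ⊥-elim (γ-disj (trans (sym eq) (trans
        (cong (λ w → c (α w)) (sym (proj₁ (meet (trans (sym (sec (α u))) (trans (cong (proj C) (sym e)) (π₂ y))))))) (sym e))))
    c₁ : Fin (nV (G C₁)) → Fin (nV (H C₁))
    c₁ u = proj₁ (pull u)
    sec₁ : ∀ u → proj C₁ (c₁ u) ≡ u
    sec₁ u = α-inj (trans (sym (π₁ _)) (trans (cong (proj C) (proj₂ (pull u))) (sec (α u))))
    lift : ∀ e → Mono (H C₁) (proj C₁) c₁ e → Mono (H C) (proj C) c (δ₁ e)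
    lift e m z hz with γ-cover z
    ... | inj₁ (x , refl) = trans (cong c (π₁ x)) (trans (sym (proj₂ (pull (proj C₁ x)))) (cong γ₁ (m x (inc₁⁻ hz))))
    ... | inj₂ (y , refl) = ⊥-elim (cross₁ hz)

  -- The vertices from `G C₁`, with the identified one among them, follow a colouring of `C₁`
  -- without the edge; the others follow T. Inside `H C₂` only colours from T are used, so no edge
  -- there is completed.
  deletion₁ : MinUnc C₁ → Partial C₂ v₂ → ∀ e₁ → ColourableWithout C (δ₁ e₁)
  deletion₁ mu P e₁ = build (proj₂ mu e₁)
    where
    open Partial P
    build : ColourableWithout C₁ e₁ →
      ColourableWithout C (δ₁ e₁)
    build (c₁ , sec₁ , free₁) = c , sec , free
      where
      Value : Fin (nV (G C)) → Set
      Value z = (∃ λ u → α u ≡ z) ⊎ (∃ λ y → y ∈ T × β (proj C₂ y) ≡ z)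
      value : ∀ z → Value z
      -- The first part is tried first, so the identified vertex takes its colour from `C₁`, as T
      -- has none over `v₂`.
      value z with Fₚ.any? (λ u → α u ≟ z)
      ... | yes r = inj₁ r
      ... | no nα with cover z
      ... | inj₁ r = inj₁ r
      ... | inj₂ (w , e) = let y , hy , πy = meets w (λ { refl → nα (v₁ , trans glue e) }) in inj₂ (y , hy , trans (cong β πy) e)
      val : ∀ {z} → Value z → Fin (nV (H C))
      val (inj₁ (u , _)) = γ₁ (c₁ u)
      val (inj₂ (y , _)) = γ₂ y
      c : Fin (nV (G C)) → Fin (nV (H C))
      c z = val (value z)
      val-sec : ∀ {z} (r : Value z) → proj C (val r) ≡ z
      val-sec (inj₁ (u , e)) = trans (π₁ _) (trans (cong α (sec₁ u)) e)
      val-sec (inj₂ (y , _ , e)) = trans (π₂ y) e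
      sec : ∀ z → proj C (c z) ≡ z
      sec z = val-sec (value z)
      val₁ : ∀ {z x} (r : Value z) → val r ≡ γ₁ x → z ≡ α (proj C₁ x) → c₁ (proj C₁ x) ≡ x
      val₁ (inj₁ (u , e)) eq ez = trans (cong c₁ (sym (α-inj (trans e ez)))) (γ₁-inj eq)
      val₁ (inj₂ _) eq _ = ⊥-elim (γ-disj (sym eq))
      val₂ : ∀ {z y} (r : Value z) → val r ≡ γ₂ y → y ∈ T
      val₂ (inj₁ _) eq = ⊥-elim (γ-disj eq)
      val₂ (inj₂ (y′ , h , _)) eq = subst (_∈ T) (γ₂-inj eq) h
      free : ∀ ẽ → ẽ ≢ δ₁ e₁ → ¬ Mono (H C) (proj C) c ẽ
      free ẽ ne m with δ-cover ẽ
      ... | inj₁ (e , refl) = free₁ e (λ eq → ne (cong δ₁ eq)) (λ x h → val₁ (value (proj C (γ₁ x))) (m (γ₁ x) (inc₁⁺ h)) (π₁ x))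
      ... | inj₂ (e , refl) = independent e (λ y h → val₂ (value (proj C (γ₂ y))) (m (γ₂ y) (inc₂⁺ h)))

  -- The union of the set of `C₁` that omits u and the set of `C₂` that omits `v₂`. The identified
  -- vertex is met from `C₁`, unless it is the vertex to be omitted.
  partial₁ : (∀ u → Partial C₁ u) → Partial C₂ v₂ → ∀ u → Partial C (α u)
  partial₁ P₁ P₂ u = record
    { T = compr T?
    ; avoids = λ {z} h → avoid z (∈-compr⁻ T? h)
    ; meets = meet-all
    ; independent = ind
    }
    where
    module P₁ = Partial (P₁ u)
    module P₂ = Partial P₂
    In : Fin (nV (H C)) → Set
    In z = (∃ λ x → x ∈ P₁.T × γ₁ x ≡ z) ⊎ (∃ λ y → y ∈ P₂.T × γ₂ y ≡ z)
    T? : ∀ z → Dec (In z)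
    T? z = Fₚ.any? (λ x → (x Sₚ.∈? P₁.T) ×-dec (γ₁ x ≟ z)) ⊎-dec Fₚ.any? (λ y → (y Sₚ.∈? P₂.T) ×-dec (γ₂ y ≟ z))
    avoid : ∀ z → In z → proj C z ≢ α u
    avoid _ (inj₁ (x , h , refl)) e = P₁.avoids h (α-inj (trans (sym (π₁ x)) e))
    avoid _ (inj₂ (y , h , refl)) e = P₂.avoids h (proj₂ (meet (trans (sym e) (π₂ y))))
    from₁ : ∀ w → w ≢ u → ∃ λ z → z ∈ compr T? × proj C z ≡ α w
    from₁ w ne = let x , h , πx = P₁.meets w ne in γ₁ x , ∈-compr⁺ T? (inj₁ (x , h , refl)) , trans (π₁ x) (cong α πx)
    meet-all : ∀ z → z ≢ α u → ∃ λ x → x ∈ compr T? × proj C x ≡ z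
    meet-all z ne with cover z
    ... | inj₁ (w , refl) = from₁ w (λ e → ne (cong α e))
    ... | inj₂ (w , refl) with w ≟ v₂
    ... | yes refl = let x , h , e = from₁ v₁ (λ eq → ne (trans (sym glue) (cong α eq))) in x , h , trans e glue
    ... | no nw = let y , h , πy = P₂.meets w nw in γ₂ y , ∈-compr⁺ T? (inj₂ (y , h , refl)) , trans (π₂ y) (cong β πy)
    in₁ : ∀ {x} → In (γ₁ x) → x ∈ P₁.T
    in₁ (inj₁ (x′ , h , e)) = subst (_∈ P₁.T) (γ₁-inj e) h
    in₁ (inj₂ (_ , _ , e)) = ⊥-elim (γ-disj (sym e))
    in₂ : ∀ {y} → In (γ₂ y) → y ∈ P₂.T
    in₂ (inj₁ (_ , _ , e)) = ⊥-elim (γ-disj e)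
    in₂ (inj₂ (y′ , h , e)) = subst (_∈ P₂.T) (γ₂-inj e) h
    ind : ∀ ẽ → ¬ (∀ x → x ∈ inc (H C) ẽ → x ∈ compr T?)
    ind ẽ sub with δ-cover ẽ
    ... | inj₁ (e , refl) = P₁.independent e (λ x h → in₁ (∈-compr⁻ T? (sub (γ₁ x) (inc₁⁺ h))))
    ... | inj₂ (e , refl) = P₂.independent e (λ y h → in₂ (∈-compr⁻ T? (sub (γ₂ y) (inc₂⁺ h))))

merge-critical : ∀ {C C₁ C₂} → Glue C C₁ C₂ → Critical C₁ → Critical C₂ → Critical C
merge-critical {C} {C₁} {C₂} gl (mu₁ , P₁) (mu₂ , P₂) = (unc , del) , partials
  where
  open Glue gl
  module G₁ = Glued gl
  module G₂ = Glued (glue-sym gl)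
  unc : Uncolourable C
  unc c sec free with γ-cover (c (α v₁))
  ... | inj₁ (x , e) = G₁.not-first mu₁ c sec free x (sym e)
  ... | inj₂ (y , e) = G₂.not-first mu₂ c sec free y (trans (cong c (sym glue)) (sym e))
  del : ∀ ẽ → ColourableWithout C ẽ
  del ẽ with δ-cover ẽ
  ... | inj₁ (e , refl) = G₁.deletion₁ mu₁ (P₂ v₂) e
  ... | inj₂ (e , refl) = G₂.deletion₁ mu₂ (P₁ v₁) e
  partials : ∀ z → Partial C z
  partials z with cover z
  ... | inj₁ (u , refl) = G₁.partial₁ P₁ (P₂ v₂) u
  ... | inj₂ (w , refl) = G₂.partial₁ P₂ (P₁ v₁) w

constructible⇒critical : ∀ {C} → Constructible C → Critical C
constructible⇒critical (fromK C _ k) = FromK.critical k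
constructible⇒critical (fromC C _ (inj₁ o)) = form⇒critical (odd⇒form {C} o)
constructible⇒critical (fromC C _ (inj₂ e)) = form⇒critical (even⇒form {C} e)
constructible⇒critical (fromE C _ e) = e⇒critical {C} e
constructible⇒critical (merge C C₁ C₂ k₁ k₂ m) =
  merge-critical (isMerge⇒glue {C} {C₁} {C₂} m) (constructible⇒critical k₁) (constructible⇒critical k₂)

-- The characterisation

∀⊎∃ : ∀ {n} {P Q : Fin n → Set} → (∀ v → P v ⊎ Q v) → (∀ v → P v) ⊎ ∃ Q
∀⊎∃ {zero} f = inj₁ λ ()
∀⊎∃ {suc n} f with f zero | ∀⊎∃ (λ v → f (suc v))
... | inj₂ q | _ = inj₂ (zero , q)
... | inj₁ p | inj₂ (v , q) = inj₂ (suc v , q)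
... | inj₁ p | inj₁ ps = inj₁ λ { zero → p ; (suc v) → ps v }

block⇒constructible : ∀ {C} → Feasible C → UncolorableBlock C → 2 ≤ nV (G C) → Constructible C
block⇒constructible {C} feas B n≥2 = by-size (∀⊎∃ (λ e → size? e))
  where
  size? : ∀ e → ∣ inc (G C) e ∣ ≡ 2 ⊎ ∣ inc (G C) e ∣ ≢ 2
  size? e with ∣ inc (G C) e ∣ ℕ.≟ 2
  ... | yes p = inj₁ p
  ... | no p = inj₂ p

  pair? : ∀ a b → (a ≢ b → ConnOff (G C) (λ w → w ≡ a ⊎ w ≡ b)) ⊎ (a ≢ b × ∃ (Disconnecting (G C) (λ w → w ≡ a ⊎ w ≡ b)))
  pair? a b with a ≟ b
  ... | yes e = inj₁ (λ ne → ⊥-elim (ne e))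
  ... | no ne with connOff? (G C) (λ w → (w ≟ a) ⊎-dec (w ≟ b))
  ... | inj₁ off = inj₁ (λ _ → off)
  ... | inj₂ d = inj₂ (ne , d)

  module _ (gr : IsGraph (G C)) where

    separated : (∃ λ a → ∃ λ b → a ≢ b × ∃ (Disconnecting (G C) (λ w → w ≡ a ⊎ w ≡ b))) → Constructible C
    separated (a , b , ne , I , s) = fromC C feas (CycleConfig.c-config B gr (λ v → At.two-nbrs (all-sep hs v)) (At.four hs))
      where
      open Separated B gr
      hs : HasSep a
      hs = b , I , ne , s

    graph : Constructible C
    graph with ℕ.m≤n⇒m<n∨m≡n n≥2
    ... | inj₂ two = fromK C feas (TwoVertices.k-config B gr (sym two))
    ... | inj₁ n≥3 = [ (λ off → fromK C feas (Complete.k-config B gr n≥3 off)) , separated ]′ (∀⊎∃ (λ a → ∀⊎∃ (pair? a)))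

  by-size : (∀ e → ∣ inc (G C) e ∣ ≡ 2) ⊎ (∃ λ e → ∣ inc (G C) e ∣ ≢ 2) → Constructible C
  by-size (inj₁ gr) = graph gr
  by-size (inj₂ (e , large)) = fromE C feas (Block.Hyperedge.e-config B e large)

-- H has no edges, so a single colour would be an independent transversal; hence the fibre is empty.
-- This is the K-configuration with n = 1 and no classes, for which t = 1 is as good as any
-- multiplicity.
single-vertex⇒constructible : ∀ {C} → Feasible C → MinUnc C → nV (G C) ≡ 1 → Constructible C
single-vertex⇒constructible {C} feas mu one = fromK C feas
  (1 , s≤s z≤n , ℕ.≤-reflexive (sym one) , ((λ e → ⊥-elim (no-edge e)) , λ u v ne → ⊥-elim (ne (unique u v))) ,
   (λ x → ⊥-elim (no-H x)) , (λ v i → ⊥-elim (no-class one i)) , (λ ẽ → ⊥-elim (no-H-edge ẽ)) , λ x → ⊥-elim (no-H x))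
  where
  unique : ∀ (u v : Fin (nV (G C))) → u ≡ v
  unique = Fin1-unique one
  no-edge : Fin (nE (G C)) → ⊥₀
  no-edge e = let p , q , _ , _ , ne = ∣∣≥2⁻ {p = inc (G C) e} (size (G C) e) in ne (unique q p)
  no-H-edge : Fin (nE (H C)) → ⊥₀
  no-H-edge ẽ = no-edge (proj₁ (proj₂ (proj₂ feas)) ẽ)
  no-H : Fin (nV (H C)) → ⊥₀
  no-H x = proj₁ mu (λ _ → x) (λ v → unique _ v) (λ ẽ → ⊥-elim (no-H-edge ẽ))
  no-class : ∀ {n} → n ≡ 1 → Fin (n ∸ 1) → ⊥₀
  no-class refl ()

-- `Connected` admits the hypergraph without vertices; there the empty set is an independent
-- transversal.
has-vertex : ∀ {C} → Feasible C → MinUnc C → nV (G C) ≢ 0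
has-vertex {C} feas mu none = proj₁ mu (λ v → ⊥-elim (none-such v)) (λ v → ⊥-elim (none-such v))
    (λ ẽ → ⊥-elim (no-edge (proj₁ (proj₂ (proj₂ feas)) ẽ)))
  where
  none-such : Fin (nV (G C)) → ⊥₀
  none-such v = Fₚ.¬Fin0 (subst Fin none v)
  no-edge : Fin (nE (G C)) → ⊥₀
  no-edge e = let p , _ = ∣∣≥2⁻ {p = inc (G C) e} (size (G C) e) in none-such p

-- The bound k on the number of vertices drives the induction: both parts of a split have fewer
-- vertices, but neither is a subterm of C.
minUnc⇒constructible : ∀ k C → nV (G C) ≤ k → Feasible C → DegreeFeasible C → MinUnc C → Constructible C
minUnc⇒constructible k C le feas df mu with nV (G C) ℕ.≟ 0 | nV (G C) ℕ.≟ 1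
... | yes e | _ = ⊥-elim (has-vertex {C} feas mu e)
... | no _ | yes e = single-vertex⇒constructible {C} feas mu e
... | no n0 | no n1 = by-block k le (∀⊎∃ (λ v → connOff? (G C) (λ w → w ≟ v)))
  where
  n≥2 : 2 ≤ nV (G C)
  n≥2 = ℕ.≤∧≢⇒< (ℕ.≤∧≢⇒< z≤n (λ e → n0 (sym e))) (λ e → n1 (sym e))
  sec : ∃ λ (c : Fin (nV (G C)) → Fin (nV (H C))) → ∀ v → proj C (c v) ≡ v
  sec = section-exists C (proj₁ feas) df n≥2
  by-block : ∀ k → nV (G C) ≤ k → (∀ v → ConnOff (G C) (_≡ v)) ⊎ (∃ λ v → ∃ (Disconnecting (G C) (_≡ v))) → Constructible C
  by-block k le (inj₁ block) = block⇒constructible feas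
    (record { con = proj₁ feas ; cov = proj₂ feas ; df = df ; unc = proj₁ mu ; c₀ = proj₁ sec ; sec₀ = proj₂ sec ; block = block }) n≥2
  by-block zero le (inj₂ _) = ⊥-elim (n0 (ℕ.n≤0⇒n≡0 le))
  by-block (suc k) le (inj₂ (v , W , dis)) =
    let C₁ , C₂ , m , (f₁ , d₁ , u₁ , l₁) , (f₂ , d₂ , u₂ , l₂) = Split.split C (proj₁ feas) (proj₂ feas) df mu (proj₁ sec)
            (proj₂ sec) v W dis
    in merge C C₁ C₂ (minUnc⇒constructible k C₁ (ℕ.≤-pred (ℕ.≤-trans l₁ le)) f₁ d₁ u₁)
                     (minUnc⇒constructible k C₂ (ℕ.≤-pred (ℕ.≤-trans l₂ le)) f₂ d₂ u₂) m

theorem2 : (C : Config) → Feasible C → DegreeFeasible C →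
    MinUncolorable C ⇔ Constructible C
theorem2 C feas df = mk⇔
  (λ mu → minUnc⇒constructible (nV (G C)) C ℕ.≤-refl feas df (minUnc⁻ {C} mu))
  (λ k → minUnc⁺ {C} (proj₁ (constructible⇒critical k)))
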